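{- Let $\mathscr G=(X,\mathcal L)$ be an interval greedoid, let $1\le k<\mathrm{rk}(\mathscr G)$, and let $q:\mathcal L\to\mathbb R_{>0}$ be a $k$-admissible weight function. Then $$\mathrm L_q(k)^2\ \ge\ \mathrm L_q(k-1)\cdot\mathrm L_q(k+1),\qquad\text{where } \mathrm L_q(j)=\sum_{\alpha\in\mathcal L,\ |\alpha|=j}q(\alpha).$$
   Context: **Greedoids.** Let $X$ be a finite set, $X^*$ the set of finite words in $X$; a word is simple if no letter repeats; $|\alpha|$ is the length of $\alpha$. A greedoid is a pair $\mathscr G=(X,\mathcal L)$ with $\mathcal L\subset X^*$ finite such that: the empty word is in $\mathcal L$; every $\alpha\in\mathcal L$ is simple; $\alpha\beta\in\mathcal L\Rightarrow\alpha\in\mathcal L$; and if $\alpha,\beta\in\mathcal L$ with $|\alpha|>|\beta|$ then there is a letter $x$ of $\alpha$ with $\beta x\in\mathcal L$. $\mathrm{rk}(\mathscr G)=\max\{|\alpha|:\alpha\in\mathcal L\}$. It is an interval greedoid if moreover for all $\alpha,\beta,\gamma\in X^*$, $x\in X$: $\alpha x,\ \alpha\beta\gamma x\in\mathcal L\Rightarrow\alpha\beta x\in\mathcal L$. **Notation.** For $\alpha\in\mathcal L$: $\mathrm{Cont}_r(\alpha)=\{\beta\in X^*:|\beta|=r,\ \alpha\beta\in\mathcal L\}$, $\mathrm{Cont}(\alpha)=\mathrm{Cont}_1(\alpha)$ (and these sets are empty if $\alpha\notin\mathcal L$). On $\mathrm{Cont}(\alpha)$ the relation $x\sim_\alpha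 y\iff\alpha xy\notin\mathcal L$ is an equivalence relation; $\mathrm{Par}(\alpha)$ is the set of its classes. For $x\in\mathrm{Cont}(\alpha)$, $\mathrm{Des}_\alpha(x)=\{y\in X:\alpha xy\in\mathcal L,\ \alpha y\notin\mathcal L\}$. For $x,y\in X$, $\mathrm{Pas}_\alpha(x,y)=\{z\in X:\alpha z\notin\mathcal L,\ \alpha xz\notin\mathcal L,\ \alpha yz\notin\mathcal L,\ \alpha xyz\in\mathcal L\}$, $\mathrm{Act}_\alpha(x,y)=\{z\in X:\alpha z\notin\mathcal L,\ \alpha xz\in\mathcal L,\ \alpha yz\in\mathcal L,\ \alpha xyz\in\mathcal L\}$. **$k$-admissible.** Let $m=\mathrm{rk}(\mathscr G)$ and $1\le k<m$. Extend $q:\mathcal L\to\mathbb R_{>0}$ to $X^*$ by $0$ outside $\mathcal L$. $q$ is $k$-admissible if there is a scale sequence $(c_0,\dots,c_m)\in\mathbb R_{>0}^{m+1}$ such that, with $\omega(\alpha):=q(\alpha)/c_{|\alpha|}$, the following hold for every $\alpha\in\mathcal L$ with $\ell:=|\alpha|<k$: 1. (ContInv) $q(\alpha xy\beta)=q(\alpha yx\beta)$ for all $x,y\in\mathrm{Cont}(\alpha)$, $\beta\in X^*$. 2. (PAMon) for all distinct $x,y\in\mathrm{Cont}(\alpha)$ and all $r\ge0$: $\sum_{z\in\mathrm{Pas}_\alpha(x,y)}\sum_{\beta\in\mathrm{Cont}_r(\alpha xyz)}q(\alpha xyz\beta)\ \ge\ \sum_{z\in\mathrm{Act}_\alpha(x,y)}\sum_{\beta\in\mathrm{Cont}_r(\alpha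 xyz)}q(\alpha xyz\beta)$. 3. (LogMod) $\omega(\alpha x)\,\omega(\alpha y)=\omega(\alpha)\,\omega(\alpha xy)$ for all $x,y\in\mathrm{Cont}(\alpha)$ with $\alpha xy\in\mathcal L$. 4. (FewDes) for every $\mathcal C\in\mathrm{Par}(\alpha)$ with $|\mathcal C|\ge2$ and every $x\in\mathcal C$: $\mathrm{Des}_\alpha(x)=\varnothing$. 5. (SynMon) $\omega(\alpha x)^2\ge\sum_{y\in\mathrm{Des}_\alpha(x)}\omega(\alpha)\,\omega(\alpha xy)$ for all $x\in\mathrm{Cont}(\alpha)$. 6. (ScaleMon) $\Bigl(1-\frac{c_{\ell+1}^2}{c_\ell c_{\ell+2}}\Bigr)\sum_{\mathcal C\in\mathrm{Par}(\alpha)}\frac{1}{1-b_\alpha(\mathcal C)}\le1$, where $b_\alpha(\mathcal C)=\sum_{y\in\mathrm{Des}_\alpha(x)}\frac{\omega(\alpha)\omega(\alpha xy)}{\omega(\alpha x)^2}$ if $\mathcal C=\{x\}$ and $b_\alpha(\mathcal C)=0$ if $|\mathcal C|\ge2$. Convention: this is considered satisfied whenever $c_{\ell+1}^2\ge c_\ell c_{\ell+2}$; and when $c_{\ell+1}^2<c_\ell c_{\ell+2}$ it includes the requirement $b_\alpha(\mathcal C)<1$ for all $\mathcal C\in\mathrm{Par}(\alpha)$. -}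

module Defs where

open import Level using (_⊔_) renaming (suc to lsuc)
open import Algebra.Apartness.Bundles using (HeytingCommutativeRing; HeytingField)
open import Algebra.Bundles using (CommutativeRing)
import Algebra.Apartness.Properties.HeytingCommutativeRing as HeytingProperties
import Algebra.Definitions.RawMonoid as RawMonoidDefinitions
open import Data.Fin.Base using (Fin)
import Data.Fin.Properties as Fin
open import Data.List.Base
  using (List; []; _∷_; _++_; allFin; cartesianProductWith; deduplicate; filter; foldr; length; map)
open import Data.List.Membership.Propositional using (_∈_; mapWith∈)
open import Data.List.Membership.Propositional.Properties using (∈-deduplicate⁻; ∈-filter⁻; ∈-map⁻)
open import Data.List.Properties using (≡-dec)
open import Data.List.Relation.Unary.Any using (here)
open import Data.List.Relation.Unary.Unique.Propositional using (Unique)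
import Data.Nat.Base as ℕ
open ℕ using (ℕ; suc)
open import Data.Product.Base using (Σ-syntax; ∃; ∃-syntax; _×_; _,_; proj₁; proj₂)
open import Data.Sum.Base using (_⊎_; inj₁; inj₂)
open import Function.Bundles using (_⇔_; Equivalence)
open import Relation.Binary.Core using (Rel)
open import Relation.Binary.PropositionalEquality using (_≡_; _≢_; refl)
open import Relation.Binary.Structures using (IsStrictPartialOrder)
open import Relation.Nullary.Decidable using (¬?; _×-dec_)
open import Relation.Nullary.Negation using (¬_)
open import Relation.Unary using (Pred; Decidable)

------------------------------------------------------------------------
-- The real numbers

-- ℝ is given by its axioms: a Cauchy complete Archimedean ordered field.
-- Classically this determines ℝ up to unique isomorphism.  The axioms are
-- the constructive ones (no decidability of the order is assumed), so
-- they also hold of Bishop's regular sequences of rationals.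

record Reals c ℓ₁ ℓ₂ : Set (lsuc (c ⊔ ℓ₁ ⊔ ℓ₂)) where
  infix 4 _<_ _≤_
  infixl 7 _÷_⟨_⟩
  field
    heytingField : HeytingField c ℓ₁ ℓ₂
  open HeytingField heytingField public
  open RawMonoidDefinitions
    (CommutativeRing.+-rawMonoid (HeytingCommutativeRing.commutativeRing heytingCommutativeRing)) public
    using () renaming (_×_ to _·_)

  field
    _<_                    : Rel Carrier ℓ₂
    <-isStrictPartialOrder : IsStrictPartialOrder _≈_ _<_
    #⇔<⊎>                  : ∀ {x y} → x # y ⇔ (x < y ⊎ y < x)
    +-monoˡ-<              : ∀ {x y} z → x < y → x + z < y + z
    *-pos                  : ∀ {x y} → 0# < x → 0# < y → 0# < x * y
    archimedean            : ∀ x → ∃[ n ] x < n · 1#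

  IsCauchy : (ℕ → Carrier) → Set (c ⊔ ℓ₂)
  IsCauchy s = ∀ ε → 0# < ε →
    ∃[ N ] (∀ i j → N ℕ.≤ i → N ℕ.≤ j → s i - s j < ε)

  _ConvergesTo_ : (ℕ → Carrier) → Carrier → Set (c ⊔ ℓ₂)
  s ConvergesTo x = ∀ ε → 0# < ε →
    ∃[ N ] (∀ i → N ℕ.≤ i → s i - x < ε × x - s i < ε)

  field
    complete : ∀ s → IsCauchy s → ∃ (s ConvergesTo_)

  _≤_ : Rel Carrier ℓ₂
  x ≤ y = ¬ (y < x)

  open HeytingProperties heytingCommutativeRing public
    using (x#0y#0→xy#0; invertibleˡ⇒#; invertibleʳ⇒#; x-0≈x)

  -- The library's field axiom inverts differences x - y with x # y.
  recip : ∀ x → x # 0# → Carrier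
  recip x x#0 = proj₁ (#⇒invertible x#0)

  _÷_⟨_⟩ : Carrier → ∀ y → y # 0# → Carrier
  x ÷ y ⟨ y#0 ⟩ = x * recip y y#0

  <⇒# : ∀ {x y} → x < y → y # x
  <⇒# x<y = Equivalence.from #⇔<⊎> (inj₂ x<y)

  recip#0 : ∀ x (x#0 : x # 0#) → recip x x#0 # 0#
  recip#0 x x#0 = invertibleʳ⇒# (x - 0# , trans (*-congʳ (x-0≈x _)) inverseˡ)
    where
    inverseˡ = proj₁ (proj₂ (#⇒invertible x#0))

  ÷#0 : ∀ {x y} → x # 0# → (y#0 : y # 0#) → x ÷ y ⟨ y#0 ⟩ # 0#
  ÷#0 x#0 y#0 = x#0y#0→xy#0 x#0 (recip#0 _ y#0)

  <⇒-#0 : ∀ {x y} → x < y → y - x # 0#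
  <⇒-#0 {x} {y} x<y = invertibleˡ⇒#
    (proj₁ inv , trans (*-congˡ (x-0≈x _)) (proj₁ (proj₂ inv)))
    where
    inv = #⇒invertible (<⇒# x<y)

  ∑ : ∀ {a} {A : Set a} → List A → (A → Carrier) → Carrier
  ∑ xs f = foldr _+_ 0# (map f xs)

  ∑∈ : ∀ {a} {A : Set a} (xs : List A) → (∀ {x} → x ∈ xs → Carrier) → Carrier
  ∑∈ xs f = foldr _+_ 0# (mapWith∈ xs f)

------------------------------------------------------------------------
-- Greedoids

Word : ℕ → Set
Word n = List (Fin n)

words : ∀ {n} (r : ℕ) → List (Word n)
words ℕ.zero  = [] ∷ []
words (suc r) = cartesianProductWith _∷_ (allFin _) (words r)

-- A finite language is a decidable predicate on words; finiteness is
-- then a consequence of `simple`.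

record Greedoid (n : ℕ) ℓ : Set (lsuc ℓ) where
  field
    ℒ          : Pred (Word n) ℓ
    ℒ?         : Decidable ℒ
    empty      : ℒ []
    simple     : ∀ {α} → ℒ α → Unique α
    hereditary : ∀ α β → ℒ (α ++ β) → ℒ α
    exchange   : ∀ {α β} → ℒ α → ℒ β → length β ℕ.< length α →
                 ∃[ x ] (x ∈ α × ℒ (β ++ x ∷ []))

  Cont : Word n → List (Fin n)
  Cont α = filter (λ x → ℒ? (α ++ x ∷ [])) (allFin n)

  Cont[_] : ℕ → Word n → List (Word n)
  Cont[ r ] α = filter (λ β → ℒ? (α ++ β)) (words r)

  infix 4 _∼[_]_
  _∼[_]_ : Fin n → Word n → Fin n → Set ℓ
  x ∼[ α ] y = ¬ ℒ (α ++ x ∷ y ∷ [])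

  class : Word n → Fin n → List (Fin n)
  class α x = filter (λ y → ¬? (ℒ? (α ++ x ∷ y ∷ []))) (Cont α)

  -- Every class lists its letters in the order of allFin n, so two
  -- classes are equal as sets exactly when they are equal as lists.
  Par : Word n → List (List (Fin n))
  Par α = deduplicate (≡-dec Fin._≟_) (map (class α) (Cont α))

  Des : Word n → Fin n → List (Fin n)
  Des α x = filter
    (λ y → ℒ? (α ++ x ∷ y ∷ []) ×-dec ¬? (ℒ? (α ++ y ∷ []))) (allFin n)

  Pas : Word n → Fin n → Fin n → List (Fin n)
  Pas α x y = filter
    (λ z → ¬? (ℒ? (α ++ z ∷ []))
     ×-dec ¬? (ℒ? (α ++ x ∷ z ∷ []))
     ×-dec ¬? (ℒ? (α ++ y ∷ z ∷ []))
     ×-dec ℒ? (α ++ x ∷ y ∷ z ∷ [])) (allFin n)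

  Act : Word n → Fin n → Fin n → List (Fin n)
  Act α x y = filter
    (λ z → ¬? (ℒ? (α ++ z ∷ []))
     ×-dec ℒ? (α ++ x ∷ z ∷ [])
     ×-dec ℒ? (α ++ y ∷ z ∷ [])
     ×-dec ℒ? (α ++ x ∷ y ∷ z ∷ [])) (allFin n)

  Cont⇒ℒ : ∀ {α x} → x ∈ Cont α → ℒ (α ++ x ∷ [])
  Cont⇒ℒ {α} x∈ = proj₂ (∈-filter⁻ (λ x → ℒ? (α ++ x ∷ [])) {xs = allFin n} x∈)

  Par⇒Cont : ∀ {α 𝒞 x} → 𝒞 ∈ Par α → x ∈ 𝒞 → x ∈ Cont α
  Par⇒Cont {α} {𝒞} {x} 𝒞∈ x∈
    with ∈-map⁻ (class α) (∈-deduplicate⁻ (≡-dec Fin._≟_) (map (class α) (Cont α)) 𝒞∈)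
  ... | y , _ , refl = proj₁ (∈-filter⁻ (λ z → ¬? (ℒ? (α ++ y ∷ z ∷ []))) {xs = Cont α} x∈)

IsInterval : ∀ {n ℓ} → Greedoid n ℓ → Set ℓ
IsInterval 𝒢 = ∀ α β γ x →
  ℒ (α ++ x ∷ []) → ℒ (α ++ β ++ γ ++ x ∷ []) → ℒ (α ++ β ++ x ∷ [])
  where open Greedoid 𝒢

-- m = max { |α| : α ∈ ℒ }
HasRank : ∀ {n ℓ} → Greedoid n ℓ → ℕ → Set ℓ
HasRank 𝒢 m = (∃[ α ] (ℒ α × length α ≡ m)) × (∀ α → ℒ α → length α ℕ.≤ m)
  where open Greedoid 𝒢

------------------------------------------------------------------------
-- Weights

module Weighted {c ℓ₁ ℓ₂ n ℓ} (ℛ : Reals c ℓ₁ ℓ₂) (𝒢 : Greedoid n ℓ) where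
  open Reals ℛ hiding (refl)
  open Greedoid 𝒢

  -- A function ℒ → ℝ>0, extended by 0 to all words.
  record Weight : Set (c ⊔ ℓ₁ ⊔ ℓ₂ ⊔ ℓ) where
    field
      q      : Word n → Carrier
      q-pos  : ∀ {α} → ℒ α → 0# < q α
      q-zero : ∀ {α} → ¬ ℒ α → q α ≈ 0#

  L : Weight → ℕ → Carrier
  L w j = ∑ (filter ℒ? (words j)) q
    where open Weight w

  -- The terms after the rank of 𝒢 are irrelevant: a condition at α of
  -- length ℓ < k < rank only involves c₀, …, c_{ℓ+2}.
  record Scale : Set (c ⊔ ℓ₂) where
    field
      at     : ℕ → Carrier
      at-pos : ∀ i → 0# < at i

  module Conditions (w : Weight) (s : Scale) where
    open Weight w
    open Scale s

    ω : Word n → Carrier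
    ω α = q α ÷ at (length α) ⟨ <⇒# (at-pos (length α)) ⟩

    ω#0 : ∀ {α} → ℒ α → ω α # 0#
    ω#0 α∈ = ÷#0 (<⇒# (q-pos α∈)) (<⇒# (at-pos _))

    -- b is only meaningful on classes; the membership proof is what makes
    -- the denominator ω(αx)² invertible when 𝒞 = {x}.
    b : ∀ α {𝒞} → 𝒞 ∈ Par α → Carrier
    b α {x ∷ []} 𝒞∈ = ∑ (Des α x) λ y →
      (ω α * ω (α ++ x ∷ y ∷ [])) ÷ (ω (α ++ x ∷ []) * ω (α ++ x ∷ [])) ⟨ x#0y#0→xy#0 ωαx#0 ωαx#0 ⟩
      where
      ωαx#0 : ω (α ++ x ∷ []) # 0#
      ωαx#0 = ω#0 (Cont⇒ℒ (Par⇒Cont 𝒞∈ (here refl)))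
    b α {_}      _  = 0#

    ContInv : Pred (Word n) ℓ₁
    ContInv α = ∀ x y β → x ∈ Cont α → y ∈ Cont α →
      q (α ++ x ∷ y ∷ β) ≈ q (α ++ y ∷ x ∷ β)

    PAMon : Pred (Word n) ℓ₂
    PAMon α = ∀ x y r → x ∈ Cont α → y ∈ Cont α → x ≢ y →
      ∑ (Act α x y) (λ z → ∑ (Cont[ r ] (α ++ x ∷ y ∷ z ∷ [])) λ β → q (α ++ x ∷ y ∷ z ∷ β))
      ≤
      ∑ (Pas α x y) (λ z → ∑ (Cont[ r ] (α ++ x ∷ y ∷ z ∷ [])) λ β → q (α ++ x ∷ y ∷ z ∷ β))

    LogMod : Pred (Word n) (ℓ₁ ⊔ ℓ)
    LogMod α = ∀ x y → x ∈ Cont α → y ∈ Cont α → ℒ (α ++ x ∷ y ∷ []) →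
      ω (α ++ x ∷ []) * ω (α ++ y ∷ []) ≈ ω α * ω (α ++ x ∷ y ∷ [])

    FewDes : Word n → Set
    FewDes α = ∀ {𝒞} → 𝒞 ∈ Par α → 2 ℕ.≤ length 𝒞 → ∀ {x} → x ∈ 𝒞 → Des α x ≡ []

    SynMon : Pred (Word n) ℓ₂
    SynMon α = ∀ x → x ∈ Cont α →
      ∑ (Des α x) (λ y → ω α * ω (α ++ x ∷ y ∷ []))
      ≤ ω (α ++ x ∷ []) * ω (α ++ x ∷ [])

    -- The convention that the condition is void when c_{ℓ+1}² ≥ c_ℓ c_{ℓ+2}
    -- is the antecedent.
    ScaleMon : Pred (Word n) ℓ₂
    ScaleMon α = cₗ₊₁ * cₗ₊₁ < cₗ * cₗ₊₂ →
      Σ[ b<1 ∈ (∀ {𝒞} (𝒞∈ : 𝒞 ∈ Par α) → b α 𝒞∈ < 1#) ]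
        (1# - (cₗ₊₁ * cₗ₊₁) ÷ (cₗ * cₗ₊₂) ⟨ <⇒# (*-pos (at-pos _) (at-pos _)) ⟩)
          * ∑∈ (Par α) (λ 𝒞∈ → 1# ÷ (1# - b α 𝒞∈) ⟨ <⇒-#0 (b<1 𝒞∈) ⟩)
        ≤ 1#
      where
      cₗ cₗ₊₁ cₗ₊₂ : Carrier
      cₗ   = at (length α)
      cₗ₊₁ = at (suc (length α))
      cₗ₊₂ = at (suc (suc (length α)))

  record Admissible (k : ℕ) (w : Weight) : Set (c ⊔ ℓ₁ ⊔ ℓ₂ ⊔ ℓ) where
    field
      scale : Scale
    open Conditions w scale
    field
      contInv  : ∀ {α} → ℒ α → length α ℕ.< k → ContInv α
      paMon    : ∀ {α} → ℒ α → length α ℕ.< k → PAMon α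
      logMod   : ∀ {α} → ℒ α → length α ℕ.< k → LogMod α
      fewDes   : ∀ {α} → ℒ α → length α ℕ.< k → FewDes α
      synMon   : ∀ {α} → ℒ α → length α ℕ.< k → SynMon α
      scaleMon : ∀ {α} → ℒ α → length α ℕ.< k → ScaleMon α

{-# OPTIONS --safe #-}
-- Combinatorial atlas.  For α ∈ ℒ let A(α, m) be the symmetric matrix,
-- indexed by the letters and an extra index null, with entries L_α(m),
-- L_αx(m) and L_αxy(m), the last one moved to the diagonal entry of x when
-- y does not continue α.  Log-concavity is the reversed Cauchy inequality
-- (hyperbolicity) for A([], k - 1) between null and the sum of all letters.
-- Hyperbolicity is proved by induction on m.  For m = 0 it is a computation
-- with the classes of Par(α).  For the step, e A(α, m + 1) + A(α, m) with
-- e > 0 is expressed through the matrices A(αx, m) and A(α, m); their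
-- hyperbolicity and the pullback inequality (which is PAMon) show that the
-- normalised matrix N satisfies N² ≥ N, and N ≤ 1 with a simple eigenvalue 1
-- leaves no other positive eigenvalue.  Finally e → ∞.  Instead of the
-- spectral theorem, a Poisson equation for the Laplacian of N is solved.
module Submission where

open import Data.Nat.Base using (ℕ; suc; _∸_) renaming (_≤_ to _≤ℕ_; _<_ to _<ℕ_)
open import Level using (Level)
open import Defs

open import Algebra.Apartness.Bundles using (HeytingCommutativeRing)
import Algebra.Apartness.Properties.HeytingCommutativeRing as HeytingProperties
open import Algebra.Bundles using (CommutativeRing)
open import Algebra.Bundles.Raw using (RawRing)
import Algebra.Properties.AbelianGroup as AbelianGroupProperties
import Algebra.Properties.Ring as RingProperties
import Algebra.Properties.Semiring.Mult as Mult
import Algebra.Properties.Semiring.Sum as Sum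
import Algebra.Solver.Ring
open import Algebra.Solver.Ring.AlmostCommutativeRing
  using (fromCommutativeRing; _-Raw-AlmostCommutative⟶_)
open import Data.Bool.Base using (Bool; true; false; if_then_else_)
open import Data.Fin.Base using (Fin; zero; suc; punchIn)
import Data.Fin.Properties as Fin
open import Data.Integer.Base as ℤ using (ℤ; +_; -[1+_])
import Data.Integer.Properties as ℤ
open import Data.List.Base
  using (List; []; _∷_; _++_; allFin; cartesianProductWith; filter; length; map; tabulate)
open import Data.List.Membership.Propositional using (_∈_)
open import Data.List.Membership.Propositional.Properties
  using (∈-filter⁺; ∈-filter⁻; ∈-allFin; ∈-map⁺; ∈-map⁻; ∈-++⁺ʳ; ∈-++⁻;
         ∈-cartesianProductWith⁺; ∈-deduplicate⁺; ∈-deduplicate⁻)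
open import Data.List.Properties using (++-assoc; ++-identityʳ; length-++; ≡-dec)
import Data.List.Relation.Unary.All as All
open import Data.List.Relation.Unary.AllPairs using (_∷_)
open import Data.List.Relation.Unary.Any using (here; there)
open import Data.List.Relation.Unary.Unique.DecPropositional.Properties using (deduplicate-!)
open import Data.List.Relation.Unary.Unique.Propositional using (Unique)
open import Data.Maybe.Base using (Maybe; just; nothing)
open import Data.Nat.Base as ℕ using (zero)
import Data.Nat.Properties as ℕ
open import Data.Product.Base using (∃; ∃-syntax; _×_; _,_; proj₁; proj₂)
open import Data.Sum.Base using (_⊎_; inj₁; inj₂; [_,_]′)
open import Function.Base using (id)
open import Function.Bundles using (Equivalence; mk⇔)
open import Relation.Binary.PropositionalEquality as ≡ using (_≡_; _≢_)
open import Relation.Binary.Structures using (IsStrictPartialOrder)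
open import Relation.Nullary.Decidable using (Dec; does; yes; no; ¬?; _×-dec_; does-⇔)
open import Relation.Nullary.Negation using (¬_; contradiction)
open import Relation.Unary using (Pred; Decidable)

-- Let P be the pencil rescaled so that the distinguished vector is constantly 1, D the diagonal of
-- its row sums, and N = D⁻¹P on the support of P. In the inner product weighted by D the matrix N
-- fixes the constants and 1 - N is a Dirichlet form; the eigenvalue 1 is simple because null is
-- joined to every letter of the support. Spectrally, t ≤ t² and t ≤ 1 leave only t = 1 or t ≤ 0.
-- Instead of using eigenvectors, one solves w = v - Nv for w orthogonal to the constants. Then ⟨w,
-- Nw⟩ = ⟨v, Nv⟩ - 2⟨Nv, Nv⟩ + ⟨Nv, NNv⟩ ≤ ⟨v, Nv⟩ - ⟨Nv, Nv⟩ ≤ 0, by N ≤ 1 at Nv and N ≤ N² at v.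
--
-- The pencil has its form because A(α, m), applied to the vector with 1 at null and e at the
-- letters, gives the null column of e A(α, m + 1) + A(α, m), so that one vector serves all
-- neighbours. Its limit direction, 0 at null and 1 at the letters, would erase the row of null and
-- with it the hub; hence e stays finite until the last step.

filter-cong : ∀ {a p q} {A : Set a} {P : Pred A p} {Q : Pred A q} (P? : Decidable P) (Q? : Decidable Q) (xs : List A) →
  (∀ {x} → x ∈ xs → does (P? x) ≡ does (Q? x)) → filter P? xs ≡ filter Q? xs
filter-cong P? Q? []       eq = ≡.refl
filter-cong P? Q? (x ∷ xs) eq with does (P? x) | does (Q? x) | eq (here ≡.refl) | filter-cong P? Q? xs (λ p → eq (there p))
... | true  | _ | ≡.refl | ih = ≡.cong (x ∷_) ih
... | false | _ | ≡.refl | ih = ih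

unique-disjoint : ∀ {a} {A : Set a} {x : A} xs {ys} → Unique (xs ++ ys) → x ∈ xs → ¬ x ∈ ys
unique-disjoint (y ∷ xs) (y∉ ∷ _) (here ≡.refl) x∈ys = All.lookup y∉ (∈-++⁺ʳ xs x∈ys) ≡.refl
unique-disjoint (y ∷ xs) (_ ∷ u)  (there x∈xs)  x∈ys = unique-disjoint xs u x∈xs x∈ys

-- Ring solver with integer coefficients.

module IntegerCoefficients {c ℓ} (R : CommutativeRing c ℓ) where
  open CommutativeRing R
  open Mult semiring using (×-homo-+; ×1-homo-*) renaming (_×_ to _·_)
  open RingProperties ring
  open AbelianGroupProperties +-abelianGroup using (⁻¹-∙-comm)
  open import Relation.Binary.Reasoning.Setoid setoid

  -- The ring solver compares its coefficients by a test, which ℤ has and the carrier has not. The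
  -- values at 0 and 1 are special-cased so that `con (+ 0)` and `con (+ 1)` denote `0#` and `1#`
  -- definitionally, and not `1# + 0#`.
  embed : ℤ → Carrier
  embed (+ 0)             = 0#
  embed (+ 1)             = 1#
  embed (+ (suc (suc n))) = suc (suc n) · 1#
  embed -[1+ n ]          = - (suc n · 1#)

  embed-+ : ∀ n → embed (+ n) ≈ n · 1#
  embed-+ 0             = refl
  embed-+ 1             = sym (+-identityʳ 1#)
  embed-+ (suc (suc n)) = refl

  embed-⊖ : ∀ m n → embed (m ℤ.⊖ n) ≈ m · 1# - n · 1#
  embed-⊖ m       0       = begin
    embed (m ℤ.⊖ 0)   ≡⟨⟩
    embed (+ m)       ≈⟨ embed-+ m ⟩
    m · 1#            ≈⟨ +-identityʳ _ ⟨
    m · 1# + 0#       ≈⟨ +-congˡ -0#≈0# ⟨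
    m · 1# - 0#       ∎
  embed-⊖ 0       (suc n) = sym (+-identityˡ _)
  embed-⊖ (suc m) (suc n) = begin
    embed (suc m ℤ.⊖ suc n)               ≡⟨ ≡.cong embed (ℤ.[1+m]⊖[1+n]≡m⊖n m n) ⟩
    embed (m ℤ.⊖ n)                       ≈⟨ embed-⊖ m n ⟩
    m · 1# - n · 1#                       ≈⟨ +-congʳ (+-identityˡ _) ⟨
    0# + m · 1# - n · 1#                  ≈⟨ +-congʳ (+-congʳ (-‿inverseʳ 1#)) ⟨
    1# - 1# + m · 1# - n · 1#             ≈⟨ +-congʳ (+-assoc _ _ _) ⟩
    1# + (- 1# + m · 1#) - n · 1#         ≈⟨ +-congʳ (+-congˡ (+-comm _ _)) ⟩
    1# + (m · 1# - 1#) - n · 1#           ≈⟨ +-congʳ (+-assoc _ _ _) ⟨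
    1# + m · 1# - 1# - n · 1#             ≈⟨ +-assoc _ _ _ ⟩
    1# + m · 1# + (- 1# - n · 1#)         ≈⟨ +-congˡ (⁻¹-∙-comm _ _) ⟩
    suc m · 1# - suc n · 1#               ∎

  embed-neg : ∀ i → embed (ℤ.- i) ≈ - embed i
  embed-neg (+ 0)             = sym -0#≈0#
  embed-neg (+ 1)             = -‿cong (+-identityʳ 1#)
  embed-neg (+ (suc (suc n))) = refl
  embed-neg -[1+ n ]          = trans (embed-+ (suc n)) (sym (-‿involutive _))

  embed-+-homo : ∀ i j → embed (i ℤ.+ j) ≈ embed i + embed j
  embed-+-homo (+ m) (+ n) = trans (embed-+ (m ℕ.+ n))
    (trans (×-homo-+ 1# m n) (sym (+-cong (embed-+ m) (embed-+ n))))
  embed-+-homo (+ m) -[1+ n ] = trans (embed-⊖ m (suc n)) (+-congʳ (sym (embed-+ m)))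
  embed-+-homo -[1+ m ] (+ n) = trans (embed-⊖ n (suc m))
    (trans (+-comm _ _) (+-congˡ (sym (embed-+ n))))
  embed-+-homo -[1+ m ] -[1+ n ] = begin
    - (suc (suc (m ℕ.+ n)) · 1#)       ≡⟨ ≡.cong (λ k → - (suc k · 1#)) (ℕ.+-suc m n) ⟨
    - ((suc m ℕ.+ suc n) · 1#)         ≈⟨ -‿cong (×-homo-+ 1# (suc m) (suc n)) ⟩
    - (suc m · 1# + suc n · 1#)        ≈⟨ ⁻¹-∙-comm _ _ ⟨
    - (suc m · 1#) - suc n · 1#        ∎

  embed-*⁺ : ∀ m n → embed (+ m ℤ.* + n) ≈ embed (+ m) * embed (+ n)
  embed-*⁺ m n = begin
    embed (+ m ℤ.* + n)        ≡⟨ ≡.cong embed (ℤ.pos-* m n) ⟨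
    embed (+ (m ℕ.* n))        ≈⟨ embed-+ (m ℕ.* n) ⟩
    (m ℕ.* n) · 1#             ≈⟨ ×1-homo-* m n ⟩
    (m · 1#) * (n · 1#)        ≈⟨ *-cong (embed-+ m) (embed-+ n) ⟨
    embed (+ m) * embed (+ n)  ∎

  embed-*-homo : ∀ i j → embed (i ℤ.* j) ≈ embed i * embed j
  embed-*-homo (+ m) (+ n) = embed-*⁺ m n
  embed-*-homo (+ m) -[1+ n ] = begin
    embed (+ m ℤ.* (ℤ.- + suc n))      ≡⟨ ≡.cong embed (ℤ.neg-distribʳ-* (+ m) (+ suc n)) ⟨
    embed (ℤ.- (+ m ℤ.* + suc n))      ≈⟨ embed-neg (+ m ℤ.* + suc n) ⟩
    - embed (+ m ℤ.* + suc n)          ≈⟨ -‿cong (embed-*⁺ m (suc n)) ⟩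
    - (embed (+ m) * embed (+ suc n))  ≈⟨ -‿distribʳ-* _ _ ⟩
    embed (+ m) * - embed (+ suc n)    ≈⟨ *-congˡ (embed-neg (+ suc n)) ⟨
    embed (+ m) * embed -[1+ n ]       ∎
  embed-*-homo -[1+ m ] (+ n) = begin
    embed (ℤ.- + suc m ℤ.* + n)        ≡⟨ ≡.cong embed (ℤ.neg-distribˡ-* (+ suc m) (+ n)) ⟨
    embed (ℤ.- (+ suc m ℤ.* + n))      ≈⟨ embed-neg (+ suc m ℤ.* + n) ⟩
    - embed (+ suc m ℤ.* + n)          ≈⟨ -‿cong (embed-*⁺ (suc m) n) ⟩
    - (embed (+ suc m) * embed (+ n))  ≈⟨ -‿distribˡ-* _ _ ⟩
    - embed (+ suc m) * embed (+ n)    ≈⟨ *-congʳ (embed-neg (+ suc m)) ⟨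
    embed -[1+ m ] * embed (+ n)       ∎
  embed-*-homo -[1+ m ] -[1+ n ] = begin
    embed (+ suc m ℤ.* + suc n)            ≈⟨ embed-*⁺ (suc m) (suc n) ⟩
    embed (+ suc m) * embed (+ suc n)      ≈⟨ -‿involutive _ ⟨
    - - (embed (+ suc m) * embed (+ suc n)) ≈⟨ -‿cong (-‿distribˡ-* _ _) ⟩
    - (- embed (+ suc m) * embed (+ suc n)) ≈⟨ -‿distribʳ-* _ _ ⟩
    - embed (+ suc m) * - embed (+ suc n)  ≈⟨ *-cong (embed-neg (+ suc m)) (embed-neg (+ suc n)) ⟨
    embed -[1+ m ] * embed -[1+ n ]        ∎

  ℤ-rawRing : RawRing _ _
  ℤ-rawRing = record
    { _≈_ = _≡_ ; _+_ = ℤ._+_ ; _*_ = ℤ._*_ ; -_ = ℤ.-_ ; 0# = + 0 ; 1# = + 1 }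

  morphism : ℤ-rawRing -Raw-AlmostCommutative⟶ fromCommutativeRing R
  morphism = record
    { ⟦_⟧    = embed
    ; +-homo = embed-+-homo
    ; *-homo = embed-*-homo
    ; -‿homo = embed-neg
    ; 0-homo = refl
    ; 1-homo = refl
    }

  coefficient≟ : ∀ i j → Maybe (embed i ≈ embed j)
  coefficient≟ i j with i ℤ.≟ j
  ... | yes ≡.refl = just refl
  ... | no _       = nothing

  open Algebra.Solver.Ring ℤ-rawRing (fromCommutativeRing R) morphism coefficient≟ public
    using (solve; _:=_; _:+_; _:*_; _:-_; :-_; con)

-- Order arithmetic and finite sums over the reals.

module OrderedField {c ℓ₁ ℓ₂} (ℛ : Reals c ℓ₁ ℓ₂) where
  open Reals ℛ hiding (zero) public
  open IsStrictPartialOrder <-isStrictPartialOrder public using ()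
    renaming (irrefl to <-irrefl; trans to <-trans; <-resp-≈ to <-resp-≈; asym to <-asym)

  commutativeRing : CommutativeRing c ℓ₁
  commutativeRing = HeytingCommutativeRing.commutativeRing heytingCommutativeRing

  open IntegerCoefficients commutativeRing public
    using (solve; _:=_; _:+_; _:*_; _:-_; :-_; con)
  open CommutativeRing commutativeRing using (semiring)
  private module Σ = Sum semiring
  open import Relation.Binary.Reasoning.Setoid setoid

  private variable
    a b : Level
    x y z x′ y′ : Carrier

  -- The order is not decidable, but ≤, ≈ and ⊥ are stable, so a proof of
  -- one of them may be split according to any proposition.
  split : {P : Set a} {A : Set b} → (P → ¬ A) → (¬ P → ¬ A) → ¬ A
  split f g a = g (λ p → f p a) a

  <-resp : x ≈ x′ → y ≈ y′ → x < y → x′ < y′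
  <-resp p q x<y = proj₁ <-resp-≈ q (proj₂ <-resp-≈ p x<y)

  ≤-resp : x ≈ x′ → y ≈ y′ → x ≤ y → x′ ≤ y′
  ≤-resp p q x≤y y<x = x≤y (<-resp (sym q) (sym p) y<x)

  <⇒≤ : x < y → x ≤ y
  <⇒≤ = <-asym

  ≤-reflexive : x ≈ y → x ≤ y
  ≤-reflexive p = <-irrefl (sym p)

  ≤-antisym : x ≤ y → y ≤ x → x ≈ y
  ≤-antisym x≤y y≤x = proj₁ (tight _ _) λ x#y → [ y≤x , x≤y ]′ (Equivalence.to #⇔<⊎> x#y)

  split< : {A : Set a} → (x < y → ¬ A) → (y < x → ¬ A) → (x ≈ y → ¬ A) → ¬ A
  split< l g e = split l λ x≮y → split g λ y≮x → e (≤-antisym y≮x x≮y)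

  <⇒0<- : x < y → 0# < y - x
  <⇒0<- {x} p = <-resp (-‿inverseʳ x) refl (+-monoˡ-< (- x) p)

  0<-⇒< : 0# < y - x → x < y
  0<-⇒< {y} {x} p = <-resp (+-identityˡ x)
    (solve 2 (λ x y → y :- x :+ x := y) refl x y) (+-monoˡ-< x p)

  ≤⇒0≤- : x ≤ y → 0# ≤ y - x
  ≤⇒0≤- {x} {y} x≤y p = x≤y (<-resp
    (solve 2 (λ x y → y :- x :+ x := y) refl x y) (+-identityˡ x) (+-monoˡ-< x p))

  0≤-⇒≤ : 0# ≤ y - x → x ≤ y
  0≤-⇒≤ {y} {x} p y<x = p (<-resp refl (-‿inverseʳ x) (+-monoˡ-< (- x) y<x))

  ≤-by : 0# ≤ z → y - x ≈ z → x ≤ y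
  ≤-by p e = 0≤-⇒≤ (≤-resp refl (sym e) p)

  0≤-resp : x ≈ y → 0# ≤ x → 0# ≤ y
  0≤-resp = ≤-resp refl

  0<-resp : x ≈ y → 0# < x → 0# < y
  0<-resp = <-resp refl

  x<0⇒0<-x : x < 0# → 0# < - x
  x<0⇒0<-x p = <-resp refl (+-identityˡ _) (<⇒0<- p)

  0<-x⇒x<0 : 0# < - x → x < 0#
  0<-x⇒x<0 p = 0<-⇒< (<-resp refl (sym (+-identityˡ _)) p)

  0≤0 : 0# ≤ 0#
  0≤0 = ≤-reflexive refl

  +-pos : 0# < x → 0# < y → 0# < x + y
  +-pos {y = y} p q = <-trans q (<-resp (+-identityˡ y) refl (+-monoˡ-< y p))

  +-nonneg : 0# ≤ x → 0# ≤ y → 0# ≤ x + y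
  +-nonneg {x} {y} p q = split<
    (λ 0<x → split<
      (λ 0<y → <⇒≤ (+-pos 0<x 0<y))
      (λ y<0 → contradiction y<0 q)
      (λ 0≈y → <⇒≤ (<-resp refl (trans (sym (+-identityʳ x)) (+-congˡ 0≈y)) 0<x)))
    (λ x<0 → contradiction x<0 p)
    (λ 0≈x → ≤-resp refl (trans (sym (+-identityˡ y)) (+-congʳ 0≈x)) q)

  -- A strict inequality cannot be proved by a classical split. Cotransitivity of apartness, applied
  -- to 0 and x, sets `x + y` apart from one of them; the orders on the wrong side contradict
  -- nonnegativity.
  +-pos-nonneg : 0# < x → 0# ≤ y → 0# < x + y
  +-pos-nonneg {x} {y} p q with #-cotrans (Equivalence.from #⇔<⊎> (inj₁ p)) (x + y)
  ... | inj₁ 0#x+y = [ id , (λ x+y<0 → contradiction x+y<0 (+-nonneg (<⇒≤ p) q)) ]′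
                       (Equivalence.to #⇔<⊎> 0#x+y)
  ... | inj₂ x+y#x = [ (λ x+y<x → contradiction (0<-x⇒x<0 (0<-resp
                         (solve 2 (λ x y → x :- (x :+ y) := :- y) refl x y) (<⇒0<- x+y<x))) q)
                     , <-trans p ]′ (Equivalence.to #⇔<⊎> x+y#x)

  +-nonneg-pos : 0# ≤ x → 0# < y → 0# < x + y
  +-nonneg-pos p q = 0<-resp (+-comm _ _) (+-pos-nonneg q p)

  *-nonneg : 0# ≤ x → 0# ≤ y → 0# ≤ x * y
  *-nonneg {x} {y} p q = split<
    (λ 0<x → split<
      (λ 0<y → <⇒≤ (*-pos 0<x 0<y))
      (λ y<0 → contradiction y<0 q)
      (λ 0≈y → ≤-reflexive (trans (sym (zeroʳ x)) (*-congˡ 0≈y))))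
    (λ x<0 → contradiction x<0 p)
    (λ 0≈x → ≤-reflexive (trans (sym (zeroˡ y)) (*-congʳ 0≈x)))

  square-pos : x # 0# → 0# < x * x
  square-pos {x} x#0 with Equivalence.to #⇔<⊎> x#0
  ... | inj₁ x<0 = <-resp refl (solve 1 (λ x → (:- x) :* (:- x) := x :* x) refl x)
                     (*-pos (x<0⇒0<-x x<0) (x<0⇒0<-x x<0))
  ... | inj₂ 0<x = *-pos 0<x 0<x

  square-nonneg : ∀ x → 0# ≤ x * x
  square-nonneg x = split {P = x # 0#} (λ x#0 → <⇒≤ (square-pos x#0))
    (λ ¬x#0 → ≤-reflexive (trans (sym (zeroˡ x)) (*-congʳ (sym (proj₁ (tight _ _) ¬x#0)))))

  0<1 : 0# < 1#
  0<1 = 0<-resp (*-identityˡ 1#) (square-pos 1#0)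
    where open HeytingProperties heytingCommutativeRing using (1#0)

  ≤-trans : x ≤ y → y ≤ z → x ≤ z
  ≤-trans {x} {y} {z} p q = ≤-by (+-nonneg (≤⇒0≤- q) (≤⇒0≤- p))
    (solve 3 (λ x y z → z :- x := (z :- y) :+ (y :- x)) refl x y z)

  *-cancelˡ-nonneg : 0# < x → 0# ≤ x * y → 0# ≤ y
  *-cancelˡ-nonneg {x} {y} 0<x p y<0 = p (0<-x⇒x<0 (<-resp refl
    (solve 2 (λ x y → x :* (:- y) := :- (x :* y)) refl x y) (*-pos 0<x (x<0⇒0<-x y<0))))

  +-cancel-nonneg : 0# ≤ x + x → 0# ≤ x
  +-cancel-nonneg {x} p = *-cancelˡ-nonneg (+-pos 0<1 0<1) (0≤-resp
    (solve 1 (λ x → x :+ x := (con (+ 1) :+ con (+ 1)) :* x) refl x) p)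

  recip-inverse : ∀ x (x#0 : x # 0#) → x * recip x x#0 ≈ 1#
  recip-inverse x x#0 = trans (*-congʳ (sym (x-0≈x x))) (proj₂ (proj₂ (#⇒invertible x#0)))

  recip-pos : ∀ {x} (0<x : 0# < x) (x#0 : x # 0#) → 0# < recip x x#0
  recip-pos {x} 0<x x#0 with Equivalence.to #⇔<⊎> (recip#0 x x#0)
  ... | inj₂ 0<r = 0<r
  ... | inj₁ r<0 = contradiction 0<1 (<⇒≤ (0<-x⇒x<0 (0<-resp
    (trans (solve 2 (λ x r → x :* (:- r) := :- (x :* r)) refl x (recip x x#0))
      (-‿cong (recip-inverse x x#0)))
    (*-pos 0<x (x<0⇒0<-x r<0)))))

  square≤0⇒≈0 : x * x ≤ 0# → x ≈ 0#
  square≤0⇒≈0 p = proj₁ (tight _ _) λ x#0 → p (square-pos x#0)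

  private variable
    m n : ℕ

  -- Opaque, so that unification treats sum as injective.
  opaque
    sum : (Fin n → Carrier) → Carrier
    sum = Σ.sum

    sum-suc : (f : Fin (suc n) → Carrier) → sum f ≈ f zero + sum (λ i → f (suc i))
    sum-suc f = refl

    sum-cong : {f g : Fin n → Carrier} → (∀ i → f i ≈ g i) → sum f ≈ sum g
    sum-cong = Σ.sum-cong-≋

    sum-zero : {f : Fin n → Carrier} → (∀ i → f i ≈ 0#) → sum f ≈ 0#
    sum-zero {n} p = trans (Σ.sum-cong-≋ p) (Σ.sum-replicate-zero n)

    sum-+ : (f g : Fin n → Carrier) → sum (λ i → f i + g i) ≈ sum f + sum g
    sum-+ = Σ.∑-distrib-+

    sum-comm : (f : Fin m → Fin n → Carrier) →
      sum (λ i → sum (λ j → f i j)) ≈ sum (λ j → sum (λ i → f i j))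
    sum-comm = Σ.∑-comm

    sum-*ˡ : ∀ a (f : Fin n → Carrier) → sum (λ i → a * f i) ≈ a * sum f
    sum-*ˡ a f = sym (Σ.*-distribˡ-sum a f)

    sum-*ʳ : ∀ a (f : Fin n → Carrier) → sum (λ i → f i * a) ≈ sum f * a
    sum-*ʳ a f = sym (Σ.*-distribʳ-sum a f)

    sum-nonneg : {f : Fin n → Carrier} → (∀ i → 0# ≤ f i) → 0# ≤ sum f
    sum-nonneg {zero}  p = 0≤0
    sum-nonneg {suc n} p = +-nonneg (p zero) (sum-nonneg λ i → p (suc i))

  sum-- : (f g : Fin n → Carrier) → sum (λ i → f i - g i) ≈ sum f - sum g
  sum-- f g = begin
    sum (λ i → f i - g i)                ≈⟨ solve 2 (λ d s → d := d :+ s :- s) refl _ (sum g) ⟩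
    sum (λ i → f i - g i) + sum g - sum g  ≈⟨ +-congʳ (sum-+ (λ i → f i - g i) g) ⟨
    sum (λ i → f i - g i + g i) - sum g
      ≈⟨ +-congʳ (sum-cong λ i → solve 2 (λ a b → a :- b :+ b := a) refl (f i) (g i)) ⟩
    sum f - sum g                        ∎

  sum-mono : {f g : Fin n → Carrier} → (∀ i → f i ≤ g i) → sum f ≤ sum g
  sum-mono {f = f} {g} p = 0≤-⇒≤ (0≤-resp (sum-- g f) (sum-nonneg (λ i → ≤⇒0≤- (p i))))

  term≤sum : (f : Fin n → Carrier) → (∀ i → 0# ≤ f i) → ∀ i → f i ≤ sum f
  term≤sum {suc n} f p zero    = ≤-by (sum-nonneg λ i → p (suc i))
    (trans (+-congʳ (sum-suc f)) (solve 2 (λ a s → a :+ s :- a := s) refl (f zero) _))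
  term≤sum {suc n} f p (suc i) = ≤-trans (term≤sum (λ j → f (suc j)) (λ j → p (suc j)) i)
    (≤-by (p zero)
    (trans (+-congʳ (sum-suc f)) (solve 2 (λ a s → a :+ s :- s := a) refl (f zero) _)))

  sum-symmetrise : (f : Fin n → Fin n → Carrier) →
    sum (λ i → sum λ j → f i j + f j i) ≈ sum (λ i → sum λ j → f i j) + sum (λ i → sum λ j → f i j)
  sum-symmetrise f = begin
    sum (λ i → sum λ j → f i j + f j i)                          ≈⟨ sum-cong (λ i → sum-+ _ _) ⟩
    sum (λ i → sum (λ j → f i j) + sum (λ j → f j i))            ≈⟨ sum-+ _ _ ⟩
    sum (λ i → sum λ j → f i j) + sum (λ i → sum λ j → f j i)    ≈⟨ +-congˡ (sum-comm f) ⟨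
    sum (λ i → sum λ j → f i j) + sum (λ i → sum λ j → f i j)    ∎

  -- Exchanging the summation indices shows that twice the double sum is the sum of `f i j + f j i`,
  -- so only symmetrised terms need a sign.
  sum-symmetrised-nonneg : (f : Fin n → Fin n → Carrier) → (∀ i j → 0# ≤ f i j + f j i) →
    0# ≤ sum (λ i → sum λ j → f i j)
  sum-symmetrised-nonneg f p = +-cancel-nonneg (0≤-resp (sum-symmetrise f)
    (sum-nonneg λ i → sum-nonneg (p i)))

  if-nonneg : ∀ b {x y} → 0# ≤ x → 0# ≤ y → 0# ≤ (if b then x else y)
  if-nonneg true  p q = p
  if-nonneg false p q = q

  if-zero : ∀ b {x y} → x ≈ 0# → y ≈ 0# → (if b then x else y) ≈ 0#
  if-zero true  p q = p
  if-zero false p q = q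

  if-yes : ∀ {p} {P : Set p} (d : Dec P) {s t : Carrier} → P → (if does d then s else t) ≈ s
  if-yes (yes _) _  = refl
  if-yes (no ¬P) P′ = contradiction P′ ¬P

  if-no : ∀ {p} {P : Set p} (d : Dec P) {s t : Carrier} → ¬ P → (if does d then s else t) ≈ t
  if-no (yes P′) ¬P = contradiction P′ ¬P
  if-no (no _)   _  = refl

  *-zero-left : ∀ {s t} → s ≈ 0# → s * t ≈ 0#
  *-zero-left s≈0 = trans (*-congʳ s≈0) (zeroˡ _)

-- Matrices, bilinear forms and linear equations.

module LinearAlgebra {c ℓ₁ ℓ₂} (ℛ : Reals c ℓ₁ ℓ₂) where
  open OrderedField ℛ
  open import Relation.Binary.Reasoning.Setoid setoid

  private variable
    n : ℕ

  Vector : ℕ → Set c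
  Vector n = Fin n → Carrier

  Matrix : ℕ → Set c
  Matrix n = Fin n → Fin n → Carrier

  apply : Matrix n → Vector n → Vector n
  apply M v i = sum λ j → M i j * v j

  bilinear : Matrix n → Vector n → Vector n → Carrier
  bilinear M v w = sum λ i → v i * apply M w i

  quadratic : Matrix n → Vector n → Carrier
  quadratic M v = bilinear M v v

  sum-combine : ∀ a b (f v w : Vector n) →
    sum (λ i → f i * (a * v i - b * w i)) ≈ a * sum (λ i → f i * v i) - b * sum (λ i → f i * w i)
  sum-combine a b f v w = begin
    sum (λ i → f i * (a * v i - b * w i))
      ≈⟨ sum-cong (λ i → solve 5 (λ a b f v w → f :* (a :* v :- b :* w) := a :* (f :* v) :- b :* (f :* w))
           refl a b (f i) (v i) (w i)) ⟩
    sum (λ i → a * (f i * v i) - b * (f i * w i))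
      ≈⟨ sum-- (λ i → a * (f i * v i)) _ ⟩
    sum (λ i → a * (f i * v i)) - sum (λ i → b * (f i * w i))
      ≈⟨ +-cong (sum-*ˡ a _) (-‿cong (sum-*ˡ b _)) ⟩
    a * sum (λ i → f i * v i) - b * sum (λ i → f i * w i) ∎

  sum-combineˡ : ∀ a b (f v w : Vector n) →
    sum (λ i → (a * v i - b * w i) * f i) ≈ a * sum (λ i → v i * f i) - b * sum (λ i → w i * f i)
  sum-combineˡ a b f v w = begin
    sum (λ i → (a * v i - b * w i) * f i)                ≈⟨ sum-cong (λ i → *-comm _ _) ⟩
    sum (λ i → f i * (a * v i - b * w i))                ≈⟨ sum-combine a b f v w ⟩
    a * sum (λ i → f i * v i) - b * sum (λ i → f i * w i)
      ≈⟨ +-cong (*-congˡ (sum-cong λ i → *-comm _ _)) (-‿cong (*-congˡ (sum-cong λ i → *-comm _ _))) ⟩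
    a * sum (λ i → v i * f i) - b * sum (λ i → w i * f i) ∎

  bilinear-cong : (M : Matrix n) {v v′ w w′ : Vector n} →
    (∀ i → v i ≈ v′ i) → (∀ i → w i ≈ w′ i) → bilinear M v w ≈ bilinear M v′ w′
  bilinear-cong M p q = sum-cong λ i → *-cong (p i) (sum-cong λ j → *-congˡ (q j))

  bilinear-comm : {M : Matrix n} → (∀ i j → M i j ≈ M j i) → ∀ v w →
    bilinear M v w ≈ bilinear M w v
  bilinear-comm {M = M} M-sym v w = begin
    sum (λ i → v i * sum (λ j → M i j * w j))    ≈⟨ sum-cong (λ i → sum-*ˡ (v i) _) ⟨
    sum (λ i → sum (λ j → v i * (M i j * w j)))  ≈⟨ sum-comm _ ⟩
    sum (λ j → sum (λ i → v i * (M i j * w j)))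
      ≈⟨ sum-cong (λ j → sum-cong λ i → trans (*-congˡ (*-congʳ (M-sym i j)))
           (solve 3 (λ v m w → v :* (m :* w) := w :* (m :* v)) refl (v i) (M j i) (w j))) ⟩
    sum (λ j → sum (λ i → w j * (M j i * v i)))  ≈⟨ sum-cong (λ j → sum-*ˡ (w j) _) ⟩
    sum (λ j → w j * sum (λ i → M j i * v i))    ∎

  quadratic-combine : {M : Matrix n} → (∀ i j → M i j ≈ M j i) → ∀ a b v w →
    quadratic M (λ i → a * v i - b * w i)
      ≈ a * a * quadratic M v - (a * b * bilinear M v w + a * b * bilinear M v w) + b * b * quadratic M w
  quadratic-combine {M = M} M-sym a b v w = begin
    quadratic M u
      ≈⟨ sum-cong (λ i → *-congˡ (sum-combine a b (M i) v w)) ⟩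
    sum (λ i → u i * (a * apply M v i - b * apply M w i))
      ≈⟨ sum-combine a b u (apply M v) (apply M w) ⟩
    a * sum (λ i → u i * apply M v i) - b * sum (λ i → u i * apply M w i)
      ≈⟨ +-cong (*-congˡ (sum-combineˡ a b (apply M v) v w)) (-‿cong (*-congˡ (sum-combineˡ a b (apply M w) v w))) ⟩
    a * (a * bilinear M v v - b * bilinear M w v) - b * (a * bilinear M v w - b * bilinear M w w)
      ≈⟨ +-congʳ (*-congˡ (+-congˡ (-‿cong (*-congˡ (bilinear-comm {M = M} M-sym w v))))) ⟩
    a * (a * bilinear M v v - b * bilinear M v w) - b * (a * bilinear M v w - b * bilinear M w w)
      ≈⟨ solve 5 (λ a b x y z → a :* (a :* x :- b :* y) :- b :* (a :* y :- b :* z)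
            := a :* a :* x :- (a :* b :* y :+ a :* b :* y) :+ b :* b :* z) refl a b _ _ _ ⟩
    a * a * quadratic M v - (a * b * bilinear M v w + a * b * bilinear M v w) + b * b * quadratic M w ∎
    where
    u = λ i → a * v i - b * w i

  δ : Fin n → Fin n → Carrier
  δ zero    zero    = 1#
  δ zero    (suc j) = 0#
  δ (suc i) zero    = 0#
  δ (suc i) (suc j) = δ i j

  sum-δ : (i : Fin n) (f : Vector n) → sum (λ j → δ i j * f j) ≈ f i
  sum-δ zero    f = trans (sum-suc _) (trans (+-cong (*-identityˡ _) (sum-zero λ j → zeroˡ _)) (+-identityʳ _))
  sum-δ (suc i) f = trans (sum-suc _) (trans (+-cong (zeroˡ _) (sum-δ i (λ j → f (suc j)))) (+-identityˡ _))

  δ-comm : (i j : Fin n) (f : Vector n) → δ i j * f i ≈ δ j i * f j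
  δ-comm zero    zero    f = refl
  δ-comm zero    (suc j) f = trans (zeroˡ _) (sym (zeroˡ _))
  δ-comm (suc i) zero    f = trans (zeroˡ _) (sym (zeroˡ _))
  δ-comm (suc i) (suc j) f = δ-comm i j (λ k → f (suc k))

  δ-nonneg : (i j : Fin n) → 0# ≤ δ i j
  δ-nonneg zero    zero    = <⇒≤ 0<1
  δ-nonneg zero    (suc j) = 0≤0
  δ-nonneg (suc i) zero    = 0≤0
  δ-nonneg (suc i) (suc j) = δ-nonneg i j

  -- Gaussian elimination on the first column.
  injective⇒solvable : (K : Matrix n) →
    (∀ (v : Vector n) → (∀ i → apply K v i ≈ 0#) → ∀ i → v i ≈ 0#) →
    ∀ (b : Vector n) → ¬ ¬ (∃ λ (v : Vector n) → ∀ i → apply K v i ≈ b i)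
  injective⇒solvable {zero}  K inj b k = k ((λ ()) , λ ())
  injective⇒solvable {suc n} K inj b k = ¬¬pivot pivot⇒⊥
    where
    e : Vector (suc n)
    e zero    = 1#
    e (suc j) = 0#

    -- Without a pivot the first column vanishes by tightness, and the first unit vector lies in the
    -- kernel. Apartness being undecidable, the pivot is found only up to double negation.
    ¬¬pivot : ¬ ¬ (∃[ p ] K p zero # 0#)
    ¬¬pivot ¬pivot = <-irrefl (sym (inj e Ke≈0 zero)) 0<1
      where
      Ke≈0 : ∀ i → apply K e i ≈ 0#
      Ke≈0 i = trans (sum-suc _) (trans (+-cong
        (trans (*-identityʳ _) (proj₁ (tight _ _) λ Ki0#0 → ¬pivot (i , Ki0#0)))
        (sum-zero λ j → zeroʳ _)) (+-identityʳ 0#))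

    pivot⇒⊥ : ¬ (∃[ p ] K p zero # 0#)
    pivot⇒⊥ (p , p#0) = injective⇒solvable reduced reduced-inj rhs
        λ (u , solution) → k (extend u (b p) , rows u (b p) b refl λ i →
          trans (+-congʳ (solution i)) (solve 2 (λ x y → x :- y :+ y := x) refl (b (punchIn p i)) (K (punchIn p i) zero * κ * b p)))
      where
      κ : Carrier
      κ = recip (K p zero) p#0

      -- The Schur complement of the pivot entry; `extend` recovers the eliminated coordinate from
      -- the pivot row.
      reduced : Matrix n
      reduced i j = K (punchIn p i) (suc j) - K (punchIn p i) zero * κ * K p (suc j)

      rhs : Vector n
      rhs i = b (punchIn p i) - K (punchIn p i) zero * κ * b p

      extend : Vector n → Carrier → Vector (suc n)
      extend u d zero    = κ * (d - sum (λ j → K p (suc j) * u j))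
      extend u d (suc j) = u j

      pivot-row : ∀ (u : Vector n) d → apply K (extend u d) p ≈ d
      pivot-row u d = begin
        apply K (extend u d) p        ≈⟨ sum-suc _ ⟩
        K p zero * (κ * (d - s)) + s  ≈⟨ solve 4 (λ x κ d s → x :* (κ :* (d :- s)) :+ s
                                           := x :* κ :* (d :- s) :+ s) refl (K p zero) κ d s ⟩
        K p zero * κ * (d - s) + s    ≈⟨ +-congʳ (*-congʳ (recip-inverse _ p#0)) ⟩
        1# * (d - s) + s              ≈⟨ solve 2 (λ d s → con (+ 1) :* (d :- s) :+ s := d) refl d s ⟩
        d                             ∎
        where
        s = sum (λ j → K p (suc j) * u j)

      other-row : ∀ (u : Vector n) d i → apply K (extend u d) (punchIn p i)
                          ≈ apply reduced u i + K (punchIn p i) zero * κ * d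
      other-row u d i = begin
        apply K (extend u d) (punchIn p i)
          ≈⟨ sum-suc _ ⟩
        x * (κ * (d - s)) + t
          ≈⟨ solve 5 (λ x κ d s t → x :* (κ :* (d :- s)) :+ t := t :- x :* κ :* s :+ x :* κ :* d) refl x κ d s t ⟩
        t - x * κ * s + x * κ * d
          ≈⟨ +-congʳ (+-congˡ (-‿cong (sum-*ˡ (x * κ) _))) ⟨
        t - sum (λ j → x * κ * (K p (suc j) * u j)) + x * κ * d
          ≈⟨ +-congʳ (sum-- _ (λ j → x * κ * (K p (suc j) * u j))) ⟨
        sum (λ j → K (punchIn p i) (suc j) * u j - x * κ * (K p (suc j) * u j)) + x * κ * d
          ≈⟨ +-congʳ (sum-cong λ j → solve 4 (λ a y b u → a :* u :- y :* (b :* u) := (a :- y :* b) :* u)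
               refl (K (punchIn p i) (suc j)) (x * κ) (K p (suc j)) (u j)) ⟩
        apply reduced u i + x * κ * d ∎
        where
        x = K (punchIn p i) zero
        s = sum (λ j → K p (suc j) * u j)
        t = sum (λ j → K (punchIn p i) (suc j) * u j)

      -- The right side is a parameter because there are two uses: `b` for solving the system, and 0
      -- for passing injectivity on to `reduced`.
      rows : ∀ (u : Vector n) d (b′ : Vector (suc n)) → d ≈ b′ p →
        (∀ i → apply reduced u i + K (punchIn p i) zero * κ * d ≈ b′ (punchIn p i)) →
        ∀ i → apply K (extend u d) i ≈ b′ i
      rows u d b′ p-eq eqs i with p Fin.≟ i
      ... | yes ≡.refl = trans (pivot-row u d) p-eq
      ... | no p≢i rewrite ≡.sym (Fin.punchIn-punchOut p≢i) = trans (other-row u d _) (eqs _)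

      reduced-inj : ∀ (u : Vector n) → (∀ i → apply reduced u i ≈ 0#) → ∀ i → u i ≈ 0#
      reduced-inj u u≈0 i = inj (extend u 0#) (rows u 0# (λ _ → 0#) refl λ j →
        trans (+-cong (u≈0 j) (zeroʳ _)) (+-identityʳ 0#)) (suc i)

  -- Weighted graphs: Dirichlet form and Poisson equation.

  module Dirichlet (P : Matrix n) (P-sym : ∀ i j → P i j ≈ P j i) (P-nonneg : ∀ i j → 0# ≤ P i j) where

    degree : Vector n
    degree i = sum (P i)

    -- The Dirichlet form of the graph with edge weights `P`: the quadratic form of its Laplacian,
    -- degrees minus `P`.
    energy : Vector n → Carrier
    energy z = sum (λ i → degree i * (z i * z i)) - quadratic P z

    -- Expanding the square and exchanging the endpoints by symmetry of `P` gives two copies of the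
    -- form. Its nonnegativity, the bound N ≤ 1, is read off the edges.
    energy-edges : ∀ (z : Vector n) →
      energy z + energy z ≈ sum (λ i → sum λ j → P i j * ((z i - z j) * (z i - z j)))
    energy-edges z = sym (begin
      sum (λ i → sum λ j → P i j * ((z i - z j) * (z i - z j)))
        ≈⟨ sum-cong (λ i → sum-cong λ j → trans
             (solve 3 (λ p x y → p :* ((x :- y) :* (x :- y)) :=
                (p :* (x :* x) :- x :* (p :* y)) :+ (p :* (y :* y) :- y :* (p :* x))) refl (P i j) (z i) (z j))
             (+-congˡ (+-cong (*-congʳ (P-sym i j)) (-‿cong (*-congˡ (*-congʳ (P-sym i j))))))) ⟩
      sum (λ i → sum λ j → f i j + f j i)
        ≈⟨ sum-symmetrise f ⟩
      sum (λ i → sum (f i)) + sum (λ i → sum (f i))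
        ≈⟨ +-cong rows rows ⟩
      energy z + energy z ∎)
      where
      f : Matrix _
      f i j = P i j * (z i * z i) - z i * (P i j * z j)
      rows : sum (λ i → sum (f i)) ≈ energy z
      rows = begin
        sum (λ i → sum (f i))
          ≈⟨ sum-cong (λ i → trans (sum-- _ (λ j → z i * (P i j * z j)))
               (+-cong (sum-*ʳ (z i * z i) (P i)) (-‿cong (sum-*ˡ (z i) _)))) ⟩
        sum (λ i → degree i * (z i * z i) - z i * apply P z i)
          ≈⟨ sum-- _ (λ i → z i * apply P z i) ⟩
        energy z ∎

    edge-nonneg : ∀ (z : Vector n) i j → 0# ≤ P i j * ((z i - z j) * (z i - z j))
    edge-nonneg z i j = *-nonneg (P-nonneg i j) (square-nonneg (z i - z j))

    energy-nonneg : ∀ (z : Vector n) → 0# ≤ energy z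
    energy-nonneg z = +-cancel-nonneg (0≤-resp (sym (energy-edges z))
      (sum-nonneg λ i → sum-nonneg (edge-nonneg z i)))

    energy≈0⇒edge : ∀ (z : Vector n) → energy z ≤ 0# → ∀ {i j} → 0# < P i j → z i ≈ z j
    energy≈0⇒edge z e≤0 {i} {j} 0<Pij = begin
      z i              ≈⟨ solve 2 (λ x y → x := x :- y :+ y) refl (z i) (z j) ⟩
      z i - z j + z j  ≈⟨ +-congʳ (square≤0⇒≈0 (0≤-⇒≤ (*-cancelˡ-nonneg 0<Pij
        (0≤-resp (solve 2 (λ p x → :- (p :* x) := p :* (con (+ 0) :- x)) refl (P i j) _)
          (0≤-resp (+-identityˡ _) (≤⇒0≤- edge≤0)))))) ⟩
      0# + z j         ≈⟨ +-identityˡ _ ⟩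
      z j              ∎
      where
      edge≤0 : P i j * ((z i - z j) * (z i - z j)) ≤ 0#
      edge≤0 = ≤-trans (term≤sum (λ j → P i j * ((z i - z j) * (z i - z j))) (edge-nonneg z i) j)
        (≤-trans (term≤sum (λ i → sum λ j → P i j * ((z i - z j) * (z i - z j)))
            (λ i → sum-nonneg (edge-nonneg z i)) i)
          (≤-trans (≤-reflexive (sym (energy-edges z)))
            (≤-by (+-nonneg (≤⇒0≤- e≤0) (≤⇒0≤- e≤0))
              (solve 1 (λ e → con (+ 0) :- (e :+ e) := (con (+ 0) :- e) :+ (con (+ 0) :- e)) refl (energy z)))))

  -- The hub 0 is adjacent to every vertex of the support of P, so the
  -- Laplacian only vanishes on functions constant on the support.
  module Hub {n} (P : Matrix (suc n)) (P-sym : ∀ i j → P i j ≈ P j i) (P-nonneg : ∀ i j → 0# ≤ P i j)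
    (P₀₀-pos : 0# < P zero zero)
    (adjacent : ∀ i → 0# < P zero i ⊎ (∀ j → P i j ≈ 0#)) where
    open Dirichlet P P-sym P-nonneg public

    -- Indicator of the isolated vertices. It fills the diagonal where the degree vanishes and the
    -- Laplacian has a zero row.
    outside : Vector (suc n)
    outside i = [ (λ _ → 0#) , (λ _ → 1#) ]′ (adjacent i)

    support : ∀ i → (0# < P zero i × outside i ≈ 0#) ⊎ ((∀ j → P i j ≈ 0#) × outside i ≈ 1#)
    support i with adjacent i
    ... | inj₁ 0<P₀ᵢ = inj₁ (0<P₀ᵢ , refl)
    ... | inj₂ Pᵢ≈0  = inj₂ (Pᵢ≈0 , refl)

    0≤outside : ∀ i → 0# ≤ outside i
    0≤outside i with adjacent i
    ... | inj₁ _ = 0≤0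
    ... | inj₂ _ = <⇒≤ 0<1

    degree-nonneg : ∀ i → 0# ≤ degree i
    degree-nonneg i = sum-nonneg (P-nonneg i)

    degree-pos : ∀ {i} → 0# < P zero i → 0# < degree i
    degree-pos {i} p = 0<-resp (sym (sum-suc _))
      (+-pos-nonneg (0<-resp (P-sym zero i) p) (sum-nonneg λ j → P-nonneg i (suc j)))

    total-pos : 0# < sum degree
    total-pos = 0<-resp (sym (sum-suc degree))
      (+-pos-nonneg (degree-pos P₀₀-pos) (sum-nonneg λ i → degree-nonneg (suc i)))

    mass : Vector (suc n) → Carrier
    mass v = sum λ i → degree i * v i

    -- degree + outside on the diagonal, minus P, plus the rank one
    -- matrix of mass: positive definite.
    K : Matrix (suc n)
    K i j = δ i j * (degree i + outside i) - P i j + degree i * degree j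

    apply-K : ∀ (v : Vector (suc n)) i → apply K v i ≈ (degree i + outside i) * v i - apply P v i + degree i * mass v
    apply-K v i = begin
      sum (λ j → K i j * v j)
        ≈⟨ sum-cong (λ j → solve 6 (λ d a p q r v →
              (d :* a :- p :+ q :* r) :* v := d :* (a :* v) :- p :* v :+ q :* (r :* v)) refl
              (δ i j) (degree i + outside i) (P i j) (degree i) (degree j) (v j)) ⟩
      sum (λ j → δ i j * ((degree i + outside i) * v j) - P i j * v j + degree i * (degree j * v j))
        ≈⟨ sum-+ (λ j → δ i j * ((degree i + outside i) * v j) - P i j * v j) _ ⟩
      sum (λ j → δ i j * ((degree i + outside i) * v j) - P i j * v j) + sum (λ j → degree i * (degree j * v j))
        ≈⟨ +-cong (sum-- _ (λ j → P i j * v j)) (sum-*ˡ (degree i) _) ⟩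
      sum (λ j → δ i j * ((degree i + outside i) * v j)) - apply P v i + degree i * mass v
        ≈⟨ +-congʳ (+-congʳ (sum-δ i (λ j → (degree i + outside i) * v j))) ⟩
      (degree i + outside i) * v i - apply P v i + degree i * mass v ∎

    quadratic-K : ∀ (v : Vector (suc n)) → quadratic K v ≈ energy v + sum (λ i → outside i * (v i * v i)) + mass v * mass v
    quadratic-K v = begin
      sum (λ i → v i * apply K v i)
        ≈⟨ sum-cong (λ i → trans (*-congˡ (apply-K v i))
             (solve 5 (λ v d o a m → v :* ((d :+ o) :* v :- a :+ d :* m)
                := (d :* (v :* v) :- v :* a) :+ o :* (v :* v) :+ m :* (d :* v)) refl
                (v i) (degree i) (outside i) (apply P v i) (mass v))) ⟩
      sum (λ i → (degree i * (v i * v i) - v i * apply P v i) + outside i * (v i * v i) + mass v * (degree i * v i))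
        ≈⟨ sum-+ (λ i → (degree i * (v i * v i) - v i * apply P v i) + outside i * (v i * v i)) _ ⟩
      sum (λ i → (degree i * (v i * v i) - v i * apply P v i) + outside i * (v i * v i))
        + sum (λ i → mass v * (degree i * v i))
        ≈⟨ +-cong (sum-+ (λ i → degree i * (v i * v i) - v i * apply P v i) _) (sum-*ˡ (mass v) _) ⟩
      sum (λ i → degree i * (v i * v i) - v i * apply P v i) + sum (λ i → outside i * (v i * v i)) + mass v * mass v
        ≈⟨ +-congʳ (+-congʳ (sum-- _ (λ i → v i * apply P v i))) ⟩
      energy v + sum (λ i → outside i * (v i * v i)) + mass v * mass v ∎

    outside²-nonneg : ∀ (v : Vector (suc n)) i → 0# ≤ outside i * (v i * v i)
    outside²-nonneg v i = *-nonneg (0≤outside i) (square-nonneg (v i))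

    -- The three summands of `quadratic-K` are nonnegative with sum 0. Zero energy makes `v` equal
    -- to `v zero` on the support, zero `mass` then makes this constant 0, and the `outside` term
    -- settles the isolated vertices.
    K-injective : ∀ (v : Vector (suc n)) → (∀ i → apply K v i ≈ 0#) → ∀ i → v i ≈ 0#
    K-injective v Kv≈0 = v≈0
      where
      total : energy v + sum (λ i → outside i * (v i * v i)) + mass v * mass v ≈ 0#
      total = trans (sym (quadratic-K v)) (sum-zero λ i → trans (*-congˡ (Kv≈0 i)) (zeroʳ _))

      o = sum (λ i → outside i * (v i * v i))

      energy≤0 : energy v ≤ 0#
      energy≤0 = ≤-by (+-nonneg (sum-nonneg (outside²-nonneg v)) (square-nonneg (mass v)))
        (trans (+-congʳ (sym total)) (solve 3 (λ e o m → e :+ o :+ m :- e := o :+ m) refl (energy v) o (mass v * mass v)))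

      mass≈0 : mass v ≈ 0#
      mass≈0 = square≤0⇒≈0 (≤-by (+-nonneg (energy-nonneg v) (sum-nonneg (outside²-nonneg v)))
        (trans (+-congʳ (sym total)) (solve 3 (λ e o m → e :+ o :+ m :- m := e :+ o) refl (energy v) o (mass v * mass v))))

      outside≤0 : ∀ i → outside i * (v i * v i) ≤ 0#
      outside≤0 i = ≤-trans (term≤sum (λ i → outside i * (v i * v i)) (outside²-nonneg v) i)
        (≤-by (+-nonneg (energy-nonneg v) (square-nonneg (mass v)))
        (trans (+-congʳ (sym total)) (solve 3 (λ e o m → e :+ o :+ m :- o := e :+ m) refl (energy v) o (mass v * mass v))))

      -- The factor `degree i` makes the equation true at isolated vertices too, so that it can be
      -- summed into `mass`.
      constant : ∀ i → degree i * v i ≈ degree i * v zero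
      constant i with adjacent i
      ... | inj₁ 0<P0i = *-congˡ (sym (energy≈0⇒edge v energy≤0 0<P0i))
      ... | inj₂ Pi≈0  = trans (*-congʳ (sum-zero Pi≈0)) (trans (zeroˡ _) (sym (trans (*-congʳ (sum-zero Pi≈0)) (zeroˡ _))))

      v₀≈0 : v zero ≈ 0#
      v₀≈0 = square≤0⇒≈0 (0≤-⇒≤ (*-cancelˡ-nonneg
        total-pos
        (≤-reflexive (sym eq))))
        where
        eq : sum degree * (0# - v zero * v zero) ≈ 0#
        eq = begin
          sum degree * (0# - v zero * v zero)
            ≈⟨ solve 2 (λ s x → s :* (con (+ 0) :- x :* x) := :- (s :* x :* x)) refl (sum degree) (v zero) ⟩
          - (sum degree * v zero * v zero)
            ≈⟨ -‿cong (*-congʳ (trans (sym (sum-*ʳ (v zero) degree)) (sym (sum-cong constant)))) ⟩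
          - (mass v * v zero)
            ≈⟨ -‿cong (*-congʳ mass≈0) ⟩
          - (0# * v zero)
            ≈⟨ solve 1 (λ x → :- (con (+ 0) :* x) := con (+ 0)) refl (v zero) ⟩
          0# ∎

      v≈0 : ∀ i → v i ≈ 0#
      v≈0 i = [ (λ (0<P0i , _) → trans (sym (energy≈0⇒edge v energy≤0 0<P0i)) v₀≈0)
              , (λ (_ , outside≈1) → square≤0⇒≈0
                  (≤-resp (trans (*-congʳ outside≈1) (*-identityˡ _)) refl (outside≤0 i)))
              ]′ (support i)

    module _ (v w : Vector (suc n)) (Kv≈ : ∀ i → apply K v i ≈ degree i * w i) where
      -- At an isolated vertex the degree is 0 and row i of the equation reduces to this claim; on
      -- the support the indicator itself is 0.
      outside-vanishes : ∀ i → outside i * v i ≈ 0#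
      outside-vanishes i = [ (λ (_ , o≈0) → trans (*-congʳ o≈0) (zeroˡ _)) , isolated ]′ (support i)
        where
        isolated : (∀ j → P i j ≈ 0#) × outside i ≈ 1# → outside i * v i ≈ 0#
        isolated (Pᵢ≈0 , _) = begin
          outside i * v i
            ≈⟨ solve 3 (λ v o m → o :* v := (con (+ 0) :+ o) :* v :- con (+ 0) :+ con (+ 0) :* m)
                 refl (v i) (outside i) (mass v) ⟩
          (0# + outside i) * v i - 0# + 0# * mass v
            ≈⟨ +-cong (+-cong (*-congʳ (+-congʳ d≈0))
                 (-‿cong (sum-zero λ j → trans (*-congʳ (Pᵢ≈0 j)) (zeroˡ _)))) (*-congʳ d≈0) ⟨
          (degree i + outside i) * v i - apply P v i + degree i * mass v
            ≈⟨ apply-K v i ⟨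
          apply K v i
            ≈⟨ trans (Kv≈ i) (trans (*-congʳ d≈0) (zeroˡ _)) ⟩
          0# ∎
          where
          d≈0 : degree i ≈ 0#
          d≈0 = sum-zero Pᵢ≈0

      flux : ∀ i → degree i * v i + degree i * mass v ≈ apply P v i + degree i * w i
      flux i = begin
        degree i * v i + degree i * mass v
          ≈⟨ solve 4 (λ a dv dm ov → dv :+ dm := a :+ (dv :+ ov :- a :+ dm) :- ov) refl
               (apply P v i) (degree i * v i) (degree i * mass v) (outside i * v i) ⟩
        apply P v i + (degree i * v i + outside i * v i - apply P v i + degree i * mass v) - outside i * v i
          ≈⟨ +-cong (+-congˡ (+-congʳ (+-congʳ (sym (distribʳ _ _ _))))) (-‿cong (outside-vanishes i)) ⟩
        apply P v i + ((degree i + outside i) * v i - apply P v i + degree i * mass v) - 0#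
          ≈⟨ trans (x-0≈x _) (+-congˡ (trans (sym (apply-K v i)) (Kv≈ i))) ⟩
        apply P v i + degree i * w i ∎

      -- Summing `flux` over all vertices removes the Laplacian, since the columns of `P` sum to the
      -- degrees. What is left is the rank one term against the right side.
      mass-balance : sum degree * mass v ≈ mass w
      mass-balance = begin
        sum degree * mass v
          ≈⟨ solve 2 (λ x m → x := m :+ x :- m) refl (sum degree * mass v) (mass v) ⟩
        mass v + sum degree * mass v - mass v
          ≈⟨ +-congʳ (+-congˡ (sum-*ʳ (mass v) degree)) ⟨
        mass v + sum (λ i → degree i * mass v) - mass v
          ≈⟨ +-congʳ (sum-+ _ _) ⟨
        sum (λ i → degree i * v i + degree i * mass v) - mass v
          ≈⟨ +-congʳ (trans (sum-cong flux) (sum-+ _ _)) ⟩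
        sum (apply P v) + mass w - mass v
          ≈⟨ +-congʳ (+-congʳ total-flux) ⟩
        mass v + mass w - mass v
          ≈⟨ solve 2 (λ x m → m :+ x :- m := x) refl (mass w) (mass v) ⟩
        mass w ∎
        where
        total-flux : sum (apply P v) ≈ mass v
        total-flux = begin
          sum (λ i → sum λ j → P i j * v j)  ≈⟨ sum-comm _ ⟩
          sum (λ j → sum λ i → P i j * v j)  ≈⟨ sum-cong (λ j → trans (sum-cong λ i → *-congʳ (P-sym i j)) (sum-*ʳ (v j) (P j))) ⟩
          mass v                             ∎

      -- The rank one correction that makes `K` invertible vanishes when w is orthogonal to the
      -- degrees, by `mass-balance`; then `v` solves the equation of the Laplacian itself.
      poisson : mass w ≈ 0# → ∀ i → apply P v i ≈ degree i * (v i - w i)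
      poisson mass-w≈0 i = begin
        apply P v i
          ≈⟨ solve 2 (λ a b → a := a :+ b :- b) refl (apply P v i) (degree i * w i) ⟩
        apply P v i + degree i * w i - degree i * w i
          ≈⟨ +-congʳ (flux i) ⟨
        degree i * v i + degree i * mass v - degree i * w i
          ≈⟨ +-congʳ (+-congˡ (trans (*-congˡ mass-v≈0) (zeroʳ _))) ⟩
        degree i * v i + 0# - degree i * w i
          ≈⟨ solve 3 (λ d v w → d :* v :+ con (+ 0) :- d :* w := d :* (v :- w)) refl (degree i) (v i) (w i) ⟩
        degree i * (v i - w i) ∎
        where
        mass-v≈0 : mass v ≈ 0#
        mass-v≈0 = square≤0⇒≈0 (0≤-⇒≤ (*-cancelˡ-nonneg total-pos (≤-reflexive (sym (begin
          sum degree * (0# - mass v * mass v)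
            ≈⟨ solve 2 (λ s m → s :* (con (+ 0) :- m :* m) := :- (s :* m :* m)) refl (sum degree) (mass v) ⟩
          - (sum degree * mass v * mass v)
            ≈⟨ -‿cong (*-congʳ (trans mass-balance mass-w≈0)) ⟩
          - (0# * mass v)
            ≈⟨ solve 1 (λ x → :- (con (+ 0) :* x) := con (+ 0)) refl (mass v) ⟩
          0# ∎)))))

-- Hyperbolic forms: local-to-global principle, criteria and limits.

module Hyperbolicity {c ℓ₁ ℓ₂} (ℛ : Reals c ℓ₁ ℓ₂) where
  open OrderedField ℛ
  open LinearAlgebra ℛ
  open import Relation.Binary.Reasoning.Setoid setoid

  private variable
    n : ℕ

  quadratic-minus : {M : Matrix n} → (∀ i j → M i j ≈ M j i) → ∀ v w →
    quadratic M (λ i → v i - w i) ≈ quadratic M v - (bilinear M v w + bilinear M v w) + quadratic M w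
  quadratic-minus {M = M} M-sym v w = begin
    quadratic M (λ i → v i - w i)
      ≈⟨ bilinear-cong M minus minus ⟩
    quadratic M (λ i → 1# * v i - 1# * w i)
      ≈⟨ quadratic-combine {M = M} M-sym 1# 1# v w ⟩
    1# * 1# * quadratic M v - (1# * 1# * bilinear M v w + 1# * 1# * bilinear M v w) + 1# * 1# * quadratic M w
      ≈⟨ solve 3 (λ x y z → con (+ 1) :* con (+ 1) :* x
            :- (con (+ 1) :* con (+ 1) :* y :+ con (+ 1) :* con (+ 1) :* y) :+ con (+ 1) :* con (+ 1) :* z
            := x :- (y :+ y) :+ z) refl (quadratic M v) (bilinear M v w) (quadratic M w) ⟩
    quadratic M v - (bilinear M v w + bilinear M v w) + quadratic M w ∎
    where
    minus : ∀ i → v i - w i ≈ 1# * v i - 1# * w i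
    minus i = solve 2 (λ v w → v :- w := con (+ 1) :* v :- con (+ 1) :* w) refl (v i) (w i)

  -- The local-to-global principle for combinatorial atlases: r i is the
  -- quadratic form of the i-th neighbour, r-cauchy comes from its
  -- hyperbolicity and r-pullback is the pullback inequality.  The vector
  -- h of the atlas is normalised to be constantly 1.
  module LocalToGlobal {n} (P : Matrix (suc n)) (P-sym : ∀ i j → P i j ≈ P j i)
    (P-nonneg : ∀ i j → 0# ≤ P i j)
    (P₀₀-pos : 0# < P zero zero)
    (adjacent : ∀ i → 0# < P zero i ⊎ (∀ j → P i j ≈ 0#))
    (r : Vector (suc n) → Vector (suc n))
    (r-outside : ∀ v i → (∀ j → P i j ≈ 0#) → r v i ≤ 0#)
    (r-cauchy : ∀ v i → 0# < P zero i → r v i * sum (P i) ≤ apply P v i * apply P v i)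
    (r-pullback : ∀ v → quadratic P v ≤ sum (r v)) where
    open Hub P P-sym P-nonneg P₀₀-pos adjacent

    module _ (v w : Vector (suc n)) (Pv≈ : ∀ i → apply P v i ≈ degree i * (v i - w i)) where
      -- This is Nv. Writing it as a difference avoids dividing by degrees that may be 0.
      z : Vector (suc n)
      z i = v i - w i

      X Y Z : Carrier
      X = sum λ i → v i * (degree i * z i)
      Y = sum λ i → w i * (degree i * z i)
      Z = sum λ i → degree i * (z i * z i)

      Z≈X-Y : Z ≈ X - Y
      Z≈X-Y = trans (sum-cong λ i → solve 3 (λ d v w → d :* ((v :- w) :* (v :- w))
                := v :* (d :* (v :- w)) :- w :* (d :* (v :- w))) refl (degree i) (v i) (w i))
              (sum-- _ _)

      Qv≈X : quadratic P v ≈ X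
      Qv≈X = sum-cong λ i → *-congˡ (Pv≈ i)

      Bvw≈Y : bilinear P v w ≈ Y
      Bvw≈Y = trans (bilinear-comm {M = P} P-sym v w) (sum-cong λ i → *-congˡ (Pv≈ i))

      r≤ : ∀ i → r v i ≤ degree i * (z i * z i)
      r≤ i = [ (λ (0<P₀ᵢ , _) → 0≤-⇒≤ (*-cancelˡ-nonneg (degree-pos 0<P₀ᵢ)
                 (0≤-resp (begin
                    apply P v i * apply P v i - r v i * degree i
                      ≈⟨ +-congʳ (*-cong (Pv≈ i) (Pv≈ i)) ⟩
                    (degree i * z i) * (degree i * z i) - r v i * degree i
                      ≈⟨ solve 3 (λ d z r → (d :* z) :* (d :* z) :- r :* d := d :* (d :* (z :* z) :- r))
                           refl (degree i) (z i) (r v i) ⟩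
                    degree i * (degree i * (z i * z i) - r v i) ∎)
                 (≤⇒0≤- (r-cauchy v i 0<P₀ᵢ)))))
             , (λ (Pᵢ≈0 , _) → ≤-trans (r-outside v i Pᵢ≈0) (*-nonneg (degree-nonneg i) (square-nonneg (z i))))
             ]′ (support i)

      -- The inequality N ≤ N² tested on `v`: X is ⟨v, Nv⟩ and Z is ⟨Nv, Nv⟩. The pullback
      -- inequality compares X with the neighbours, and `r≤` compares the neighbours with Z.
      X≤Z : X ≤ Z
      X≤Z = ≤-trans (≤-reflexive (sym Qv≈X)) (≤-trans (r-pullback v) (sum-mono r≤))

      -- As w = v - z, the form at w is X - 2Z + Qz; its negative is the energy Z - Qz of `z` plus Z
      -- - X.
      Qw≤0 : quadratic P w ≤ 0#
      Qw≤0 = ≤-by (+-nonneg (energy-nonneg z) (≤⇒0≤- X≤Z)) (sym (begin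
        Z - quadratic P z + (Z - X)
          ≈⟨ +-cong (+-cong Z≈X-Y (-‿cong (quadratic-minus {M = P} P-sym v w))) (+-congʳ Z≈X-Y) ⟩
        X - Y - (quadratic P v - (bilinear P v w + bilinear P v w) + quadratic P w) + (X - Y - X)
          ≈⟨ +-congʳ (+-congˡ (-‿cong (+-congʳ (+-cong Qv≈X (-‿cong (+-cong Bvw≈Y Bvw≈Y)))))) ⟩
        X - Y - (X - (Y + Y) + quadratic P w) + (X - Y - X)
          ≈⟨ solve 3 (λ x y q → x :- y :- (x :- (y :+ y) :+ q) :+ (x :- y :- x) := con (+ 0) :- q)
               refl X Y (quadratic P w) ⟩
        0# - quadratic P w ∎))

    lorentzian : ∀ w → mass w ≈ 0# → quadratic P w ≤ 0#
    -- The inequality to be proved is a negation, so the doubly negated solution of the linear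
    -- system may be used.
    lorentzian w w⊥ 0<Qw = injective⇒solvable K K-injective (λ i → degree i * w i)
      λ (v , Kv≈) → Qw≤0 v w (poisson v w Kv≈ w⊥) 0<Qw

  Hyperbolic : Matrix n → Set _
  Hyperbolic M = ∀ v w → 0# ≤ quadratic M w →
    quadratic M v * quadratic M w ≤ bilinear M v w * bilinear M v w

  -- The case Qw = 0 of the reversed Cauchy inequality is trivial.
  hyperbolic-by : {M : Matrix n} →
    (∀ v w → 0# < quadratic M w →
       ¬ (bilinear M v w * bilinear M v w < quadratic M v * quadratic M w)) →
    Hyperbolic M
  hyperbolic-by {M = M} h v w 0≤Qw = split<
    (h v w)
    (λ Qw<0 → contradiction Qw<0 0≤Qw)
    (λ 0≈Qw → ≤-trans (≤-reflexive (trans (*-congˡ (sym 0≈Qw)) (zeroʳ _))) (square-nonneg _))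

  -- For u = a v - b w with a = ⟨g, w⟩ and b = ⟨g, v⟩, orthogonality to g gives Qu ≤ 0, and
  -- completing the square gives Qw Qu = a² (Qv Qw - B²) + (b Qw - a B)². For a apart from 0 this
  -- bounds the discriminant; if a = 0, then w itself would have Qw ≤ 0.
  lorentzian⇒hyperbolic : {M : Matrix n} → (∀ i j → M i j ≈ M j i) → (g : Vector n) →
    (∀ w → sum (λ i → g i * w i) ≈ 0# → quadratic M w ≤ 0#) → Hyperbolic M
  lorentzian⇒hyperbolic {n} {M} M-sym g neg = hyperbolic-by λ v w 0<Qw →
    split {P = sum (λ i → g i * w i) # 0#} (main v w 0<Qw)
      (λ ¬#0 _ → neg w (proj₁ (tight _ _) ¬#0) 0<Qw)
    where
    module _ (v w : Vector n) (0<Qw : 0# < quadratic M w) (a#0 : sum (λ i → g i * w i) # 0#) where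
      a b Qv B Qw : Carrier
      a  = sum λ i → g i * w i
      b  = sum λ i → g i * v i
      Qv = quadratic M v
      B  = bilinear M v w
      Qw = quadratic M w

      Qu≤0 : quadratic M (λ i → a * v i - b * w i) ≤ 0#
      Qu≤0 = neg _ (trans (sum-combine a b g v w)
        (solve 2 (λ a b → a :* b :- b :* a := con (+ 0)) refl a b))

      main : ¬ (B * B < Qv * Qw)
      main B²<QvQw = contradiction
        (+-pos-nonneg (*-pos (square-pos a#0) (<⇒0<- B²<QvQw)) (square-nonneg (b * Qw - a * B)))
        (0≤-⇒≤ (0≤-resp eq (*-nonneg (<⇒≤ 0<Qw) (≤⇒0≤- Qu≤0))))
        where
        eq : Qw * (0# - quadratic M (λ i → a * v i - b * w i))
           ≈ 0# - (a * a * (Qv * Qw - B * B) + (b * Qw - a * B) * (b * Qw - a * B))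
        eq = trans (*-congˡ (+-congˡ (-‿cong (quadratic-combine {M = M} M-sym a b v w))))
          (solve 5 (λ a b v w m → w :* (con (+ 0) :- (a :* a :* v :- (a :* b :* m :+ a :* b :* m) :+ b :* b :* w))
             := con (+ 0) :- (a :* a :* (v :* w :- m :* m) :+ (b :* w :- a :* m) :* (b :* w :- a :* m)))
             refl a b Qv Qw B)

  hyperbolic-congruence : {M : Matrix n} (s t : Vector n) → (∀ i → t i * s i ≈ 1#) →
    Hyperbolic (λ i j → s i * s j * M i j) → Hyperbolic M
  hyperbolic-congruence {n} {M} s t ts≈1 h v w 0≤Qw =
    ≤-resp (*-cong (rescale v v) (rescale w w)) (*-cong (rescale v w) (rescale v w))
      (h (λ i → t i * v i) (λ i → t i * w i) (0≤-resp (sym (rescale w w)) 0≤Qw))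
    where
    rescale : ∀ v w → bilinear (λ i j → s i * s j * M i j) (λ i → t i * v i) (λ i → t i * w i) ≈ bilinear M v w
    rescale v w = sum-cong λ i → begin
      t i * v i * sum (λ j → s i * s j * M i j * (t j * w j))
        ≈⟨ *-congˡ (trans (sum-cong λ j → trans
             (solve 5 (λ s r m t w → s :* r :* m :* (t :* w) := s :* (t :* r :* (m :* w))) refl
               (s i) (s j) (M i j) (t j) (w j))
             (*-congˡ (trans (*-congʳ (ts≈1 j)) (*-identityˡ _)))) (sum-*ˡ (s i) _)) ⟩
      t i * v i * (s i * apply M w i)
        ≈⟨ solve 4 (λ t v s a → t :* v :* (s :* a) := t :* s :* (v :* a)) refl (t i) (v i) (s i) (apply M w i) ⟩
      t i * s i * (v i * apply M w i)
        ≈⟨ trans (*-congʳ (ts≈1 i)) (*-identityˡ _) ⟩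
      v i * apply M w i ∎

  bilinear-pencil : ∀ e (A C : Matrix n) v w →
    bilinear (λ i j → e * A i j + C i j) v w ≈ e * bilinear A v w + bilinear C v w
  bilinear-pencil e A C v w = begin
    sum (λ i → v i * sum (λ j → (e * A i j + C i j) * w j))
      ≈⟨ sum-cong (λ i → trans (*-congˡ (row i))
           (solve 4 (λ v e a c → v :* (e :* a :+ c) := e :* (v :* a) :+ v :* c) refl
             (v i) e (apply A w i) (apply C w i))) ⟩
    sum (λ i → e * (v i * apply A w i) + v i * apply C w i)
      ≈⟨ trans (sum-+ _ _) (+-congʳ (sum-*ˡ e _)) ⟩
    e * bilinear A v w + bilinear C v w ∎
    where
    row : ∀ i → sum (λ j → (e * A i j + C i j) * w j) ≈ e * apply A w i + apply C w i
    row i = trans (sum-cong λ j → solve 4 (λ e a c w → (e :* a :+ c) :* w := e :* (a :* w) :+ c :* w) refl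
        e (A i j) (C i j) (w j))
      (trans (sum-+ _ _) (+-congʳ (sum-*ˡ e _)))

  -- A violation at v, w with Qw > 0 persists in the pencil: there the discriminant is e² f₀ + e f₁
  -- + f₂ with f₀ > 0 and the value at w is e Qw + Qw′, so a large e contradicts the hypothesis.
  hyperbolic-limit : {A : Matrix n} (C : Matrix n) →
    (∀ e → 0# < e → Hyperbolic (λ i j → e * A i j + C i j)) → Hyperbolic A
  hyperbolic-limit {n} {A} C h = hyperbolic-by main
    where
    module _ (v w : Vector n) (0<Qw : 0# < quadratic A w)
             (B²<QvQw : bilinear A v w * bilinear A v w < quadratic A v * quadratic A w) where
      Qv B Qw Qv′ B′ Qw′ f₀ f₁ f₂ r s R S e : Carrier
      Qv  = quadratic A v
      B   = bilinear A v w
      Qw  = quadratic A w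
      Qv′ = quadratic C v
      B′  = bilinear C v w
      Qw′ = quadratic C w
      f₀ = Qv * Qw - B * B
      f₁ = Qv * Qw′ + Qv′ * Qw - (B * B′ + B * B′)
      f₂ = Qv′ * Qw′ - B′ * B′
      0<f₀ : 0# < f₀
      0<f₀ = <⇒0<- B²<QvQw
      r = recip Qw (<⇒# 0<Qw)
      s = recip f₀ (<⇒# 0<f₀)
      -- Since 1 + x + x² is nonnegative, `1# + x * x` can replace the absolute value of x: `R`
      -- outweighs `Qw′`, and `S` outweighs `f₁` and `f₂` together.
      R = 1# + Qw′ * Qw′
      S = 1# + f₁ * f₁ + (1# + f₂ * f₂)
      -- Large enough for e Qw + Qw′ and e² f₀ + e f₁ + f₂ to be positive.
      e = 1# + (r * R + s * S)

      1+square-pos : ∀ x → 0# < 1# + x * x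
      1+square-pos x = +-pos-nonneg 0<1 (square-nonneg x)

      1+x+x²-nonneg : ∀ x → 0# ≤ 1# + x + x * x
      1+x+x²-nonneg x = +-cancel-nonneg (0≤-resp
        (solve 1 (λ x → (con (+ 1) :+ x) :* (con (+ 1) :+ x) :+ (con (+ 1) :+ x :* x)
           := (con (+ 1) :+ x :+ x :* x) :+ (con (+ 1) :+ x :+ x :* x)) refl x)
        (+-nonneg (square-nonneg (1# + x)) (<⇒≤ (1+square-pos x))))

      0<rR : 0# < r * R
      0<rR = *-pos (recip-pos 0<Qw _) (1+square-pos Qw′)

      0<sS : 0# < s * S
      0<sS = *-pos (recip-pos 0<f₀ _) (+-pos (1+square-pos f₁) (1+square-pos f₂))

      0<e : 0# < e
      0<e = +-pos 0<1 (+-pos 0<rR 0<sS)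

      Qw-pencil : 0# ≤ e * Qw + Qw′
      Qw-pencil = 0≤-resp (begin
          Qw + (1# + Qw′ + Qw′ * Qw′) + Qw * (s * S)
            ≈⟨ solve 3 (λ q p t → q :+ (con (+ 1) :+ p :+ p :* p) :+ t
                 := q :+ con (+ 1) :* (con (+ 1) :+ p :* p) :+ p :+ t) refl Qw Qw′ (Qw * (s * S)) ⟩
          Qw + 1# * R + Qw′ + Qw * (s * S)
            ≈⟨ +-congʳ (+-congʳ (+-congˡ (*-congʳ (recip-inverse Qw _)))) ⟨
          Qw + Qw * r * R + Qw′ + Qw * (s * S)
            ≈⟨ solve 5 (λ q p r k t → q :+ q :* r :* k :+ p :+ q :* t
                 := (con (+ 1) :+ (r :* k :+ t)) :* q :+ p) refl Qw Qw′ r R (s * S) ⟩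
          e * Qw + Qw′ ∎)
        (+-nonneg (+-nonneg (<⇒≤ 0<Qw) (1+x+x²-nonneg Qw′)) (<⇒≤ (*-pos 0<Qw 0<sS)))

      slope : Carrier
      slope = f₀ + (1# + f₁ + f₁ * f₁) + f₀ * (r * R)

      0<slope : 0# < slope
      0<slope = +-pos (+-pos-nonneg 0<f₀ (1+x+x²-nonneg f₁)) (*-pos 0<f₀ 0<rR)

      slope-eq : slope + (1# + f₂ * f₂) ≈ e * f₀ + f₁
      slope-eq = begin
        slope + (1# + f₂ * f₂)
          ≈⟨ solve 4 (λ a b c t → a :+ (con (+ 1) :+ b :+ b :* b) :+ t :+ (con (+ 1) :+ c :* c)
               := a :+ con (+ 1) :* (con (+ 1) :+ b :* b :+ (con (+ 1) :+ c :* c)) :+ b :+ t)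
               refl f₀ f₁ f₂ (f₀ * (r * R)) ⟩
        f₀ + 1# * S + f₁ + f₀ * (r * R)
          ≈⟨ +-congʳ (+-congʳ (+-congˡ (*-congʳ (recip-inverse f₀ _)))) ⟨
        f₀ + f₀ * s * S + f₁ + f₀ * (r * R)
          ≈⟨ solve 5 (λ q p r k t → q :+ q :* r :* k :+ p :+ q :* t
               := (con (+ 1) :+ (t :+ r :* k)) :* q :+ p) refl f₀ f₁ s S (r * R) ⟩
        e * f₀ + f₁ ∎

      discriminant : 0# < (e * Qv + Qv′) * (e * Qw + Qw′) - (e * B + B′) * (e * B + B′)
      discriminant = 0<-resp (begin
          slope + (1# + f₂ + f₂ * f₂) + (r * R + s * S) * (e * f₀ + f₁)
            ≈⟨ solve 4 (λ k c e′ g → k :+ (con (+ 1) :+ c :+ c :* c) :+ e′ :* g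
                 := (k :+ (con (+ 1) :+ c :* c)) :+ e′ :* g :+ c) refl slope f₂ (r * R + s * S) (e * f₀ + f₁) ⟩
          slope + (1# + f₂ * f₂) + (r * R + s * S) * (e * f₀ + f₁) + f₂
            ≈⟨ +-congʳ (+-congʳ slope-eq) ⟩
          e * f₀ + f₁ + (r * R + s * S) * (e * f₀ + f₁) + f₂
            ≈⟨ solve 3 (λ e′ g c → g :+ e′ :* g :+ c := (con (+ 1) :+ e′) :* g :+ c) refl (r * R + s * S) (e * f₀ + f₁) f₂ ⟩
          e * (e * f₀ + f₁) + f₂
            ≈⟨ solve 7 (λ e v b w v′ b′ w′ →
                 e :* (e :* (v :* w :- b :* b) :+ (v :* w′ :+ v′ :* w :- (b :* b′ :+ b :* b′))) :+ (v′ :* w′ :- b′ :* b′)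
                 := (e :* v :+ v′) :* (e :* w :+ w′) :- (e :* b :+ b′) :* (e :* b :+ b′))
                 refl e Qv B Qw Qv′ B′ Qw′ ⟩
          (e * Qv + Qv′) * (e * Qw + Qw′) - (e * B + B′) * (e * B + B′) ∎)
        (+-pos-nonneg (+-pos-nonneg 0<slope (1+x+x²-nonneg f₂))
          (*-nonneg (<⇒≤ (+-pos 0<rR 0<sS))
            (0≤-resp slope-eq (<⇒≤ (+-pos 0<slope (1+square-pos f₂))))))

    main : ∀ v w → 0# < quadratic A w →
       ¬ (bilinear A v w * bilinear A v w < quadratic A v * quadratic A w)
    main v w p q = ≤-resp (*-cong (eq v v) (eq w w)) (*-cong (eq v w) (eq v w))
      (h (e v w p q) (0<e v w p q) v w (0≤-resp (sym (eq w w)) (Qw-pencil v w p q)))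
      (0<-⇒< (discriminant v w p q))
      where
      eq = bilinear-pencil (e v w p q) A C

-- Sums over lists.

module ListSums {c ℓ₁ ℓ₂} (ℛ : Reals c ℓ₁ ℓ₂) where
  open OrderedField ℛ

  private variable
    a b : Level
    A : Set a
    B : Set b

  ∑-cong : (xs : List A) {f g : A → Carrier} → (∀ x → f x ≈ g x) → ∑ xs f ≈ ∑ xs g
  ∑-cong []       p = refl
  ∑-cong (x ∷ xs) p = +-cong (p x) (∑-cong xs p)

  ∑-zero : (xs : List A) {f : A → Carrier} → (∀ x → f x ≈ 0#) → ∑ xs f ≈ 0#
  ∑-zero []       p = refl
  ∑-zero (x ∷ xs) p = trans (+-cong (p x) (∑-zero xs p)) (+-identityʳ 0#)

  ∑-nonneg : (xs : List A) {f : A → Carrier} → (∀ x → 0# ≤ f x) → 0# ≤ ∑ xs f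
  ∑-nonneg []       p = 0≤0
  ∑-nonneg (x ∷ xs) p = +-nonneg (p x) (∑-nonneg xs p)

  ∑-pos : {xs : List A} {f : A → Carrier} → (∀ x → 0# ≤ f x) → ∀ {x} → x ∈ xs → 0# < f x → 0# < ∑ xs f
  ∑-pos {xs = _ ∷ xs} p (here ≡.refl) 0<fx = +-pos-nonneg 0<fx (∑-nonneg xs p)
  ∑-pos {xs = y ∷ xs} p (there x∈)    0<fx = +-nonneg-pos (p y) (∑-pos p x∈ 0<fx)

  ∑-filter : ∀ {p} {P : Pred A p} (P? : Decidable P) xs (f : A → Carrier) →
    ∑ (filter P? xs) f ≈ ∑ xs (λ x → if does (P? x) then f x else 0#)
  ∑-filter P? []       f = refl
  ∑-filter P? (x ∷ xs) f with P? x
  ... | yes _ = +-congˡ (∑-filter P? xs f)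
  ... | no _  = trans (∑-filter P? xs f) (sym (+-identityˡ _))

  ∑-filter-support : ∀ {p} {P : Pred A p} (P? : Decidable P) xs {f : A → Carrier} →
    (∀ {x} → ¬ P x → f x ≈ 0#) → ∑ (filter P? xs) f ≈ ∑ xs f
  ∑-filter-support P? []       z = refl
  ∑-filter-support P? (x ∷ xs) z with P? x
  ... | yes _  = +-congˡ (∑-filter-support P? xs z)
  ... | no ¬Px = trans (∑-filter-support P? xs z) (trans (sym (+-identityˡ _)) (+-congʳ (sym (z ¬Px))))

  ∑-tabulate : ∀ {n} (g : Fin n → A) (f : A → Carrier) → ∑ (tabulate g) f ≈ sum (λ i → f (g i))
  ∑-tabulate {n = zero}  g f = sym (sum-zero λ ())
  ∑-tabulate {n = suc n} g f = trans (+-congˡ (∑-tabulate (λ i → g (suc i)) f)) (sym (sum-suc _))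

  ∑-allFin : ∀ {n} (f : Fin n → Carrier) → ∑ (allFin n) f ≈ sum f
  ∑-allFin f = ∑-tabulate (λ i → i) f

  ∑-filter-allFin : ∀ {n p} {P : Pred (Fin n) p} (P? : Decidable P) (f : Fin n → Carrier) →
    ∑ (filter P? (allFin n)) f ≈ sum (λ i → if does (P? i) then f i else 0#)
  ∑-filter-allFin P? f = trans (∑-filter P? (allFin _) f) (∑-allFin _)

  ∑-++ : (xs ys : List A) (f : A → Carrier) → ∑ (xs ++ ys) f ≈ ∑ xs f + ∑ ys f
  ∑-++ []       ys f = sym (+-identityˡ _)
  ∑-++ (x ∷ xs) ys f = trans (+-congˡ (∑-++ xs ys f)) (sym (+-assoc _ _ _))

  ∑-map : (g : A → B) (xs : List A) (f : B → Carrier) → ∑ (map g xs) f ≡ ∑ xs (λ x → f (g x))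
  ∑-map g []       f = ≡.refl
  ∑-map g (x ∷ xs) f = ≡.cong (λ s → f (g x) + s) (∑-map g xs f)

  ∑-cartesianProductWith : ∀ {c} {C : Set c} (g : A → B → C) xs ys (f : C → Carrier) →
    ∑ (cartesianProductWith g xs ys) f ≈ ∑ xs (λ x → ∑ ys (λ y → f (g x y)))
  ∑-cartesianProductWith g []       ys f = refl
  ∑-cartesianProductWith g (x ∷ xs) ys f = trans (∑-++ (map (g x) ys) _ f)
    (+-cong (reflexive (∑-map (g x) ys f)) (∑-cartesianProductWith g xs ys f))

  ∑-cong∈ : (xs : List A) {f g : A → Carrier} → (∀ {x} → x ∈ xs → f x ≈ g x) → ∑ xs f ≈ ∑ xs g
  ∑-cong∈ []       p = refl
  ∑-cong∈ (x ∷ xs) p = +-cong (p (here ≡.refl)) (∑-cong∈ xs (λ x∈ → p (there x∈)))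

  ∑-nonneg∈ : (xs : List A) {f : A → Carrier} → (∀ {x} → x ∈ xs → 0# ≤ f x) → 0# ≤ ∑ xs f
  ∑-nonneg∈ []       p = 0≤0
  ∑-nonneg∈ (x ∷ xs) p = +-nonneg (p (here ≡.refl)) (∑-nonneg∈ xs (λ x∈ → p (there x∈)))

  ∑-+ : (xs : List A) (f g : A → Carrier) → ∑ xs (λ x → f x + g x) ≈ ∑ xs f + ∑ xs g
  ∑-+ []       f g = sym (+-identityʳ 0#)
  ∑-+ (x ∷ xs) f g = trans (+-congˡ (∑-+ xs f g))
    (solve 4 (λ a b s t → a :+ b :+ (s :+ t) := a :+ s :+ (b :+ t)) refl (f x) (g x) (∑ xs f) (∑ xs g))

  ∑-*ʳ : (xs : List A) (f : A → Carrier) (c : Carrier) → ∑ xs (λ x → f x * c) ≈ ∑ xs f * c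
  ∑-*ʳ []       f c = sym (zeroˡ c)
  ∑-*ʳ (x ∷ xs) f c = trans (+-congˡ (∑-*ʳ xs f c)) (sym (distribʳ c (f x) (∑ xs f)))

  ∑-comm : (xs : List A) (ys : List B) (f : A → B → Carrier) →
    ∑ xs (λ x → ∑ ys (λ y → f x y)) ≈ ∑ ys (λ y → ∑ xs (λ x → f x y))
  ∑-comm []       ys f = sym (∑-zero ys λ _ → refl)
  ∑-comm (x ∷ xs) ys f = trans (+-congˡ (∑-comm xs ys f)) (sym (∑-+ ys _ _))

  ∑-single : {P : A → Set b} (P? : ∀ x → Dec (P x)) {xs : List A} → Unique xs → ∀ {y} → y ∈ xs →
    (∀ {x} → P x → x ≡ y) → P y → ∀ c → ∑ xs (λ x → if does (P? x) then c else 0#) ≈ c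
  ∑-single {P = P} P? {x ∷ xs} (x∉ ∷ u) {y} (here ≡.refl) uniq Py c =
    trans (+-cong (yes′ (P? y)) (trans (∑-cong∈ xs (λ z∈ → no′ z∈ (P? _))) (∑-zero xs (λ _ → refl)))) (+-identityʳ c)
    where
    yes′ : (d : Dec (P y)) → (if does d then c else 0#) ≈ c
    yes′ (yes _)  = refl
    yes′ (no ¬Py) = contradiction Py ¬Py
    no′ : ∀ {z} → z ∈ xs → (d : Dec (P z)) → (if does d then c else 0#) ≈ 0#
    no′ z∈ (yes Pz) = contradiction (≡.sym (uniq Pz)) (All.lookup x∉ z∈)
    no′ z∈ (no _)   = refl
  ∑-single {P = P} P? {x ∷ xs} (x∉ ∷ u) {y} (there y∈) uniq Py c =
    trans (+-cong (no′ (P? x)) (∑-single P? u y∈ uniq Py c)) (+-identityˡ c)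
    where
    no′ : (d : Dec (P x)) → (if does d then c else 0#) ≈ 0#
    no′ (yes Px) = contradiction (uniq Px) (All.lookup x∉ y∈)
    no′ (no _)   = refl

  -- The tangent form of the Cauchy–Schwarz inequality (Σ B)² ≤ Σ E Σ ρ.
  ∑∈-tangent : ∀ λ′ (xs : List A) (B E : A → Carrier) (ρ : ∀ {x} → x ∈ xs → Carrier) →
    (∀ {x} (x∈ : x ∈ xs) → 0# ≤ E x + λ′ * λ′ * ρ x∈ - (λ′ + λ′) * B x) →
    0# ≤ ∑ xs E + λ′ * λ′ * ∑∈ xs ρ - (λ′ + λ′) * ∑ xs B
  ∑∈-tangent λ′ []       B E ρ p = ≤-reflexive
    (solve 1 (λ l → con (+ 0) := con (+ 0) :+ l :* l :* con (+ 0) :- (l :+ l) :* con (+ 0)) refl λ′)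
  ∑∈-tangent λ′ (x ∷ xs) B E ρ p = 0≤-resp
    (solve 7 (λ l b b′ e e′ r r′ → (e :+ l :* l :* r :- (l :+ l) :* b) :+ (e′ :+ l :* l :* r′ :- (l :+ l) :* b′)
       := (e :+ e′) :+ l :* l :* (r :+ r′) :- (l :+ l) :* (b :+ b′)) refl
       λ′ (B x) (∑ xs B) (E x) (∑ xs E) (ρ (here ≡.refl)) (∑∈ xs (λ x∈ → ρ (there x∈))))
    (+-nonneg (p (here ≡.refl)) (∑∈-tangent λ′ xs B E (λ x∈ → ρ (there x∈)) (λ x∈ → p (there x∈))))

-- Weights of continuations and the matrices of the atlas.

module Continuations {c ℓ₁ ℓ₂ n ℓ} (ℛ : Reals c ℓ₁ ℓ₂) (𝒢 : Greedoid n ℓ)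
  (weight : Weighted.Weight ℛ 𝒢) where
  open OrderedField ℛ
  open LinearAlgebra ℛ
  open Hyperbolicity ℛ
  open ListSums ℛ
  open Greedoid 𝒢
  open Weighted ℛ 𝒢
  open Weight weight
  open import Relation.Binary.Reasoning.Setoid setoid

  -- The paper's L_{q,αγ}(m).
  W : Word n → Word n → ℕ → Carrier
  W α γ m = ∑ (words m) λ β → q (α ++ γ ++ β)

  q-nonneg : ∀ α → 0# ≤ q α
  q-nonneg α = split {P = ℒ α} (λ α∈ → <⇒≤ (q-pos α∈)) (λ α∉ → ≤-reflexive (sym (q-zero α∉)))

  W-nonneg : ∀ α γ m → 0# ≤ W α γ m
  W-nonneg α γ m = ∑-nonneg (words m) λ β → q-nonneg _

  W-dead : ∀ α γ m → ¬ ℒ (α ++ γ) → W α γ m ≈ 0#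
  W-dead α γ m αγ∉ = ∑-zero (words m) λ β → q-zero λ αγβ∈ →
    αγ∉ (hereditary (α ++ γ) β (≡.subst ℒ (≡.sym (++-assoc α γ β)) αγβ∈))

  -- The base word is kept apart from the letters after it, so that words have the form
  -- `α ++ x ∷ y ∷ β` in which the conditions on the weight are stated. This moves the base to αx.
  W-snoc : ∀ α x γ m → W (α ++ x ∷ []) γ m ≈ W α (x ∷ γ) m
  W-snoc α x γ m = ∑-cong (words m) λ β → reflexive (≡.cong q (++-assoc α (x ∷ []) (γ ++ β)))

  W-suc : ∀ α γ m → W α γ (suc m) ≈ sum λ x → W α (γ ++ x ∷ []) m
  W-suc α γ m = trans (∑-cartesianProductWith _∷_ (allFin n) (words m) _) (trans (∑-allFin _)
    (sum-cong λ x → ∑-cong (words m) λ β →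
      reflexive (≡.cong (λ δ → q (α ++ δ)) (≡.sym (++-assoc γ (x ∷ []) β)))))

  W-zero : ∀ α γ → W α γ 0 ≈ q (α ++ γ)
  W-zero α γ = trans (+-identityʳ _) (reflexive (≡.cong (λ δ → q (α ++ δ)) (++-identityʳ γ)))

  L≈W : ∀ j → L weight j ≈ W [] [] j
  L≈W j = ∑-filter-support ℒ? (words j) q-zero

  snoc∈ : ∀ {α x γ} → ℒ (α ++ x ∷ γ) → ℒ ((α ++ x ∷ []) ++ γ)
  snoc∈ {α} {x} {γ} = ≡.subst ℒ (≡.sym (++-assoc α (x ∷ []) γ))

  prefix∈ : ∀ {α x γ} → ℒ (α ++ x ∷ γ) → ℒ (α ++ x ∷ [])
  prefix∈ {α} {x} {γ} p = hereditary (α ++ x ∷ []) γ (snoc∈ p)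

  prefix₂∈ : ∀ {α x y γ} → ℒ (α ++ x ∷ y ∷ γ) → ℒ (α ++ x ∷ y ∷ [])
  prefix₂∈ {α} {x} {y} {γ} p = hereditary (α ++ x ∷ y ∷ []) γ
    (≡.subst ℒ (≡.sym (++-assoc α (x ∷ y ∷ []) γ)) p)

  ∈Cont : ∀ {α x} → ℒ (α ++ x ∷ []) → x ∈ Cont α
  ∈Cont {α} p = ∈-filter⁺ (λ x → ℒ? (α ++ x ∷ [])) (∈-allFin _) p

  ∈-words : ∀ (β : Word n) → β ∈ words (length β)
  ∈-words []      = here ≡.refl
  ∈-words (x ∷ β) = ∈-cartesianProductWith⁺ _∷_ (∈-allFin x) (∈-words β)

  -- Exchange against the longer word ξ adds one letter at a time. For ξ of maximal length every
  -- word of ℒ can be prolonged up to the rank, which gives the strict positivity in `W-pos`.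
  extend : ∀ {ξ α} r → ℒ ξ → ℒ α → length α ℕ.+ r ℕ.≤ length ξ →
    ∃ λ β → length β ≡ r × ℒ (α ++ β)
  extend {ξ} {α} zero    ξ∈ α∈ le = [] , ≡.refl , ≡.subst ℒ (≡.sym (++-identityʳ α)) α∈
  extend {ξ} {α} (suc r) ξ∈ α∈ le
    with exchange ξ∈ α∈ (ℕ.≤-trans (ℕ.m≤m+n (suc (length α)) r) (≡.subst (ℕ._≤ length ξ) (ℕ.+-suc (length α) r) le))
  ... | x , _ , αx∈
    with extend r ξ∈ αx∈ (≡.subst (ℕ._≤ length ξ) eq le)
    where
    eq : length α ℕ.+ suc r ≡ length (α ++ x ∷ []) ℕ.+ r
    eq = ≡.trans (≡.sym (ℕ.+-assoc (length α) 1 r)) (≡.cong (ℕ._+ r) (≡.sym (length-++ α)))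
  ... | β , len , αxβ∈ = x ∷ β , ≡.cong suc len , ≡.subst ℒ (++-assoc α (x ∷ []) β) αxβ∈

  W-pos : ∀ {k} → HasRank 𝒢 k → ∀ α γ m → ℒ (α ++ γ) → length (α ++ γ) ℕ.+ m ℕ.≤ k → 0# < W α γ m
  W-pos ((ξ , ξ∈ , ≡.refl) , _) α γ m αγ∈ le with extend m ξ∈ αγ∈ le
  ... | β , ≡.refl , αγβ∈ = ∑-pos (λ β → q-nonneg _) (∈-words β)
    (q-pos (≡.subst ℒ (++-assoc α γ β) αγβ∈))

  extends : Word n → Fin n → Bool
  extends α x = does (ℒ? (α ++ x ∷ []))

  -- The paper's matrix A(α, m), with 0 the index null.
  A : Word n → ℕ → Matrix (suc n)
  A α m zero    zero    = W α [] m
  A α m zero    (suc y) = W α (y ∷ []) m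
  A α m (suc x) zero    = W α (x ∷ []) m
  A α m (suc x) (suc y) = (if extends α y then W α (x ∷ y ∷ []) m else 0#)
    + δ x y * sum λ z → if extends α z then 0# else W α (x ∷ z ∷ []) m

  -- The weight of the word xy sits in column y if y continues α and on the diagonal otherwise; in
  -- row x it therefore multiplies the coordinate of y or that of x. Written this way, the diagonal
  -- correction disappears from the later sums.
  pull : Word n → Vector (suc n) → Fin n → Fin n → Carrier
  pull α u x y = if extends α y then u (suc y) else u (suc x)

  apply-null : ∀ α m u → apply (A α m) u zero
    ≈ u zero * W α [] m + sum λ x → u (suc x) * W α (x ∷ []) m
  apply-null α m u = trans (sum-suc _) (+-cong (*-comm _ _) (sum-cong λ x → *-comm _ _))

  if-cases : ∀ {p} {P : Set p} (d : Dec P) a v w →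
    (if does d then a else 0#) * v + (if does d then 0# else a) * w ≈ (if does d then v else w) * a
  if-cases (yes _) a v w = solve 3 (λ a v w → a :* v :+ con (+ 0) :* w := v :* a) refl a v w
  if-cases (no _)  a v w = solve 3 (λ a v w → con (+ 0) :* v :+ a :* w := w :* a) refl a v w

  apply-letter : ∀ α m u x → apply (A α m) u (suc x)
    ≈ u zero * W α (x ∷ []) m + sum λ y → pull α u x y * W α (x ∷ y ∷ []) m
  apply-letter α m u x = trans (sum-suc _) (+-cong (*-comm _ _) (begin
    sum (λ y → (on y + δ x y * sum off) * u (suc y))
      ≈⟨ sum-cong (λ y → solve 4 (λ a d s u → (a :+ d :* s) :* u := a :* u :+ d :* (s :* u)) refl
           (on y) (δ x y) (sum off) (u (suc y))) ⟩
    sum (λ y → on y * u (suc y) + δ x y * (sum off * u (suc y)))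
      ≈⟨ trans (sum-+ _ _) (+-congˡ (sum-δ x (λ y → sum off * u (suc y)))) ⟩
    sum (λ y → on y * u (suc y)) + sum off * u (suc x)
      ≈⟨ +-congˡ (sum-*ʳ (u (suc x)) off) ⟨
    sum (λ y → on y * u (suc y)) + sum (λ y → off y * u (suc x))
      ≈⟨ sum-+ _ _ ⟨
    sum (λ y → on y * u (suc y) + off y * u (suc x))
      ≈⟨ sum-cong (λ y → if-cases (ℒ? (α ++ y ∷ [])) (W α (x ∷ y ∷ []) m) (u (suc y)) (u (suc x))) ⟩
    sum (λ y → pull α u x y * W α (x ∷ y ∷ []) m) ∎))
    where
    on off : Fin n → Carrier
    on y  = if extends α y then W α (x ∷ y ∷ []) m else 0#
    off z = if extends α z then 0# else W α (x ∷ z ∷ []) m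

-- The induction on m: inheritance, pullback inequality and the passage from m to m + 1.

module InductiveStep {c ℓ₁ ℓ₂ n ℓ} (ℛ : Reals c ℓ₁ ℓ₂) (𝒢 : Greedoid n ℓ)
  (weight : Weighted.Weight ℛ 𝒢) (scale : Weighted.Scale ℛ 𝒢) (k : ℕ)
  (interval : IsInterval 𝒢)
  (contInv : ∀ {α} → Greedoid.ℒ 𝒢 α → length α ℕ.< k → Weighted.Conditions.ContInv ℛ 𝒢 weight scale α)
  (paMon : ∀ {α} → Greedoid.ℒ 𝒢 α → length α ℕ.< k → Weighted.Conditions.PAMon ℛ 𝒢 weight scale α)
  where
  open OrderedField ℛ
  open LinearAlgebra ℛ
  open Hyperbolicity ℛ
  open ListSums ℛ
  open Greedoid 𝒢
  open Weighted.Weight weight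
  open Continuations ℛ 𝒢 weight
  open import Relation.Binary.Reasoning.Setoid setoid

  W-swap : ∀ {α} → ℒ α → length α ℕ.< k → ∀ {x y} γ m → ℒ (α ++ x ∷ []) → ℒ (α ++ y ∷ []) →
    W α (x ∷ y ∷ γ) m ≈ W α (y ∷ x ∷ γ) m
  W-swap α∈ <k {x} {y} γ m αx∈ αy∈ = ∑-cong (words m) λ β →
    contInv α∈ <k x y (γ ++ β) (∈Cont αx∈) (∈Cont αy∈)

  A-sym : ∀ {α} → ℒ α → length α ℕ.< k → ∀ m i j → A α m i j ≈ A α m j i
  A-sym α∈ <k m zero    zero    = refl
  A-sym α∈ <k m zero    (suc y) = refl
  A-sym α∈ <k m (suc x) zero    = refl
  A-sym {α} α∈ <k m (suc x) (suc y) = +-cong (off (ℒ? (α ++ y ∷ [])) (ℒ? (α ++ x ∷ [])))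
    (δ-comm x y (λ x → sum λ z → if extends α z then 0# else W α (x ∷ z ∷ []) m))
    where
    off : (d : Dec (ℒ (α ++ y ∷ []))) (e : Dec (ℒ (α ++ x ∷ []))) →
      (if does d then W α (x ∷ y ∷ []) m else 0#) ≈ (if does e then W α (y ∷ x ∷ []) m else 0#)
    off (yes αy∈) (yes αx∈) = W-swap α∈ <k [] m αx∈ αy∈
    off (yes _)   (no αx∉)  = W-dead α _ m λ p → αx∉ (prefix∈ p)
    off (no αy∉)  (yes _)   = sym (W-dead α _ m λ p → αy∉ (prefix∈ p))
    off (no _)    (no _)    = refl

  A-nonneg : ∀ α m i j → 0# ≤ A α m i j
  A-nonneg α m zero    zero    = W-nonneg α _ m
  A-nonneg α m zero    (suc y) = W-nonneg α _ m
  A-nonneg α m (suc x) zero    = W-nonneg α _ m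
  A-nonneg α m (suc x) (suc y) = +-nonneg
    (if-nonneg (extends α y) (W-nonneg α _ m) 0≤0)
    (*-nonneg (δ-nonneg x y) (sum-nonneg λ z → if-nonneg (extends α z) 0≤0 (W-nonneg α _ m)))

  A-dead : ∀ α m → ¬ ℒ α → ∀ i j → A α m i j ≈ 0#
  A-dead α m α∉ = entry
    where
    dead : ∀ γ → W α γ m ≈ 0#
    dead γ = W-dead α γ m λ p → α∉ (hereditary α γ p)
    entry : ∀ i j → A α m i j ≈ 0#
    entry zero    zero    = dead _
    entry zero    (suc y) = dead _
    entry (suc x) zero    = dead _
    entry (suc x) (suc y) = trans (+-cong (if-zero (extends α y) (dead _) refl)
      (trans (*-congˡ (sum-zero λ z → if-zero (extends α z) refl (dead _))) (zeroʳ _))) (+-identityʳ 0#)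

  A-letter-dead : ∀ α m x → ¬ ℒ (α ++ x ∷ []) → ∀ j → A α m (suc x) j ≈ 0#
  A-letter-dead α m x αx∉ = entry
    where
    dead : ∀ γ → W α (x ∷ γ) m ≈ 0#
    dead γ = W-dead α (x ∷ γ) m λ p → αx∉ (prefix∈ p)
    entry : ∀ j → A α m (suc x) j ≈ 0#
    entry zero    = dead []
    entry (suc y) = trans (+-cong (if-zero (extends α y) (dead _) refl)
      (trans (*-congˡ (sum-zero λ z → if-zero (extends α z) refl (dead _))) (zeroʳ _))) (+-identityʳ 0#)

  -- The linear map along the edge of the atlas labelled x.
  T : Word n → Fin n → Vector (suc n) → Vector (suc n)
  T α x u zero    = u zero
  T α x u (suc y) = pull α u x y

  -- The paper's h, scaled to be 1 at null.
  H : Carrier → Vector (suc n)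
  H e zero    = 1#
  H e (suc x) = e

  pull-const : ∀ α e x y → pull α (H e) x y ≈ e
  pull-const α e x y with extends α y
  ... | true  = refl
  ... | false = refl

  T-H : ∀ α e x i → T α x (H e) i ≈ H e i
  T-H α e x zero    = refl
  T-H α e x (suc y) = pull-const α e x y

  pencil : Word n → ℕ → Carrier → Matrix (suc n)
  pencil α m e i j = e * A α (suc m) i j + A α m i j

  apply-pencil : ∀ α m e u i → apply (pencil α m e) u i ≈ e * apply (A α (suc m)) u i + apply (A α m) u i
  apply-pencil α m e u i = trans
    (sum-cong λ j → solve 4 (λ e a b u → (e :* a :+ b) :* u := e :* (a :* u) :+ b :* u) refl
      e (A α (suc m) i j) (A α m i j) (u j))
    (trans (sum-+ _ _) (+-congʳ (sum-*ˡ e _)))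

  -- Summing over one further letter raises the length by 1, and `pull` has no effect on a vector
  -- constant on the letters. So `H e` is sent to the null column of the pencil, which is the reason
  -- for the shape of both.
  apply-H : ∀ α m e i → apply (A α m) (H e) i ≈ e * A α (suc m) i zero + A α m i zero
  apply-H α m e zero = begin
    apply (A α m) (H e) zero                      ≈⟨ apply-null α m (H e) ⟩
    1# * W α [] m + sum (λ x → e * W α (x ∷ []) m)  ≈⟨ +-cong (*-identityˡ _) (sum-*ˡ e _) ⟩
    W α [] m + e * sum (λ x → W α (x ∷ []) m)     ≈⟨ +-comm _ _ ⟩
    e * sum (λ x → W α (x ∷ []) m) + W α [] m     ≈⟨ +-congʳ (*-congˡ (W-suc α [] m)) ⟨
    e * W α [] (suc m) + W α [] m                 ∎
  apply-H α m e (suc x) = begin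
    apply (A α m) (H e) (suc x)
      ≈⟨ apply-letter α m (H e) x ⟩
    1# * W α (x ∷ []) m + sum (λ y → pull α (H e) x y * W α (x ∷ y ∷ []) m)
      ≈⟨ +-cong (*-identityˡ _) (trans (sum-cong λ y → *-congʳ (pull-const α e x y)) (sum-*ˡ e _)) ⟩
    W α (x ∷ []) m + e * sum (λ y → W α (x ∷ y ∷ []) m)
      ≈⟨ +-comm _ _ ⟩
    e * sum (λ y → W α (x ∷ y ∷ []) m) + W α (x ∷ []) m
      ≈⟨ +-congʳ (*-congˡ (W-suc α (x ∷ []) m)) ⟨
    e * W α (x ∷ []) (suc m) + W α (x ∷ []) m ∎

  -- Row x records the words that begin with x after α, and so does the null column after αx; `T`
  -- accounts for the entries moved to the diagonal.
  apply-via-T : ∀ α m u x → apply (A α m) u (suc x) ≈ sum λ i → T α x u i * A (α ++ x ∷ []) m i zero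
  apply-via-T α m u x = trans (apply-letter α m u x) (sym (trans (sum-suc _)
    (+-cong (*-congˡ (W-snoc α x [] m)) (sum-cong λ y → *-congˡ (W-snoc α x (y ∷ []) m)))))

  bilinear-H : ∀ α m e v → bilinear (A α m) v (H e)
    ≈ e * sum (λ i → v i * A α (suc m) i zero) + sum (λ i → v i * A α m i zero)
  bilinear-H α m e v = begin
    sum (λ i → v i * apply (A α m) (H e) i)
      ≈⟨ sum-cong (λ i → trans (*-congˡ (apply-H α m e i))
           (solve 4 (λ v e a b → v :* (e :* a :+ b) := e :* (v :* a) :+ v :* b) refl
             (v i) e (A α (suc m) i zero) (A α m i zero))) ⟩
    sum (λ i → e * (v i * A α (suc m) i zero) + v i * A α m i zero)
      ≈⟨ trans (sum-+ _ _) (+-congʳ (sum-*ˡ e _)) ⟩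
    e * sum (λ i → v i * A α (suc m) i zero) + sum (λ i → v i * A α m i zero) ∎

  -- By `apply-via-T` and `bilinear-H`, a row of the pencil becomes a bilinear value against `H e`,
  -- the shape to which hyperbolicity of the neighbour applies.
  inheritance-letter : ∀ α m e u x →
    apply (pencil α m e) u (suc x) ≈ bilinear (A (α ++ x ∷ []) m) (T α x u) (H e)
  inheritance-letter α m e u x = begin
    apply (pencil α m e) u (suc x)
      ≈⟨ apply-pencil α m e u (suc x) ⟩
    e * apply (A α (suc m)) u (suc x) + apply (A α m) u (suc x)
      ≈⟨ +-cong (*-congˡ (apply-via-T α (suc m) u x)) (apply-via-T α m u x) ⟩
    e * sum (λ i → T α x u i * A (α ++ x ∷ []) (suc m) i zero) + sum (λ i → T α x u i * A (α ++ x ∷ []) m i zero)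
      ≈⟨ bilinear-H (α ++ x ∷ []) m e (T α x u) ⟨
    bilinear (A (α ++ x ∷ []) m) (T α x u) (H e) ∎

  inheritance-null : ∀ α m e u → apply (pencil α m e) u zero ≈ bilinear (A α m) u (H e)
  inheritance-null α m e u = begin
    apply (pencil α m e) u zero
      ≈⟨ apply-pencil α m e u zero ⟩
    e * apply (A α (suc m)) u zero + apply (A α m) u zero
      ≈⟨ +-cong (*-congˡ (column (suc m))) (column m) ⟩
    e * sum (λ i → u i * A α (suc m) i zero) + sum (λ i → u i * A α m i zero)
      ≈⟨ bilinear-H α m e u ⟨
    bilinear (A α m) u (H e) ∎
    where
    column : ∀ m → apply (A α m) u zero ≈ sum λ i → u i * A α m i zero
    column m = trans (apply-null α m u) (sym (sum-suc _))

  -- Pullback inequality.  Expanding both sides over words xyz, the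
  -- difference splits into sums that cancel in pairs, except for the
  -- passive and active triples compared by PAMon.
  module Pullback {α} (α∈ : ℒ α) (m : ℕ) (<k : suc (length α) ℕ.< k) (u : Vector (suc n)) where
    a : Vector n
    a x = u (suc x)

    p : Fin n → Fin n → Carrier
    p = pull α u

    W₂ : Fin n → Fin n → Carrier
    W₂ x y = W α (x ∷ y ∷ []) (suc m)

    W₃ : Fin n → Fin n → Fin n → Carrier
    W₃ x y z = W α (x ∷ y ∷ z ∷ []) m

    -- What `pull (α ++ x ∷ []) (T α x u) y z` becomes after reassociating the word in its test.
    p₂ : Fin n → Fin n → Fin n → Carrier
    p₂ x y z = if does (ℒ? (α ++ x ∷ z ∷ [])) then p x z else p x y

    α<k : length α ℕ.< k
    α<k = ℕ.<-trans (ℕ.n<1+n _) <k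

    αx<k : ∀ x → length (α ++ x ∷ []) ℕ.< k
    αx<k x = ≡.subst (ℕ._< k) (≡.sym (≡.trans (length-++ α) (ℕ.+-comm (length α) 1))) <k

    dead₁ : ∀ {x} → ¬ ℒ (α ++ x ∷ []) → ∀ γ m → W α (x ∷ γ) m ≈ 0#
    dead₁ αx∉ γ m = W-dead α _ m λ p → αx∉ (prefix∈ p)

    dead₂ : ∀ {x y} → ¬ ℒ (α ++ x ∷ y ∷ []) → ∀ γ m → W α (x ∷ y ∷ γ) m ≈ 0#
    dead₂ αxy∉ γ m = W-dead α _ m λ p → αxy∉ (prefix₂∈ p)

    swap₁₂ : ∀ {x y} → ℒ (α ++ x ∷ []) → ℒ (α ++ y ∷ []) → ∀ z → W₃ x y z ≈ W₃ y x z
    swap₁₂ αx∈ αy∈ z = W-swap α∈ α<k (z ∷ []) m αx∈ αy∈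

    -- If αxy is in ℒ, this is `ContInv` at αx. Otherwise xyz is dead by heredity, and xzy is dead
    -- because the interval property would derive αxy from αy and αxzy.
    swap₂₃ : ∀ {x y z} → ℒ (α ++ y ∷ []) → ℒ (α ++ x ∷ z ∷ []) → W₃ x y z ≈ W₃ x z y
    swap₂₃ {x} {y} {z} αy∈ αxz∈ = by (ℒ? (α ++ x ∷ y ∷ []))
      where
      by : Dec (ℒ (α ++ x ∷ y ∷ [])) → W₃ x y z ≈ W₃ x z y
      by (yes αxy∈) = begin
        W₃ x y z                                ≈⟨ W-snoc α x (y ∷ z ∷ []) m ⟨
        W (α ++ x ∷ []) (y ∷ z ∷ []) m          ≈⟨ W-swap (prefix∈ αxz∈) (αx<k x) [] m (snoc∈ αxy∈) (snoc∈ αxz∈) ⟩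
        W (α ++ x ∷ []) (z ∷ y ∷ []) m          ≈⟨ W-snoc α x (z ∷ y ∷ []) m ⟩
        W₃ x z y                                ∎
      by (no αxy∉) = trans (dead₂ αxy∉ (z ∷ []) m)
        (sym (W-dead α _ m λ p → αxy∉ (interval α (x ∷ []) (z ∷ []) y αy∈ p)))

    -- Three adjacent transpositions, through yxz and yzx. If αyz is not in ℒ both of these are
    -- dead: yzx by heredity, yxz by the interval property with αz.
    reverse : ∀ {x y z} → ℒ (α ++ x ∷ []) → ℒ (α ++ y ∷ []) → ℒ (α ++ z ∷ []) → W₃ x y z ≈ W₃ z y x
    reverse {x} {y} {z} αx∈ αy∈ αz∈ = by (ℒ? (α ++ y ∷ z ∷ []))
      where
      by : Dec (ℒ (α ++ y ∷ z ∷ [])) → W₃ x y z ≈ W₃ z y x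
      by (yes αyz∈) = trans (swap₁₂ αx∈ αy∈ z) (trans (swap₂₃ αx∈ αyz∈) (swap₁₂ αy∈ αz∈ x))
      by (no αyz∉)  = trans
        (trans (swap₁₂ αx∈ αy∈ z) (W-dead α _ m λ p → αyz∉ (interval α (y ∷ []) (x ∷ []) z αz∈ p)))
        (sym (trans (swap₁₂ αz∈ αy∈ x) (dead₂ αyz∉ (x ∷ []) m)))

    u₀ : Carrier
    u₀ = u zero

    w : Fin n → Fin n → Carrier
    w x y = W α (x ∷ y ∷ []) m

    crossTerm : Fin n → Fin n → Carrier
    crossTerm x y = (u₀ + u₀) * (w x y * (p x y - a x))

    F : Fin n → Fin n → Fin n → Carrier
    F x y z = W₃ x y z * (p x y * p₂ x y z - a x * p x y)

    expand : ∀ V (P w G : Vector n) →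
      u₀ * (u₀ * V + sum (λ y → P y * w y)) + sum (λ y → P y * (u₀ * w y + G y))
        ≈ u₀ * u₀ * V + sum (λ y → (u₀ + u₀) * (P y * w y) + P y * G y)
    expand V P w G = begin
      u₀ * (u₀ * V + sum (λ y → P y * w y)) + sum (λ y → P y * (u₀ * w y + G y))
        ≈⟨ +-congʳ (solve 3 (λ u v s → u :* (u :* v :+ s) := u :* u :* v :+ u :* s) refl u₀ V (sum λ y → P y * w y)) ⟩
      u₀ * u₀ * V + u₀ * sum (λ y → P y * w y) + sum (λ y → P y * (u₀ * w y + G y))
        ≈⟨ +-congʳ (+-congˡ (sum-*ˡ u₀ _)) ⟨
      u₀ * u₀ * V + sum (λ y → u₀ * (P y * w y)) + sum (λ y → P y * (u₀ * w y + G y))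
        ≈⟨ trans (+-assoc _ _ _) (+-congˡ (sym (sum-+ _ _))) ⟩
      u₀ * u₀ * V + sum (λ y → u₀ * (P y * w y) + P y * (u₀ * w y + G y))
        ≈⟨ +-congˡ (sum-cong λ y → solve 4 (λ u p w g → u :* (p :* w) :+ p :* (u :* w :+ g)
             := (u :+ u) :* (p :* w) :+ p :* g) refl u₀ (P y) (w y) (G y)) ⟩
      u₀ * u₀ * V + sum (λ y → (u₀ + u₀) * (P y * w y) + P y * G y) ∎

    -- `rhs x` gathers the terms of the form of A(α, m + 1) that belong to words beginning with x;
    -- `W-suc` adds a letter to the words of the null terms so that they match those of `lhs x`.
    lhs rhs : Fin n → Carrier
    lhs x = quadratic (A (α ++ x ∷ []) m) (T α x u)
    rhs x = u₀ * (u₀ * W α (x ∷ []) m + sum (λ y → a x * w x y))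
          + sum (λ y → a x * (u₀ * w x y + p x y * W₂ x y))

    lhs-expansion : ∀ x → lhs x ≈ u₀ * (u₀ * W α (x ∷ []) m + sum (λ y → p x y * w x y))
      + sum (λ y → p x y * (u₀ * w x y + sum λ z → p₂ x y z * W₃ x y z))
    lhs-expansion x = trans (sum-suc _) (+-cong
      (*-congˡ (trans (apply-null αx m (T α x u)) (+-cong (*-congˡ (W-snoc α x [] m))
        (sum-cong λ y → *-congˡ (W-snoc α x (y ∷ []) m)))))
      (sum-cong λ y → *-congˡ (trans (apply-letter αx m (T α x u) y) (+-cong (*-congˡ (W-snoc α x (y ∷ []) m))
        (sum-cong λ z → *-cong (reflexive (≡.cong (λ γ → if does (ℒ? γ) then p x z else p x y)
            (++-assoc α (x ∷ []) (z ∷ []))))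
          (W-snoc α x (y ∷ z ∷ []) m))))))
      where
      αx = α ++ x ∷ []

    rhs-expansion : quadratic (A α (suc m)) u ≈ sum rhs
    rhs-expansion = begin
      quadratic (A α (suc m)) u
        ≈⟨ sum-suc _ ⟩
      u₀ * apply (A α (suc m)) u zero + sum (λ x → a x * apply (A α (suc m)) u (suc x))
        ≈⟨ +-cong (*-congˡ null) (sum-cong letter) ⟩
      u₀ * sum (λ x → u₀ * W α (x ∷ []) m + sum (λ y → a x * w x y))
        + sum (λ x → sum (λ y → a x * (u₀ * w x y + p x y * W₂ x y)))
        ≈⟨ +-congʳ (sum-*ˡ u₀ _) ⟨
      sum (λ x → u₀ * (u₀ * W α (x ∷ []) m + sum (λ y → a x * w x y)))
        + sum (λ x → sum (λ y → a x * (u₀ * w x y + p x y * W₂ x y)))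
        ≈⟨ sum-+ _ _ ⟨
      sum rhs ∎
      where
      null : apply (A α (suc m)) u zero ≈ sum (λ x → u₀ * W α (x ∷ []) m + sum (λ y → a x * w x y))
      null = begin
        apply (A α (suc m)) u zero
          ≈⟨ apply-null α (suc m) u ⟩
        u₀ * W α [] (suc m) + sum (λ x → a x * W α (x ∷ []) (suc m))
          ≈⟨ +-cong (trans (*-congˡ (W-suc α [] m)) (sym (sum-*ˡ u₀ _)))
               (sum-cong λ x → trans (*-congˡ (W-suc α (x ∷ []) m)) (sym (sum-*ˡ (a x) _))) ⟩
        sum (λ x → u₀ * W α (x ∷ []) m) + sum (λ x → sum (λ y → a x * w x y))
          ≈⟨ sum-+ _ _ ⟨
        sum (λ x → u₀ * W α (x ∷ []) m + sum (λ y → a x * w x y)) ∎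
      letter : ∀ x → a x * apply (A α (suc m)) u (suc x) ≈ sum (λ y → a x * (u₀ * w x y + p x y * W₂ x y))
      letter x = begin
        a x * apply (A α (suc m)) u (suc x)
          ≈⟨ *-congˡ (apply-letter α (suc m) u x) ⟩
        a x * (u₀ * W α (x ∷ []) (suc m) + sum (λ y → p x y * W₂ x y))
          ≈⟨ *-congˡ (+-congʳ (trans (*-congˡ (W-suc α (x ∷ []) m)) (sym (sum-*ˡ u₀ _)))) ⟩
        a x * (sum (λ y → u₀ * w x y) + sum (λ y → p x y * W₂ x y))
          ≈⟨ *-congˡ (sum-+ _ _) ⟨
        a x * sum (λ y → u₀ * w x y + p x y * W₂ x y)
          ≈⟨ sum-*ˡ (a x) _ ⟨
        sum (λ y → a x * (u₀ * w x y + p x y * W₂ x y)) ∎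

    row-difference : ∀ x → lhs x - rhs x ≈ sum (λ y → crossTerm x y + sum λ z → F x y z)
    row-difference x = begin
      lhs x - rhs x
        ≈⟨ +-cong (trans (lhs-expansion x) (expand _ (p x) (w x) (λ y → sum λ z → p₂ x y z * W₃ x y z)))
             (-‿cong (expand _ (λ _ → a x) (w x) (λ y → p x y * W₂ x y))) ⟩
      V + sum row - (V + sum row′)
        ≈⟨ solve 3 (λ v l r → v :+ l :- (v :+ r) := l :- r) refl V (sum row) (sum row′) ⟩
      sum row - sum row′
        ≈⟨ sum-- _ _ ⟨
      sum (λ y → row y - row′ y)
        ≈⟨ sum-cong (λ y → begin
             row y - row′ y
               ≈⟨ solve 6 (λ u p w a g h → (u :+ u) :* (p :* w) :+ p :* g :- ((u :+ u) :* (a :* w) :+ a :* (p :* h))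
                    := (u :+ u) :* (w :* (p :- a)) :+ (p :* g :- a :* p :* h)) refl
                    u₀ (p x y) (w x y) (a x) (sum λ z → p₂ x y z * W₃ x y z) (W₂ x y) ⟩
             crossTerm x y + (p x y * sum (λ z → p₂ x y z * W₃ x y z) - a x * p x y * W₂ x y)
               ≈⟨ +-congˡ (+-congˡ (-‿cong (*-congˡ (W-suc α (x ∷ y ∷ []) m)))) ⟩
             crossTerm x y + (p x y * sum (λ z → p₂ x y z * W₃ x y z) - a x * p x y * sum (λ z → W₃ x y z))
               ≈⟨ +-congˡ (+-cong (sum-*ˡ (p x y) _) (-‿cong (sum-*ˡ (a x * p x y) _))) ⟨
             crossTerm x y + (sum (λ z → p x y * (p₂ x y z * W₃ x y z)) - sum (λ z → a x * p x y * W₃ x y z))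
               ≈⟨ +-congˡ (sum-- _ _) ⟨
             crossTerm x y + sum (λ z → p x y * (p₂ x y z * W₃ x y z) - a x * p x y * W₃ x y z)
               ≈⟨ +-congˡ (sum-cong λ z → solve 4 (λ p r w a → p :* (r :* w) :- a :* p :* w := w :* (p :* r :- a :* p))
                    refl (p x y) (p₂ x y z) (W₃ x y z) (a x)) ⟩
             crossTerm x y + sum (λ z → F x y z) ∎) ⟩
      sum (λ y → crossTerm x y + sum λ z → F x y z) ∎
      where
      V = u₀ * u₀ * W α (x ∷ []) m
      row row′ : Fin n → Carrier
      row y = (u₀ + u₀) * (p x y * w x y) + p x y * sum (λ z → p₂ x y z * W₃ x y z)
      row′ y = (u₀ + u₀) * (a x * w x y) + a x * (p x y * W₂ x y)

    difference : sum lhs - quadratic (A α (suc m)) u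
      ≈ sum (λ x → sum λ y → crossTerm x y) + sum (λ x → sum λ y → sum λ z → F x y z)
    difference = begin
      sum lhs - quadratic (A α (suc m)) u          ≈⟨ +-congˡ (-‿cong rhs-expansion) ⟩
      sum lhs - sum rhs                            ≈⟨ sum-- _ _ ⟨
      sum (λ x → lhs x - rhs x)                    ≈⟨ sum-cong (λ x → trans (row-difference x) (sum-+ _ _)) ⟩
      sum (λ x → sum (λ y → crossTerm x y) + sum (λ y → sum λ z → F x y z))  ≈⟨ sum-+ _ _ ⟩
      sum (λ x → sum λ y → crossTerm x y) + sum (λ x → sum λ y → sum λ z → F x y z) ∎

    -- For two continuing letters `p x y` is `a y` and the terms are opposite. If a letter does not
    -- continue α, one term has a dead weight, and in the other `p` returns the coordinate that is
    -- subtracted.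
    cross-cancels : ∀ x y → 0# ≤ crossTerm x y + crossTerm y x
    cross-cancels x y = ≤-reflexive (sym (by (ℒ? (α ++ x ∷ [])) (ℒ? (α ++ y ∷ []))))
      where
      by : (d : Dec (ℒ (α ++ x ∷ []))) (e : Dec (ℒ (α ++ y ∷ []))) → crossTerm x y + crossTerm y x ≈ 0#
      by (yes αx∈) (yes αy∈) = begin
        crossTerm x y + crossTerm y x
          ≈⟨ +-cong (*-congˡ (*-congˡ (+-congʳ (if-yes (ℒ? (α ++ y ∷ [])) αy∈))))
               (*-congˡ (*-cong (W-swap α∈ α<k [] m αy∈ αx∈) (+-congʳ (if-yes (ℒ? (α ++ x ∷ [])) αx∈)))) ⟩
        (u₀ + u₀) * (w x y * (a y - a x)) + (u₀ + u₀) * (w x y * (a x - a y))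
          ≈⟨ solve 4 (λ u w a b → (u :+ u) :* (w :* (b :- a)) :+ (u :+ u) :* (w :* (a :- b)) := con (+ 0))
               refl u₀ (w x y) (a x) (a y) ⟩
        0# ∎
      by (no αx∉) e = begin
        crossTerm x y + crossTerm y x
          ≈⟨ +-cong (*-congˡ (*-zero-left (dead₁ αx∉ (y ∷ []) m)))
               (*-congˡ (*-congˡ (+-congʳ (if-no (ℒ? (α ++ x ∷ [])) αx∉)))) ⟩
        (u₀ + u₀) * 0# + (u₀ + u₀) * (w y x * (a y - a y))
          ≈⟨ solve 3 (λ u w a → (u :+ u) :* con (+ 0) :+ (u :+ u) :* (w :* (a :- a)) := con (+ 0))
               refl u₀ (w y x) (a y) ⟩
        0# ∎
      by (yes _) (no αy∉) = begin
        crossTerm x y + crossTerm y x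
          ≈⟨ +-cong (*-congˡ (*-congˡ (+-congʳ (if-no (ℒ? (α ++ y ∷ [])) αy∉))))
               (*-congˡ (*-zero-left (dead₁ αy∉ (x ∷ []) m))) ⟩
        (u₀ + u₀) * (w x y * (a x - a x)) + (u₀ + u₀) * 0#
          ≈⟨ solve 3 (λ u w a → (u :+ u) :* (w :* (a :- a)) :+ (u :+ u) :* con (+ 0) := con (+ 0))
               refl u₀ (w x y) (a x) ⟩
        0# ∎

    -- The cases in which `F` need not vanish: y and z continue α; only z does; only y does and αxz
    -- is not in ℒ. In the other cases the two products agree, or the interval property makes the
    -- weight 0.
    Fᵃ Fᵇ Fᶜ : Fin n → Fin n → Fin n → Carrier
    Fᵃ x y z = if extends α y then (if extends α z then W₃ x y z * (a y * a z - a x * a y) else 0#) else 0#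
    Fᵇ x y z = if extends α y then 0# else (if extends α z then W₃ x y z * (a x * (a z - a x)) else 0#)
    Fᶜ x y z = if extends α y then (if extends α z then 0# else
      (if does (ℒ? (α ++ x ∷ z ∷ [])) then 0# else W₃ x y z * (a y * (a y - a x)))) else 0#

    F-split : ∀ x y z → F x y z ≈ Fᵃ x y z + (Fᵇ x y z + Fᶜ x y z)
    F-split x y z = by (ℒ? (α ++ y ∷ [])) (ℒ? (α ++ z ∷ [])) (ℒ? (α ++ x ∷ z ∷ []))
      where
      t = W₃ x y z
      by : (d : Dec (ℒ (α ++ y ∷ []))) (e : Dec (ℒ (α ++ z ∷ []))) (f : Dec (ℒ (α ++ x ∷ z ∷ []))) →
        let pxy = if does d then a y else a x
            pxz = if does e then a z else a x
        in t * (pxy * (if does f then pxz else pxy) - a x * pxy)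
           ≈ (if does d then (if does e then t * (a y * a z - a x * a y) else 0#) else 0#)
           + ((if does d then 0# else (if does e then t * (a x * (a z - a x)) else 0#))
           + (if does d then (if does e then 0# else (if does f then 0# else t * (a y * (a y - a x)))) else 0#))
      by (yes _) (yes _) (yes _) = solve 4 (λ t a b c → t :* (b :* c :- a :* b)
        := t :* (b :* c :- a :* b) :+ (con (+ 0) :+ con (+ 0))) refl t (a x) (a y) (a z)
      by (no _) (yes _) (yes _) = solve 3 (λ t a c → t :* (a :* c :- a :* a)
        := con (+ 0) :+ (t :* (a :* (c :- a)) :+ con (+ 0))) refl t (a x) (a z)
      by d (yes αz∈) (no αxz∉) = trans (*-zero-left t≈0) (sym (trans (+-cong (zeroᵃ d) (+-cong (zeroᵇ d) (if-zero (does d) refl refl)))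
        (solve 0 (con (+ 0) :+ (con (+ 0) :+ con (+ 0)) := con (+ 0)) refl)))
        where
        t≈0 : t ≈ 0#
        t≈0 = W-dead α _ m λ p → αxz∉ (interval α (x ∷ []) (y ∷ []) z αz∈ p)
        zeroᵃ : ∀ (d : Dec (ℒ (α ++ y ∷ []))) → (if does d then t * (a y * a z - a x * a y) else 0#) ≈ 0#
        zeroᵃ d = if-zero (does d) (*-zero-left t≈0) refl
        zeroᵇ : ∀ (d : Dec (ℒ (α ++ y ∷ []))) → (if does d then 0# else t * (a x * (a z - a x))) ≈ 0#
        zeroᵇ d = if-zero (does d) refl (*-zero-left t≈0)
      by (yes _) (no _) (yes _) = solve 3 (λ t a b → t :* (b :* a :- a :* b)
        := con (+ 0) :+ (con (+ 0) :+ con (+ 0))) refl t (a x) (a y)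
      by (yes _) (no _) (no _) = solve 3 (λ t a b → t :* (b :* b :- a :* b)
        := con (+ 0) :+ (con (+ 0) :+ t :* (b :* (b :- a)))) refl t (a x) (a y)
      by (no _) (no _) (yes _) = solve 2 (λ t a → t :* (a :* a :- a :* a)
        := con (+ 0) :+ (con (+ 0) :+ con (+ 0))) refl t (a x)
      by (no _) (no _) (no _) = solve 2 (λ t a → t :* (a :* a :- a :* a)
        := con (+ 0) :+ (con (+ 0) :+ con (+ 0))) refl t (a x)

    Fᵃ-cancels : ∀ x y z → Fᵃ x y z + Fᵃ z y x ≈ 0#
    Fᵃ-cancels x y z = by (ℒ? (α ++ x ∷ [])) (ℒ? (α ++ y ∷ [])) (ℒ? (α ++ z ∷ []))
      where
      by : (d : Dec (ℒ (α ++ x ∷ []))) (e : Dec (ℒ (α ++ y ∷ []))) (f : Dec (ℒ (α ++ z ∷ []))) →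
        (if does e then (if does f then W₃ x y z * (a y * a z - a x * a y) else 0#) else 0#)
        + (if does e then (if does d then W₃ z y x * (a y * a x - a z * a y) else 0#) else 0#) ≈ 0#
      by d         (no _)    f         = +-identityʳ 0#
      by (yes αx∈) (yes αy∈) (yes αz∈) = trans (+-congʳ (*-congʳ (reverse αx∈ αy∈ αz∈)))
        (solve 4 (λ t a b c → t :* (b :* c :- a :* b) :+ t :* (b :* a :- c :* b) := con (+ 0))
          refl (W₃ z y x) (a x) (a y) (a z))
      by (no αx∉)  (yes _)   f         = trans (+-identityʳ _)
        (if-zero (does f) (*-zero-left (dead₁ αx∉ _ m)) refl)
      by (yes _)   (yes _)   (no αz∉)  = trans (+-identityˡ _) (*-zero-left (dead₁ αz∉ _ m))

    -- Here z is the letter that does not continue α: the middle one in `Fᵇ`, the last one in `Fᶜ`.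
    -- The swap in `Fᵇ` brings all words on the same x, y, z into the pair `G x y`, `G y x`.
    G : Fin n → Fin n → Carrier
    G x y = sum λ z → Fᵇ x z y + Fᶜ x y z

    G-dead : ∀ x y → ¬ ℒ (α ++ x ∷ []) → G x y ≈ 0#
    G-dead x y αx∉ = sum-zero λ z → trans (+-cong
      (if-zero (extends α z) refl (if-zero (extends α y) (*-zero-left (dead₁ αx∉ _ m)) refl))
      (if-zero (extends α y) (if-zero (extends α z) refl
        (if-zero (does (ℒ? (α ++ x ∷ z ∷ []))) refl (*-zero-left (dead₁ αx∉ _ m)))) refl)) (+-identityʳ 0#)

    G-dead′ : ∀ x y → ¬ ℒ (α ++ y ∷ []) → G x y ≈ 0#
    G-dead′ x y αy∉ = sum-zero λ z → trans (+-cong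
      (if-zero (extends α z) refl (if-no (ℒ? (α ++ y ∷ [])) αy∉))
      (if-no (ℒ? (α ++ y ∷ [])) αy∉)) (+-identityʳ 0#)

    passive active : Fin n → Fin n → Fin n → Carrier
    passive x y z = if does (¬? (ℒ? (α ++ z ∷ [])) ×-dec ¬? (ℒ? (α ++ x ∷ z ∷ []))
      ×-dec ¬? (ℒ? (α ++ y ∷ z ∷ [])) ×-dec ℒ? (α ++ x ∷ y ∷ z ∷ [])) then W₃ x y z else 0#
    active x y z = if does (¬? (ℒ? (α ++ z ∷ [])) ×-dec ℒ? (α ++ x ∷ z ∷ [])
      ×-dec ℒ? (α ++ y ∷ z ∷ []) ×-dec ℒ? (α ++ x ∷ y ∷ z ∷ [])) then W₃ x y z else 0#

    paMon-W : ∀ x y → ℒ (α ++ x ∷ []) → ℒ (α ++ y ∷ []) → x ≢ y → sum (active x y) ≤ sum (passive x y)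
    paMon-W x y αx∈ αy∈ x≢y = ≤-resp
      (trans (∑-filter-allFin _ _) (sum-cong λ z → cong-if (does (¬? (ℒ? (α ++ z ∷ [])) ×-dec ℒ? (α ++ x ∷ z ∷ [])
      ×-dec ℒ? (α ++ y ∷ z ∷ []) ×-dec ℒ? (α ++ x ∷ y ∷ z ∷ []))) (inner z)))
      (trans (∑-filter-allFin _ _) (sum-cong λ z → cong-if (does (¬? (ℒ? (α ++ z ∷ [])) ×-dec ¬? (ℒ? (α ++ x ∷ z ∷ []))
      ×-dec ¬? (ℒ? (α ++ y ∷ z ∷ [])) ×-dec ℒ? (α ++ x ∷ y ∷ z ∷ []))) (inner z)))
      (paMon α∈ α<k x y m (∈Cont αx∈) (∈Cont αy∈) x≢y)
      where
      cong-if : ∀ b {s t : Carrier} → s ≈ t → (if b then s else 0#) ≈ (if b then t else 0#)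
      cong-if true  p = p
      cong-if false p = refl
      inner : ∀ z → ∑ (Cont[ m ] (α ++ x ∷ y ∷ z ∷ [])) (λ β → q (α ++ x ∷ y ∷ z ∷ β)) ≈ W₃ x y z
      inner z = ∑-filter-support (λ β → ℒ? ((α ++ x ∷ y ∷ z ∷ []) ++ β)) (words m)
        λ {β} αxyzβ∉ → q-zero λ p → αxyzβ∉ (≡.subst ℒ (≡.sym (++-assoc α (x ∷ y ∷ z ∷ []) β)) p)

    -- For z not continuing α, all surviving orders of the three letters have the weight of xyz. The
    -- coefficients add up to -(a x - a y)² if αxz and αyz are both in ℒ (active), to (a x - a y)²
    -- if neither is (passive), and to 0 if exactly one is.
    G-symmetrised : ∀ x y → ℒ (α ++ x ∷ []) → ℒ (α ++ y ∷ []) →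
      G x y + G y x ≈ (a x - a y) * (a x - a y) * (sum (passive x y) - sum (active x y))
    G-symmetrised x y αx∈ αy∈ = begin
      G x y + G y x
        ≈⟨ sum-+ _ _ ⟨
      sum (λ z → Fᵇ x z y + Fᶜ x y z + (Fᵇ y z x + Fᶜ y x z))
        ≈⟨ sum-cong (λ z → by z (ℒ? (α ++ x ∷ [])) (ℒ? (α ++ y ∷ [])) (ℒ? (α ++ z ∷ []))
             (ℒ? (α ++ x ∷ z ∷ [])) (ℒ? (α ++ y ∷ z ∷ [])) (ℒ? (α ++ x ∷ y ∷ z ∷ []))) ⟩
      sum (λ z → (a x - a y) * (a x - a y) * (passive x y z - active x y z))
        ≈⟨ trans (sum-*ˡ ((a x - a y) * (a x - a y)) _) (*-congˡ (sum-- _ _)) ⟩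
      (a x - a y) * (a x - a y) * (sum (passive x y) - sum (active x y)) ∎
      where
      by : ∀ z (d : Dec (ℒ (α ++ x ∷ []))) (e : Dec (ℒ (α ++ y ∷ []))) (f : Dec (ℒ (α ++ z ∷ [])))
        (g : Dec (ℒ (α ++ x ∷ z ∷ []))) (h : Dec (ℒ (α ++ y ∷ z ∷ []))) (i : Dec (ℒ (α ++ x ∷ y ∷ z ∷ []))) →
        (if does f then 0# else (if does e then W₃ x z y * (a x * (a y - a x)) else 0#))
        + (if does e then (if does f then 0# else
            (if does g then 0# else W₃ x y z * (a y * (a y - a x)))) else 0#)
        + ((if does f then 0# else (if does d then W₃ y z x * (a y * (a x - a y)) else 0#))
        + (if does d then (if does f then 0# else
            (if does h then 0# else W₃ y x z * (a x * (a x - a y)))) else 0#))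
        ≈ (a x - a y) * (a x - a y) *
          ((if does (¬? f ×-dec ¬? g ×-dec ¬? h ×-dec i) then W₃ x y z else 0#)
          - (if does (¬? f ×-dec g ×-dec h ×-dec i) then W₃ x y z else 0#))
      by z (no αx∉) e        f       g h i = contradiction αx∈ αx∉
      by z (yes _)  (no αy∉) f       g h i = contradiction αy∈ αy∉
      by z (yes _)  (yes _)  (yes _) g h i = solve 2 (λ a b → con (+ 0) :+ con (+ 0) :+ (con (+ 0) :+ con (+ 0))
        := (a :- b) :* (a :- b) :* (con (+ 0) :- con (+ 0))) refl (a x) (a y)
      by z (yes _)  (yes _)  (no _)  (yes αxz∈) (yes αyz∈) i = begin
        W₃ x z y * (a x * (a y - a x)) + 0# + (W₃ y z x * (a y * (a x - a y)) + 0#)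
          ≈⟨ +-cong (+-congʳ (*-congʳ (sym (swap₂₃ αy∈ αxz∈))))
               (+-congʳ (*-congʳ (trans (sym (swap₂₃ αx∈ αyz∈)) (swap₁₂ αy∈ αx∈ z)))) ⟩
        W₃ x y z * (a x * (a y - a x)) + 0# + (W₃ x y z * (a y * (a x - a y)) + 0#)
          ≈⟨ solve 3 (λ t a b → t :* (a :* (b :- a)) :+ con (+ 0) :+ (t :* (b :* (a :- b)) :+ con (+ 0))
               := (a :- b) :* (a :- b) :* (con (+ 0) :- t)) refl (W₃ x y z) (a x) (a y) ⟩
        (a x - a y) * (a x - a y) * (0# - W₃ x y z)
          ≈⟨ *-congˡ (+-congˡ (-‿cong (only i))) ⟨
        (a x - a y) * (a x - a y) * (0# - (if does i then W₃ x y z else 0#)) ∎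
        where
        only : ∀ (i : Dec (ℒ (α ++ x ∷ y ∷ z ∷ []))) → (if does i then W₃ x y z else 0#) ≈ W₃ x y z
        only (yes _)   = refl
        only (no ∉)    = sym (W-dead α _ m ∉)
      by z (yes _)  (yes _)  (no _)  (yes αxz∈) (no αyz∉) i = begin
        W₃ x z y * (a x * (a y - a x)) + 0# + (W₃ y z x * (a y * (a x - a y)) + W₃ y x z * (a x * (a x - a y)))
          ≈⟨ +-cong (+-congʳ (*-congʳ (sym (swap₂₃ αy∈ αxz∈))))
               (+-cong (*-congʳ (dead₂ αyz∉ _ m)) (*-congʳ (swap₁₂ αy∈ αx∈ z))) ⟩
        W₃ x y z * (a x * (a y - a x)) + 0# + (0# * (a y * (a x - a y)) + W₃ x y z * (a x * (a x - a y)))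
          ≈⟨ solve 3 (λ t a b → t :* (a :* (b :- a)) :+ con (+ 0) :+ (con (+ 0) :* (b :* (a :- b)) :+ t :* (a :* (a :- b)))
               := (a :- b) :* (a :- b) :* (con (+ 0) :- con (+ 0))) refl (W₃ x y z) (a x) (a y) ⟩
        (a x - a y) * (a x - a y) * (0# - 0#) ∎
      by z (yes _)  (yes _)  (no _)  (no αxz∉) (yes αyz∈) i = begin
        W₃ x z y * (a x * (a y - a x)) + W₃ x y z * (a y * (a y - a x)) + (W₃ y z x * (a y * (a x - a y)) + 0#)
          ≈⟨ +-cong (+-congʳ (*-congʳ (dead₂ αxz∉ _ m)))
               (+-congʳ (*-congʳ (trans (sym (swap₂₃ αx∈ αyz∈)) (swap₁₂ αy∈ αx∈ z)))) ⟩
        0# * (a x * (a y - a x)) + W₃ x y z * (a y * (a y - a x)) + (W₃ x y z * (a y * (a x - a y)) + 0#)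
          ≈⟨ solve 3 (λ t a b → con (+ 0) :* (a :* (b :- a)) :+ t :* (b :* (b :- a)) :+ (t :* (b :* (a :- b)) :+ con (+ 0))
               := (a :- b) :* (a :- b) :* (con (+ 0) :- con (+ 0))) refl (W₃ x y z) (a x) (a y) ⟩
        (a x - a y) * (a x - a y) * (0# - 0#) ∎
      by z (yes _)  (yes _)  (no _)  (no αxz∉) (no αyz∉) i = begin
        W₃ x z y * (a x * (a y - a x)) + W₃ x y z * (a y * (a y - a x))
          + (W₃ y z x * (a y * (a x - a y)) + W₃ y x z * (a x * (a x - a y)))
          ≈⟨ +-cong (+-congʳ (*-congʳ (dead₂ αxz∉ _ m)))
               (+-cong (*-congʳ (dead₂ αyz∉ _ m)) (*-congʳ (swap₁₂ αy∈ αx∈ z))) ⟩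
        0# * (a x * (a y - a x)) + W₃ x y z * (a y * (a y - a x))
          + (0# * (a y * (a x - a y)) + W₃ x y z * (a x * (a x - a y)))
          ≈⟨ solve 3 (λ t a b → con (+ 0) :* (a :* (b :- a)) :+ t :* (b :* (b :- a))
                :+ (con (+ 0) :* (b :* (a :- b)) :+ t :* (a :* (a :- b)))
               := (a :- b) :* (a :- b) :* (t :- con (+ 0))) refl (W₃ x y z) (a x) (a y) ⟩
        (a x - a y) * (a x - a y) * (W₃ x y z - 0#)
          ≈⟨ *-congˡ (+-congʳ (only i)) ⟨
        (a x - a y) * (a x - a y) * ((if does i then W₃ x y z else 0#) - 0#) ∎
        where
        only : ∀ (i : Dec (ℒ (α ++ x ∷ y ∷ z ∷ []))) → (if does i then W₃ x y z else 0#) ≈ W₃ x y z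
        only (yes _)   = refl
        only (no ∉)    = sym (W-dead α _ m ∉)

    G-symmetrised-nonneg : ∀ x y → 0# ≤ G x y + G y x
    G-symmetrised-nonneg x y = by (ℒ? (α ++ x ∷ [])) (ℒ? (α ++ y ∷ [])) (x Fin.≟ y)
      where
      by : Dec (ℒ (α ++ x ∷ [])) → Dec (ℒ (α ++ y ∷ [])) → Dec (x ≡ y) → 0# ≤ G x y + G y x
      by (no αx∉) _ _ = ≤-reflexive (sym (trans (+-cong (G-dead x y αx∉) (G-dead′ y x αx∉)) (+-identityʳ 0#)))
      by (yes _) (no αy∉) _ = ≤-reflexive (sym (trans (+-cong (G-dead′ x y αy∉) (G-dead y x αy∉)) (+-identityʳ 0#)))
      -- `PAMon` compares distinct letters; on the diagonal the square is 0.
      by (yes αx∈) (yes αy∈) (yes ≡.refl) = ≤-reflexive (sym (trans (G-symmetrised x x αx∈ αy∈)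
        (*-zero-left (solve 1 (λ a → (a :- a) :* (a :- a) := con (+ 0)) refl (a x)))))
      by (yes αx∈) (yes αy∈) (no x≢y) = 0≤-resp (sym (G-symmetrised x y αx∈ αy∈))
        (*-nonneg (square-nonneg (a x - a y)) (≤⇒0≤- (paMon-W x y αx∈ αy∈ x≢y)))

    F-nonneg : 0# ≤ sum (λ x → sum λ y → sum λ z → F x y z)
    F-nonneg = 0≤-resp (sym (begin
      sum (λ x → sum λ y → sum λ z → F x y z)
        ≈⟨ sum-cong (λ x → trans (sum-cong λ y → trans (sum-cong λ z → F-split x y z) (sum-+ _ _)) (sum-+ _ _)) ⟩
      sum (λ x → sum (λ y → sum λ z → Fᵃ x y z) + sum (λ y → sum λ z → Fᵇ x y z + Fᶜ x y z))
        ≈⟨ sum-+ _ _ ⟩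
      sum (λ x → sum (λ y → sum λ z → Fᵃ x y z)) + sum (λ x → sum (λ y → sum λ z → Fᵇ x y z + Fᶜ x y z))
        ≈⟨ +-cong (sum-cong λ x → sum-comm _) (sum-cong regroup) ⟩
      sum (λ x → sum (λ z → sum λ y → Fᵃ x y z)) + sum (λ x → sum λ y → G x y) ∎))
      (+-nonneg
        (sum-symmetrised-nonneg (λ x z → sum λ y → Fᵃ x y z) λ x z → ≤-reflexive (sym
          (trans (sym (sum-+ _ _)) (sum-zero λ y → Fᵃ-cancels x y z))))
        (sum-symmetrised-nonneg G G-symmetrised-nonneg))
      where
      regroup : ∀ x → sum (λ y → sum λ z → Fᵇ x y z + Fᶜ x y z) ≈ sum (λ y → G x y)
      regroup x = begin
        sum (λ y → sum λ z → Fᵇ x y z + Fᶜ x y z)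
          ≈⟨ trans (sum-cong λ y → sum-+ _ _) (sum-+ _ _) ⟩
        sum (λ y → sum λ z → Fᵇ x y z) + sum (λ y → sum λ z → Fᶜ x y z)
          ≈⟨ +-congʳ (sum-comm _) ⟩
        sum (λ y → sum λ z → Fᵇ x z y) + sum (λ y → sum λ z → Fᶜ x y z)
          ≈⟨ trans (sum-cong λ y → sum-+ _ _) (sum-+ _ _) ⟨
        sum (λ y → G x y) ∎

    pullback : quadratic (A α (suc m)) u ≤ sum lhs
    pullback = 0≤-⇒≤ (0≤-resp (sym difference)
      (+-nonneg (sum-symmetrised-nonneg crossTerm cross-cancels) F-nonneg))

  -- The local-to-global principle applied to the pencil at α.

  module Step {α} (α∈ : ℒ α) (m : ℕ) (<k : length α ℕ.+ suc m ℕ.< k)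
    {rank : ℕ} (hasRank : HasRank 𝒢 rank) (k<rank : k ℕ.< rank) (e : Carrier) (0<e : 0# < e)
    (hyp-null : Hyperbolic (A α m))
    (hyp-letter : ∀ x → ℒ (α ++ x ∷ []) → Hyperbolic (A (α ++ x ∷ []) m)) where

    1+α+m<k : suc (length α ℕ.+ m) ℕ.< k
    1+α+m<k = ≡.subst (ℕ._< k) (ℕ.+-suc (length α) m) <k

    1+α<k : suc (length α) ℕ.< k
    1+α<k = ℕ.≤-<-trans (ℕ.s≤s (ℕ.m≤m+n (length α) m)) 1+α+m<k

    P : Matrix (suc n)
    P i j = H e i * H e j * pencil α m e i j

    scaled : Vector (suc n) → Vector (suc n)
    scaled v i = H e i * v i

    H-nonneg : ∀ i → 0# ≤ H e i
    H-nonneg zero    = <⇒≤ 0<1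
    H-nonneg (suc x) = <⇒≤ 0<e

    pencil-sym : ∀ i j → pencil α m e i j ≈ pencil α m e j i
    pencil-sym i j = +-cong (*-congˡ (A-sym α∈ α<k (suc m) i j)) (A-sym α∈ α<k m i j)
      where
      α<k = ℕ.<-trans (ℕ.n<1+n _) 1+α<k

    P-sym : ∀ i j → P i j ≈ P j i
    P-sym i j = *-cong (*-comm _ _) (pencil-sym i j)

    pencil-nonneg : ∀ i j → 0# ≤ pencil α m e i j
    pencil-nonneg i j = +-nonneg (*-nonneg (<⇒≤ 0<e) (A-nonneg α (suc m) i j)) (A-nonneg α m i j)

    P-nonneg : ∀ i j → 0# ≤ P i j
    P-nonneg i j = *-nonneg (*-nonneg (H-nonneg i) (H-nonneg j)) (pencil-nonneg i j)

    P₀₀-pos : 0# < P zero zero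
    P₀₀-pos = *-pos (*-pos 0<1 0<1) (+-nonneg-pos (*-nonneg (<⇒≤ 0<e) (W-nonneg α [] (suc m)))
      (W-pos hasRank α [] m (≡.subst ℒ (≡.sym (++-identityʳ α)) α∈)
        (≡.subst (λ α → length α ℕ.+ m ℕ.≤ rank) (≡.sym (++-identityʳ α))
          (ℕ.<⇒≤ (ℕ.<-trans (ℕ.<-trans (ℕ.n<1+n _) 1+α+m<k) k<rank)))))

    -- Strictness comes from the summand A(α, m): as 1 + |α| + m < k < rank, the word αx has
    -- continuations of length m.
    P₀-pos : ∀ {x} → ℒ (α ++ x ∷ []) → 0# < P zero (suc x)
    P₀-pos {x} αx∈ = *-pos (*-pos 0<1 0<e) (+-nonneg-pos (*-nonneg (<⇒≤ 0<e) (W-nonneg α (x ∷ []) (suc m)))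
      (W-pos hasRank α (x ∷ []) m αx∈
        (≡.subst (λ l → l ℕ.+ m ℕ.≤ rank) (≡.sym (≡.trans (length-++ α) (ℕ.+-comm (length α) 1)))
          (ℕ.<⇒≤ (ℕ.<-trans 1+α+m<k k<rank)))))

    P-dead : ∀ {x} → ¬ ℒ (α ++ x ∷ []) → ∀ j → P (suc x) j ≈ 0#
    P-dead {x} αx∉ j = trans (*-congˡ (trans
      (+-cong (trans (*-congˡ (A-letter-dead α (suc m) x αx∉ j)) (zeroʳ e)) (A-letter-dead α m x αx∉ j))
      (+-identityʳ 0#))) (zeroʳ _)

    adjacent : ∀ i → 0# < P zero i ⊎ (∀ j → P i j ≈ 0#)
    adjacent zero    = inj₁ P₀₀-pos
    adjacent (suc x) = by (ℒ? (α ++ x ∷ []))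
      where
      by : Dec (ℒ (α ++ x ∷ [])) → 0# < P zero (suc x) ⊎ (∀ j → P (suc x) j ≈ 0#)
      by (yes αx∈) = inj₁ (P₀-pos αx∈)
      by (no αx∉)  = inj₂ (P-dead αx∉)

    apply-P : ∀ v i → apply P v i ≈ H e i * apply (pencil α m e) (scaled v) i
    apply-P v i = trans
      (sum-cong λ j → solve 4 (λ h k p v → h :* k :* p :* v := h :* (p :* (k :* v))) refl
        (H e i) (H e j) (pencil α m e i j) (v j))
      (sum-*ˡ (H e i) _)

    degree-P : ∀ i → sum (P i) ≈ H e i * apply (pencil α m e) (H e) i
    degree-P i = trans
      (sum-cong λ j → solve 3 (λ h k p → h :* k :* p := h :* (p :* k)) refl
        (H e i) (H e j) (pencil α m e i j))
      (sum-*ˡ (H e i) _)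

    r : Vector (suc n) → Vector (suc n)
    r v zero    = H e zero * quadratic (A α m) (scaled v)
    r v (suc x) = H e (suc x) * quadratic (A (α ++ x ∷ []) m) (T α x (scaled v))

    r-outside : ∀ v i → (∀ j → P i j ≈ 0#) → r v i ≤ 0#
    r-outside v zero    P₀≈0 = contradiction P₀₀-pos (≤-reflexive (P₀≈0 zero))
    r-outside v (suc x) Pₓ≈0 = by (ℒ? (α ++ x ∷ []))
      where
      by : Dec (ℒ (α ++ x ∷ [])) → r v (suc x) ≤ 0#
      by (yes αx∈) = contradiction (0<-resp (P-sym zero (suc x)) (P₀-pos αx∈)) (≤-reflexive (Pₓ≈0 zero))
      by (no αx∉)  = ≤-reflexive (trans (*-congˡ (sum-zero λ i → trans (*-congˡ
        (sum-zero λ j → trans (*-congʳ (A-dead _ m αx∉ i j)) (zeroˡ _))) (zeroʳ _))) (zeroʳ _))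

    quadratic-H-nonneg : ∀ β → 0# ≤ quadratic (A β m) (H e)
    quadratic-H-nonneg β = sum-nonneg λ i → *-nonneg (H-nonneg i)
      (sum-nonneg λ j → *-nonneg (A-nonneg β m i j) (H-nonneg j))

    cauchy : ∀ {M : Matrix (suc n)} → Hyperbolic M → 0# ≤ quadratic M (H e) → ∀ h u →
      (h * quadratic M u) * (h * quadratic M (H e)) ≤ (h * bilinear M u (H e)) * (h * bilinear M u (H e))
    cauchy {M} hyp 0≤QH h u = ≤-by
      (*-nonneg (square-nonneg h) (≤⇒0≤- (hyp u (H e) 0≤QH)))
      (solve 4 (λ h a b c → (h :* c) :* (h :* c) :- (h :* a) :* (h :* b) := h :* h :* (c :* c :- a :* b)) refl
        h (quadratic M u) (quadratic M (H e)) (bilinear M u (H e)))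

    -- By inheritance the row value at v is `H e i` times a bilinear value of the neighbour against
    -- `H e`. The row sum is `H e i` times its quadratic value at `H e`, since `T` fixes `H e`. What
    -- remains is hyperbolicity of the neighbour.
    r-cauchy : ∀ v i → 0# < P zero i → r v i * sum (P i) ≤ apply P v i * apply P v i
    r-cauchy v zero _ = ≤-resp
      (*-congˡ (sym (trans (degree-P zero) (*-congˡ (inheritance-null α m e (H e))))))
      (*-cong eq eq)
      (cauchy hyp-null (quadratic-H-nonneg α) 1# (scaled v))
      where
      eq = sym (trans (apply-P v zero) (*-congˡ (inheritance-null α m e (scaled v))))
    r-cauchy v (suc x) 0<P = by (ℒ? (α ++ x ∷ []))
      where
      eq = sym (trans (apply-P v (suc x)) (*-congˡ (inheritance-letter α m e (scaled v) x)))
      by : Dec (ℒ (α ++ x ∷ [])) → r v (suc x) * sum (P (suc x)) ≤ apply P v (suc x) * apply P v (suc x)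
      by (no αx∉)  = contradiction (0<-resp (P-sym zero (suc x)) 0<P) (≤-reflexive (P-dead αx∉ zero))
      by (yes αx∈) = ≤-resp
        (*-congˡ (sym (trans (degree-P (suc x)) (*-congˡ (trans (inheritance-letter α m e (H e) x)
          (bilinear-cong (A (α ++ x ∷ []) m) (T-H α e x) (λ _ → refl)))))))
        (*-cong eq eq)
        (cauchy (hyp-letter x αx∈) (quadratic-H-nonneg (α ++ x ∷ [])) e (T α x (scaled v)))

    -- The neighbour of null is A(α, m) itself and contributes exactly that summand of the pencil;
    -- the rest is e times `pullback`.
    r-pullback : ∀ v → quadratic P v ≤ sum (r v)
    r-pullback v = ≤-resp (sym (begin
        quadratic P v
          ≈⟨ sum-cong (λ i → trans (*-congˡ (apply-P v i))
               (solve 3 (λ v h a → v :* (h :* a) := h :* v :* a) refl (v i) (H e i) (apply (pencil α m e) (scaled v) i))) ⟩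
        quadratic (pencil α m e) (scaled v)
          ≈⟨ bilinear-pencil e (A α (suc m)) (A α m) (scaled v) (scaled v) ⟩
        e * quadratic (A α (suc m)) (scaled v) + quadratic (A α m) (scaled v) ∎))
      (sym (begin
        sum (r v)
          ≈⟨ sum-suc (r v) ⟩
        1# * quadratic (A α m) (scaled v) + sum (λ x → e * lhs x)
          ≈⟨ trans (+-cong (*-identityˡ _) (sum-*ˡ e lhs)) (+-comm _ _) ⟩
        e * sum lhs + quadratic (A α m) (scaled v) ∎))
      (≤-by (*-nonneg (<⇒≤ 0<e) (≤⇒0≤- pullback))
        (solve 4 (λ e a b c → e :* a :+ c :- (e :* b :+ c) := e :* (a :- b)) refl
          e (sum lhs) (quadratic (A α (suc m)) (scaled v)) (quadratic (A α m) (scaled v))))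
      where
      open Pullback α∈ m 1+α<k (scaled v)

    H⁻¹ : Vector (suc n)
    H⁻¹ zero    = 1#
    H⁻¹ (suc x) = recip e (<⇒# 0<e)

    H⁻¹H≈1 : ∀ i → H⁻¹ i * H e i ≈ 1#
    H⁻¹H≈1 zero    = *-identityˡ 1#
    H⁻¹H≈1 (suc x) = trans (*-comm _ _) (recip-inverse e _)

    pencil-hyperbolic : Hyperbolic (pencil α m e)
    pencil-hyperbolic = hyperbolic-congruence (H e) H⁻¹ H⁻¹H≈1
      (lorentzian⇒hyperbolic P-sym _ (LocalToGlobal.lorentzian P P-sym P-nonneg P₀₀-pos adjacent
        r r-outside r-cauchy r-pullback))

  hyperbolic-step : ∀ {rank} → HasRank 𝒢 rank → k ℕ.< rank →
    ∀ {α} → ℒ α → ∀ m → length α ℕ.+ suc m ℕ.< k →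
    Hyperbolic (A α m) → (∀ x → ℒ (α ++ x ∷ []) → Hyperbolic (A (α ++ x ∷ []) m)) →
    Hyperbolic (A α (suc m))
  hyperbolic-step hasRank k<rank {α} α∈ m <k hyp-null hyp-letter = hyperbolic-limit (A α m) λ e 0<e →
    Step.pencil-hyperbolic α∈ m <k hasRank k<rank e 0<e hyp-null hyp-letter

  -- The neighbours of (α, m + 1) are (α, m) and the (αx, m). Both inherit the bound on |α| + m,
  -- which keeps every base case within the range of admissibility.
  hyperbolic-induction : ∀ {rank} → HasRank 𝒢 rank → k ℕ.< rank →
    (∀ {α} → ℒ α → length α ℕ.< k → Hyperbolic (A α 0)) →
    ∀ m {α} → ℒ α → length α ℕ.+ m ℕ.< k → Hyperbolic (A α m)
  hyperbolic-induction hasRank k<rank base zero    {α} α∈ <k =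
    base α∈ (≡.subst (ℕ._< k) (ℕ.+-identityʳ (length α)) <k)
  hyperbolic-induction hasRank k<rank base (suc m) {α} α∈ <k =
    hyperbolic-step hasRank k<rank α∈ m <k
      (hyperbolic-induction hasRank k<rank base m α∈ (ℕ.<-trans (ℕ.+-monoʳ-< (length α) (ℕ.n<1+n m)) <k))
      λ x αx∈ → hyperbolic-induction hasRank k<rank base m αx∈ (≡.subst (ℕ._< k) (eq x) <k)
    where
    eq : ∀ x → length α ℕ.+ suc m ≡ length (α ++ x ∷ []) ℕ.+ m
    eq x = ≡.trans (≡.sym (ℕ.+-assoc (length α) 1 m)) (≡.cong (ℕ._+ m) (≡.sym (length-++ α)))

-- The case m = 0: the form in terms of the classes of Par(α).

module BaseCase {c ℓ₁ ℓ₂ n ℓ} (ℛ : Reals c ℓ₁ ℓ₂) (𝒢 : Greedoid n ℓ)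
  (weight : Weighted.Weight ℛ 𝒢) (scale : Weighted.Scale ℛ 𝒢)
  {α : Word n} (α∈ : Greedoid.ℒ 𝒢 α)
  (contInv : Weighted.Conditions.ContInv ℛ 𝒢 weight scale α)
  (logMod : Weighted.Conditions.LogMod ℛ 𝒢 weight scale α)
  (fewDes : Weighted.Conditions.FewDes ℛ 𝒢 weight scale α)
  (synMon : Weighted.Conditions.SynMon ℛ 𝒢 weight scale α)
  (scaleMon : Weighted.Conditions.ScaleMon ℛ 𝒢 weight scale α)
  where
  open OrderedField ℛ
  open LinearAlgebra ℛ
  open Hyperbolicity ℛ
  open ListSums ℛ
  open Greedoid 𝒢
  open Weighted.Weight weight
  open Weighted.Scale scale
  open Weighted.Conditions ℛ 𝒢 weight scale using (ω; b)
  open Continuations ℛ 𝒢 weight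
  open import Relation.Binary.Reasoning.Setoid setoid

  ∼-refl : ∀ x → x ∼[ α ] x
  ∼-refl x αxx∈ = unique-disjoint (α ++ x ∷ [])
    (≡.subst Unique (≡.sym (++-assoc α (x ∷ []) (x ∷ []))) (simple αxx∈))
    (∈-++⁺ʳ α (here ≡.refl)) (here ≡.refl)

  ∼-sym : ∀ {x y} → x ∈ Cont α → y ∈ Cont α → x ∼[ α ] y → y ∼[ α ] x
  ∼-sym {x} {y} x∈ y∈ αxy∉ αyx∈ = <-irrefl refl
    (<-resp refl (trans (contInv y x [] y∈ x∈) (q-zero αxy∉)) (q-pos αyx∈))

  -- Exchanging αxz against αy would give a letter t of αxz with αyt in ℒ. Simplicity rules out the
  -- letters of α, and t = x or t = z contradicts one of the two relations.
  ∼-trans : ∀ {x y z} → x ∈ Cont α → y ∈ Cont α → x ∼[ α ] y → y ∼[ α ] z → x ∼[ α ] z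
  ∼-trans {x} {y} {z} x∈ y∈ x∼y y∼z αxz∈ with exchange αxz∈ (Cont⇒ℒ y∈) shorter
    where
    shorter : length (α ++ y ∷ []) ℕ.< length (α ++ x ∷ z ∷ [])
    shorter = ≡.subst₂ ℕ._<_ (≡.sym (length-++ α)) (≡.sym (length-++ α)) (ℕ.+-monoʳ-< (length α) (ℕ.n<1+n 1))
  ... | t , t∈ , αyt∈ with ∈-++⁻ α t∈
  ... | inj₁ t∈α = unique-disjoint α
    (≡.subst Unique (++-assoc α (y ∷ []) (t ∷ [])) (simple αyt∈)) t∈α (there (here ≡.refl))
  ... | inj₂ (here ≡.refl) = ∼-sym x∈ y∈ x∼y (≡.subst ℒ (++-assoc α (y ∷ []) (x ∷ [])) αyt∈)
  ... | inj₂ (there (here ≡.refl)) = y∼z (≡.subst ℒ (++-assoc α (y ∷ []) (z ∷ [])) αyt∈)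

  class-cong : ∀ {x y} → x ∈ Cont α → y ∈ Cont α → x ∼[ α ] y → class α x ≡ class α y
  class-cong {x} {y} x∈ y∈ x∼y = filter-cong _ _ (Cont α) λ {z} z∈ → does-⇔
    (mk⇔ (∼-trans y∈ x∈ (∼-sym x∈ y∈ x∼y)) (∼-trans x∈ y∈ x∼y))
    (¬? (ℒ? (α ++ x ∷ z ∷ []))) (¬? (ℒ? (α ++ y ∷ z ∷ [])))

  ∈class : ∀ {x y} → y ∈ Cont α → x ∼[ α ] y → y ∈ class α x
  ∈class {x} = ∈-filter⁺ (λ y → ¬? (ℒ? (α ++ x ∷ y ∷ [])))

  class⇒∼ : ∀ {x y} → y ∈ class α x → x ∼[ α ] y
  class⇒∼ {x} y∈ = proj₂ (∈-filter⁻ (λ y → ¬? (ℒ? (α ++ x ∷ y ∷ []))) {xs = Cont α} y∈)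

  _≟ʷ_ : (v w : Word n) → Dec (v ≡ w)
  _≟ʷ_ = ≡-dec Fin._≟_

  class∈Par : ∀ {x} → x ∈ Cont α → class α x ∈ Par α
  class∈Par x∈ = ∈-deduplicate⁺ _≟ʷ_ (∈-map⁺ (class α) x∈)

  Par⇒class : ∀ {𝒞} → 𝒞 ∈ Par α → ∃ λ y → y ∈ Cont α × 𝒞 ≡ class α y
  Par⇒class 𝒞∈ = ∈-map⁻ (class α) (∈-deduplicate⁻ _≟ʷ_ (map (class α) (Cont α)) 𝒞∈)

  class-of-member : ∀ {𝒞 x} → 𝒞 ∈ Par α → x ∈ 𝒞 → class α x ≡ 𝒞
  class-of-member 𝒞∈ x∈𝒞 with Par⇒class 𝒞∈
  ... | y , y∈ , ≡.refl = ≡.sym (class-cong y∈ (Par⇒Cont 𝒞∈ x∈𝒞) (class⇒∼ x∈𝒞))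

  -- Double counting: a letter of Cont(α) lies in exactly one class, its own, and deduplication
  -- lists that class once.
  ∑-Par : (f : Fin n → Carrier) → ∑ (Par α) (λ 𝒞 → ∑ 𝒞 f) ≈ ∑ (Cont α) f
  ∑-Par f = begin
    ∑ (Par α) (λ 𝒞 → ∑ 𝒞 f)
      ≈⟨ ∑-cong∈ (Par α) members ⟩
    ∑ (Par α) (λ 𝒞 → ∑ (Cont α) (λ x → if does (class α x ≟ʷ 𝒞) then f x else 0#))
      ≈⟨ ∑-comm (Par α) (Cont α) _ ⟩
    ∑ (Cont α) (λ x → ∑ (Par α) (λ 𝒞 → if does (class α x ≟ʷ 𝒞) then f x else 0#))
      ≈⟨ ∑-cong∈ (Cont α) (λ {x} x∈ → ∑-single (class α x ≟ʷ_)
           (deduplicate-! _≟ʷ_ (map (class α) (Cont α))) (class∈Par x∈) ≡.sym ≡.refl (f x)) ⟩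
    ∑ (Cont α) f ∎
    where
    members : ∀ {𝒞} → 𝒞 ∈ Par α → ∑ 𝒞 f ≈ ∑ (Cont α) (λ x → if does (class α x ≟ʷ 𝒞) then f x else 0#)
    members 𝒞∈ with Par⇒class 𝒞∈
    ... | y , y∈ , ≡.refl = trans (∑-filter (λ z → ¬? (ℒ? (α ++ y ∷ z ∷ []))) (Cont α) f)
      (∑-cong∈ (Cont α) λ {x} x∈ → reflexive (≡.cong (λ t → if t then f x else 0#)
        (does-⇔ (mk⇔ (λ y∼x → ≡.sym (class-cong y∈ x∈ y∼x))
                     (λ eq → class⇒∼ (≡.subst (x ∈_) eq (∈class x∈ (∼-refl x)))))
          (¬? (ℒ? (α ++ y ∷ x ∷ []))) (class α x ≟ʷ class α y))))

  ωₓ : Fin n → Carrier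
  ωₓ x = ω (α ++ x ∷ [])

  ωₓᵧ : Fin n → Fin n → Carrier
  ωₓᵧ x y = ω (α ++ x ∷ y ∷ [])

  ω-dead : ∀ {β} → ¬ ℒ β → ω β ≈ 0#
  ω-dead β∉ = trans (*-congʳ (q-zero β∉)) (zeroˡ _)

  ω-pos : ∀ {β} → ℒ β → 0# < ω β
  ω-pos β∈ = *-pos (q-pos β∈) (recip-pos (at-pos _) _)

  q≈ : ∀ β → q β ≈ at (length β) * ω β
  q≈ β = sym (begin
    at (length β) * (q β * recip (at (length β)) c#0)
      ≈⟨ solve 3 (λ c q r → c :* (q :* r) := c :* r :* q) refl (at (length β)) (q β) (recip (at (length β)) c#0) ⟩
    at (length β) * recip (at (length β)) c#0 * q β
      ≈⟨ trans (*-congʳ (recip-inverse _ _)) (*-identityˡ _) ⟩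
    q β ∎)
    where
    c#0 = <⇒# (at-pos (length β))

  c₀ c₁ c₂ : Carrier
  c₀ = at (length α)
  c₁ = at (suc (length α))
  c₂ = at (suc (suc (length α)))

  q≈₁ : ∀ x → q (α ++ x ∷ []) ≈ c₁ * ωₓ x
  q≈₁ x = trans (q≈ _) (*-congʳ (reflexive (≡.cong at (≡.trans (length-++ α) (ℕ.+-comm (length α) 1)))))

  q≈₂ : ∀ x y → q (α ++ x ∷ y ∷ []) ≈ c₂ * ωₓᵧ x y
  q≈₂ x y = trans (q≈ _) (*-congʳ (reflexive (≡.cong at (≡.trans (length-++ α) (ℕ.+-comm (length α) 2)))))

  descents : Fin n → Carrier
  descents x = ∑ (Des α x) λ y → ω α * ωₓᵧ x y

  ∑-recip : ∀ {a} {B : Set a} {s} (s#0 : s # 0#) (ys : List B) (f : B → Carrier) →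
    s * ∑ ys (λ y → f y ÷ s ⟨ s#0 ⟩) ≈ ∑ ys f
  ∑-recip {s = s} s#0 ys f = begin
    s * ∑ ys (λ y → f y * recip s s#0)  ≈⟨ *-congˡ (∑-*ʳ ys f (recip s s#0)) ⟩
    s * (∑ ys f * recip s s#0)
      ≈⟨ solve 3 (λ s t r → s :* (t :* r) := s :* r :* t) refl s (∑ ys f) (recip s s#0) ⟩
    s * recip s s#0 * ∑ ys f            ≈⟨ trans (*-congʳ (recip-inverse s s#0)) (*-identityˡ _) ⟩
    ∑ ys f                              ∎

  b-singleton : ∀ {x} (𝒞∈ : (x ∷ []) ∈ Par α) → ωₓ x * ωₓ x * b α 𝒞∈ ≈ descents x
  b-singleton {x} 𝒞∈ = ∑-recip _ (Des α x) (λ y → ω α * ωₓᵧ x y)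

  b≤1 : ∀ {𝒞} (𝒞∈ : 𝒞 ∈ Par α) → 0# ≤ 1# - b α 𝒞∈
  b≤1 {[]}         𝒞∈ = 0≤-resp (sym (x-0≈x 1#)) (<⇒≤ 0<1)
  b≤1 {x ∷ []}     𝒞∈ = *-cancelˡ-nonneg (*-pos 0<ωₓ 0<ωₓ) (0≤-resp
    (trans (+-congˡ (-‿cong (sym (b-singleton 𝒞∈))))
      (solve 2 (λ s b → s :- s :* b := s :* (con (+ 1) :- b)) refl (ωₓ x * ωₓ x) (b α 𝒞∈)))
    (≤⇒0≤- (synMon x x∈)))
    where
    x∈ : x ∈ Cont α
    x∈ = Par⇒Cont 𝒞∈ (here ≡.refl)
    0<ωₓ : 0# < ωₓ x
    0<ωₓ = ω-pos (Cont⇒ℒ x∈)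
  b≤1 {x ∷ y ∷ zs} 𝒞∈ = 0≤-resp (sym (x-0≈x 1#)) (<⇒≤ 0<1)

  -- The null row of A(α, 0). Testing the form on vectors orthogonal to it eliminates the null
  -- coordinate.
  g : Vector (suc n)
  g zero    = q α
  g (suc x) = q (α ++ x ∷ [])

  module Form (u : Vector (suc n)) where
    a v : Fin n → Carrier
    a x = u (suc x)
    v x = ωₓ x * a x

    S : Carrier
    S = sum v

    e : Fin n → Carrier
    e x = v x * ∑ (class α x) v - a x * a x * descents x

    -- `LogMod` turns ω(α) ω(αxy) into ω(αx) ω(αy) for continuing y, which would give `v x * S`.
    -- Missing are the y equivalent to x; extra are the descents, which the diagonal convention
    -- weights by `a x * a x`. The defect is `e x`.
    row : ∀ x → ℒ (α ++ x ∷ []) →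
      ω α * sum (λ y → a x * (pull α u x y * ωₓᵧ x y)) ≈ v x * S - e x
    row x αx∈ = begin
      ω α * sum (λ y → a x * (pull α u x y * ωₓᵧ x y))
        ≈⟨ sum-*ˡ (ω α) _ ⟨
      sum (λ y → ω α * (a x * (pull α u x y * ωₓᵧ x y)))
        ≈⟨ sum-cong (λ y → by y (ℒ? (α ++ y ∷ [])) (ℒ? (α ++ x ∷ y ∷ []))) ⟩
      sum (λ y → v x * v y - (v x * similar y - a x * a x * descent y))
        ≈⟨ trans (sum-- _ _) (+-cong (sum-*ˡ (v x) v) (-‿cong (trans (sum-- _ _)
             (+-cong (sum-*ˡ (v x) similar) (-‿cong (sum-*ˡ (a x * a x) descent)))))) ⟩
      v x * S - (v x * sum similar - a x * a x * sum descent)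
        ≈⟨ +-congˡ (-‿cong (+-cong (*-congˡ class-sum) (-‿cong (*-congˡ descent-sum)))) ⟩
      v x * S - e x ∎
      where
      similar descent : Fin n → Carrier
      similar y = if extends α y then (if does (¬? (ℒ? (α ++ x ∷ y ∷ []))) then v y else 0#) else 0#
      descent y = if does (ℒ? (α ++ x ∷ y ∷ []) ×-dec ¬? (ℒ? (α ++ y ∷ []))) then ω α * ωₓᵧ x y else 0#

      class-sum : sum similar ≈ ∑ (class α x) v
      class-sum = sym (trans (∑-filter (λ y → ¬? (ℒ? (α ++ x ∷ y ∷ []))) (Cont α) v) (∑-filter-allFin _ _))

      descent-sum : sum descent ≈ descents x
      descent-sum = sym (∑-filter-allFin _ _)

      by : ∀ y (d : Dec (ℒ (α ++ y ∷ []))) (f : Dec (ℒ (α ++ x ∷ y ∷ []))) →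
        ω α * (a x * ((if does d then a y else a x) * ωₓᵧ x y))
          ≈ v x * v y - (v x * (if does d then (if does (¬? f) then v y else 0#) else 0#)
                       - a x * a x * (if does (f ×-dec ¬? d) then ω α * ωₓᵧ x y else 0#))
      by y (yes αy∈) (yes αxy∈) = begin
        ω α * (a x * (a y * ωₓᵧ x y))
          ≈⟨ solve 4 (λ o a b t → o :* (a :* (b :* t)) := o :* t :* (a :* b)) refl (ω α) (a x) (a y) (ωₓᵧ x y) ⟩
        ω α * ωₓᵧ x y * (a x * a y)
          ≈⟨ *-congʳ (logMod x y (∈Cont αx∈) (∈Cont αy∈) αxy∈) ⟨
        ωₓ x * ωₓ y * (a x * a y)
          ≈⟨ solve 4 (λ o p a b → o :* p :* (a :* b) := (o :* a) :* (p :* b)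
               :- ((o :* a) :* con (+ 0) :- a :* a :* con (+ 0))) refl (ωₓ x) (ωₓ y) (a x) (a y) ⟩
        v x * v y - (v x * 0# - a x * a x * 0#) ∎
      by y (yes αy∈) (no αxy∉) = begin
        ω α * (a x * (a y * ωₓᵧ x y))
          ≈⟨ *-congˡ (*-congˡ (*-congˡ (ω-dead αxy∉))) ⟩
        ω α * (a x * (a y * 0#))
          ≈⟨ solve 5 (λ o a b v w → o :* (a :* (b :* con (+ 0))) := v :* w :- (v :* w :- a :* a :* con (+ 0)))
               refl (ω α) (a x) (a y) (v x) (v y) ⟩
        v x * v y - (v x * v y - a x * a x * 0#) ∎
      by y (no αy∉) (yes αxy∈) = begin
        ω α * (a x * (a x * ωₓᵧ x y))
          ≈⟨ solve 4 (λ o a t v → o :* (a :* (a :* t)) := v :* con (+ 0) :- (v :* con (+ 0) :- a :* a :* (o :* t)))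
               refl (ω α) (a x) (ωₓᵧ x y) (v x) ⟩
        v x * 0# - (v x * 0# - a x * a x * (ω α * ωₓᵧ x y))
          ≈⟨ +-congʳ (*-congˡ (trans (*-congʳ (ω-dead αy∉)) (zeroˡ _))) ⟨
        v x * v y - (v x * 0# - a x * a x * (ω α * ωₓᵧ x y)) ∎
      by y (no αy∉) (no αxy∉) = begin
        ω α * (a x * (a x * ωₓᵧ x y))
          ≈⟨ *-congˡ (*-congˡ (*-congˡ (ω-dead αxy∉))) ⟩
        ω α * (a x * (a x * 0#))
          ≈⟨ solve 3 (λ o a v → o :* (a :* (a :* con (+ 0))) := v :* con (+ 0) :- (v :* con (+ 0) :- a :* a :* con (+ 0)))
               refl (ω α) (a x) (v x) ⟩
        v x * 0# - (v x * 0# - a x * a x * 0#)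
          ≈⟨ +-congʳ (*-congˡ (trans (*-congʳ (ω-dead αy∉)) (zeroˡ _))) ⟨
        v x * v y - (v x * 0# - a x * a x * 0#) ∎

    E : Carrier
    E = ∑ (Cont α) e

    letters : ω α * sum (λ x → sum λ y → a x * (pull α u x y * ωₓᵧ x y)) ≈ S * S - E
    letters = begin
      ω α * sum (λ x → sum λ y → a x * (pull α u x y * ωₓᵧ x y))
        ≈⟨ sum-*ˡ (ω α) _ ⟨
      sum (λ x → ω α * sum (λ y → a x * (pull α u x y * ωₓᵧ x y)))
        ≈⟨ sum-cong (λ x → by x (ℒ? (α ++ x ∷ []))) ⟩
      sum (λ x → v x * S - (if extends α x then e x else 0#))
        ≈⟨ trans (sum-- _ _) (+-cong (sum-*ʳ S v) (-‿cong (sym (∑-filter-allFin _ _)))) ⟩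
      S * S - E ∎
      where
      by : ∀ x (d : Dec (ℒ (α ++ x ∷ []))) → ω α * sum (λ y → a x * (pull α u x y * ωₓᵧ x y))
        ≈ v x * S - (if does d then e x else 0#)
      by x (yes αx∈) = row x αx∈
      by x (no αx∉)  = begin
        ω α * sum (λ y → a x * (pull α u x y * ωₓᵧ x y))
          ≈⟨ *-congˡ (sum-zero λ y → trans (*-congˡ (trans (*-congˡ (ω-dead λ p → αx∉ (prefix∈ p))) (zeroʳ _))) (zeroʳ _)) ⟩
        ω α * 0#
          ≈⟨ solve 3 (λ o a s → o :* con (+ 0) := con (+ 0) :* a :* s :- con (+ 0)) refl (ω α) (a x) S ⟩
        0# * a x * S - 0#
          ≈⟨ +-congʳ (*-congʳ (*-congʳ (ω-dead αx∉))) ⟨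
        v x * S - 0# ∎

    -- A single letter keeps its descents, whence the factor 1 - b; in a larger class `FewDes`
    -- removes them, and all members share the class sum.
    class-energy : ∀ {𝒞} (𝒞∈ : 𝒞 ∈ Par α) → ∑ 𝒞 e ≈ (1# - b α 𝒞∈) * (∑ 𝒞 v * ∑ 𝒞 v)
    class-energy {[]} 𝒞∈ = solve 0 (con (+ 0) := (con (+ 1) :- con (+ 0)) :* (con (+ 0) :* con (+ 0))) refl
    class-energy {x ∷ []} 𝒞∈ = singleton
      where
      singleton : e x + 0# ≈ (1# - b α 𝒞∈) * ((v x + 0#) * (v x + 0#))
      singleton = begin
        v x * ∑ (class α x) v - a x * a x * descents x + 0#
          ≈⟨ +-congʳ (+-cong (*-congˡ (reflexive (≡.cong (λ 𝒟 → ∑ 𝒟 v) (class-of-member 𝒞∈ (here ≡.refl)))))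
               (-‿cong (*-congˡ (sym (b-singleton 𝒞∈))))) ⟩
        v x * (v x + 0#) - a x * a x * (ωₓ x * ωₓ x * b α 𝒞∈) + 0#
          ≈⟨ solve 3 (λ o a b → (o :* a) :* (o :* a :+ con (+ 0)) :- a :* a :* (o :* o :* b) :+ con (+ 0)
               := (con (+ 1) :- b) :* ((o :* a :+ con (+ 0)) :* (o :* a :+ con (+ 0)))) refl (ωₓ x) (a x) (b α 𝒞∈) ⟩
        (1# - b α 𝒞∈) * ((v x + 0#) * (v x + 0#)) ∎
    class-energy {𝒞@(x ∷ y ∷ zs)} 𝒞∈ = begin
      ∑ 𝒞 e
        ≈⟨ ∑-cong∈ 𝒞 (λ {z} z∈ → begin
             v z * ∑ (class α z) v - a z * a z * descents z
               ≈⟨ +-cong (*-congˡ (reflexive (≡.cong (λ 𝒟 → ∑ 𝒟 v) (class-of-member 𝒞∈ z∈))))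
                    (-‿cong (*-congˡ (reflexive (≡.cong (λ ys → ∑ ys λ y → ω α * ωₓᵧ z y)
                      (fewDes 𝒞∈ (ℕ.s≤s (ℕ.s≤s ℕ.z≤n)) z∈))))) ⟩
             v z * ∑ 𝒞 v - a z * a z * 0#
               ≈⟨ solve 3 (λ v s a → v :* s :- a :* a :* con (+ 0) := v :* s) refl (v z) (∑ 𝒞 v) (a z) ⟩
             v z * ∑ 𝒞 v ∎) ⟩
      ∑ 𝒞 (λ z → v z * ∑ 𝒞 v)
        ≈⟨ ∑-*ʳ 𝒞 v (∑ 𝒞 v) ⟩
      ∑ 𝒞 v * ∑ 𝒞 v
        ≈⟨ solve 1 (λ s → s :* s := (con (+ 1) :- con (+ 0)) :* (s :* s)) refl (∑ 𝒞 v) ⟩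
      (1# - 0#) * (∑ 𝒞 v * ∑ 𝒞 v) ∎

    E-nonneg : 0# ≤ E
    E-nonneg = 0≤-resp (∑-Par e) (∑-nonneg∈ (Par α) λ {𝒞} 𝒞∈ →
      0≤-resp (sym (class-energy 𝒞∈)) (*-nonneg (b≤1 𝒞∈) (square-nonneg (∑ 𝒞 v))))

    S≈ : ∑ (Par α) (λ 𝒞 → ∑ 𝒞 v) ≈ S
    S≈ = trans (∑-Par v) (trans (∑-filter-allFin _ v) (sum-cong λ x → by x (ℒ? (α ++ x ∷ []))))
      where
      by : ∀ x (d : Dec (ℒ (α ++ x ∷ []))) → (if does d then v x else 0#) ≈ v x
      by x (yes _)  = refl
      by x (no αx∉) = sym (trans (*-congʳ (ω-dead αx∉)) (zeroˡ _))

    0<c₀c₂ : 0# < c₀ * c₂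
    0<c₀c₂ = *-pos (at-pos _) (at-pos _)

    κ : Carrier
    κ = 1# - (c₁ * c₁) ÷ (c₀ * c₂) ⟨ <⇒# (*-pos (at-pos _) (at-pos _)) ⟩

    c₀c₂κ : c₀ * c₂ * κ ≈ c₀ * c₂ - c₁ * c₁
    c₀c₂κ = begin
      t * (1# - c₁ * c₁ * r)
        ≈⟨ solve 3 (λ t c r → t :* (con (+ 1) :- c :* c :* r) := t :- c :* c :* (t :* r)) refl t c₁ r ⟩
      t - c₁ * c₁ * (t * r)
        ≈⟨ +-congˡ (-‿cong (trans (*-congˡ (recip-inverse t _)) (*-identityʳ _))) ⟩
      t - c₁ * c₁ ∎
      where
      t = c₀ * c₂
      r = recip (c₀ * c₂) (<⇒# (*-pos (at-pos _) (at-pos _)))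

    -- Multiplied by d = 1 - b, the right side is the square of d B - κ S, where B is the class sum
    -- of `v`.
    tangent : ∀ (b<1 : ∀ {𝒞} (𝒞∈ : 𝒞 ∈ Par α) → b α 𝒞∈ < 1#) {𝒞} (𝒞∈ : 𝒞 ∈ Par α) →
      0# ≤ ∑ 𝒞 e + (κ * S) * (κ * S) * (1# ÷ (1# - b α 𝒞∈) ⟨ <⇒-#0 (b<1 𝒞∈) ⟩) - (κ * S + κ * S) * ∑ 𝒞 v
    tangent b<1 {𝒞} 𝒞∈ = *-cancelˡ-nonneg (<⇒0<- (b<1 𝒞∈)) (0≤-resp (begin
        (d * B - l) * (d * B - l)
          ≈⟨ solve 3 (λ d b l → (d :* b :- l) :* (d :* b :- l)
               := d :* (d :* (b :* b)) :+ l :* l :* con (+ 1) :- d :* ((l :+ l) :* b)) refl d B l ⟩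
        d * (d * (B * B)) + l * l * 1# - d * ((l + l) * B)
          ≈⟨ +-congʳ (+-cong (*-congˡ (class-energy 𝒞∈)) (*-congˡ (recip-inverse d _))) ⟨
        d * ∑ 𝒞 e + l * l * (d * r) - d * ((l + l) * B)
          ≈⟨ solve 5 (λ d e l r b → d :* e :+ l :* l :* (d :* r) :- d :* ((l :+ l) :* b)
               := d :* (e :+ l :* l :* (con (+ 1) :* r) :- (l :+ l) :* b)) refl d (∑ 𝒞 e) l r B ⟩
        d * (∑ 𝒞 e + l * l * (1# * r) - (l + l) * B) ∎)
      (square-nonneg (d * B - l)))
      where
      d = 1# - b α 𝒞∈
      r = recip d (<⇒-#0 (b<1 𝒞∈))
      B = ∑ 𝒞 v
      l = κ * S

    -- With E = Σ (1 - b) B² and S = Σ B over the classes, Cauchy-Schwarz gives S² ≤ E Σ 1/(1 - b),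
    -- and `ScaleMon` bounds κ Σ 1/(1 - b) by 1, so κ S² ≤ E. The tangent form with multiplier κ S
    -- yields this without a further division. If c₁² ≥ c₀ c₂, nonnegativity of E is enough.
    energy-bound : c₀ * c₂ * (S * S - E) ≤ c₁ * c₁ * (S * S)
    energy-bound = split {P = c₁ * c₁ < c₀ * c₂} small large
      where
      large : ¬ (c₁ * c₁ < c₀ * c₂) → c₀ * c₂ * (S * S - E) ≤ c₁ * c₁ * (S * S)
      large c₀c₂≤c₁² = ≤-by
        (+-nonneg (*-nonneg (≤⇒0≤- c₀c₂≤c₁²) (square-nonneg S)) (*-nonneg (<⇒≤ 0<c₀c₂) E-nonneg))
        (solve 4 (λ c t s e → c :* (s :* s) :- t :* (s :* s :- e) := (c :- t) :* (s :* s) :+ t :* e)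
          refl (c₁ * c₁) (c₀ * c₂) S E)

      small : c₁ * c₁ < c₀ * c₂ → c₀ * c₂ * (S * S - E) ≤ c₁ * c₁ * (S * S)
      small c₁²<c₀c₂ with scaleMon c₁²<c₀c₂
      ... | b<1 , κΣρ≤1 = ≤-by (*-nonneg (<⇒≤ 0<c₀c₂) κS²≤E) (begin
          c₁ * c₁ * (S * S) - c₀ * c₂ * (S * S - E)
            ≈⟨ solve 4 (λ c t s e → c :* (s :* s) :- t :* (s :* s :- e) := t :* e :- (t :- c) :* (s :* s))
                 refl (c₁ * c₁) (c₀ * c₂) S E ⟩
          c₀ * c₂ * E - (c₀ * c₂ - c₁ * c₁) * (S * S)
            ≈⟨ +-congˡ (-‿cong (*-congʳ c₀c₂κ)) ⟨
          c₀ * c₂ * E - c₀ * c₂ * κ * (S * S)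
            ≈⟨ solve 4 (λ t e k s → t :* e :- t :* k :* (s :* s) := t :* (e :- k :* (s :* s))) refl (c₀ * c₂) E κ S ⟩
          c₀ * c₂ * (E - κ * (S * S)) ∎)
        where
        Σρ : Carrier
        Σρ = ∑∈ (Par α) (λ 𝒞∈ → 1# ÷ (1# - b α 𝒞∈) ⟨ <⇒-#0 (b<1 𝒞∈) ⟩)

        0≤κ : 0# ≤ κ
        0≤κ = *-cancelˡ-nonneg 0<c₀c₂ (0≤-resp (sym c₀c₂κ) (<⇒≤ (<⇒0<- c₁²<c₀c₂)))

        tangents : 0# ≤ E + (κ * S) * (κ * S) * Σρ - (κ * S + κ * S) * S
        tangents = 0≤-resp (+-cong (+-congʳ (∑-Par e)) (-‿cong (*-congˡ S≈)))
          (∑∈-tangent (κ * S) (Par α) (λ 𝒞 → ∑ 𝒞 v) (λ 𝒞 → ∑ 𝒞 e) _ (tangent b<1))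

        κS²≤E : 0# ≤ E - κ * (S * S)
        κS²≤E = 0≤-resp
          (solve 4 (λ e k s r → (e :+ (k :* s) :* (k :* s) :* r :- (k :* s :+ k :* s) :* s)
               :+ k :* (s :* s) :* (con (+ 1) :- k :* r) := e :- k :* (s :* s)) refl E κ S Σρ)
          (+-nonneg tangents (*-nonneg (*-nonneg 0≤κ (square-nonneg S)) (≤⇒0≤- κΣρ≤1)))

    W-empty : W α [] 0 ≈ q α
    W-empty = trans (W-zero α []) (reflexive (≡.cong q (++-identityʳ α)))

    -- Orthogonality to `g` makes the null row vanish and gives -N for q(α) times the null
    -- coordinate, so after multiplication by q(α) the remaining mixed term is -N².
    quadratic-expansion : sum (λ i → g i * u i) ≈ 0# →
      q α * quadratic (A α 0) u ≈ c₀ * c₂ * (S * S - E) - c₁ * c₁ * (S * S)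
    quadratic-expansion gu≈0 = begin
      q α * quadratic (A α 0) u
        ≈⟨ *-congˡ (trans (sum-suc _) (+-cong null (trans (sum-cong letter) (trans (sum-+ _ _) (+-congʳ (sum-*ˡ (u zero) _)))))) ⟩
      q α * (u zero * 0# + (u zero * N + M))
        ≈⟨ solve 4 (λ q u n m → q :* (u :* con (+ 0) :+ (u :* n :+ m)) := q :* m :+ (q :* u :+ n) :* n :- n :* n)
             refl (q α) (u zero) N M ⟩
      q α * M + (q α * u zero + N) * N - N * N
        ≈⟨ +-cong (+-cong qM (trans (*-congʳ (trans (sym (sum-suc _)) gu≈0)) (zeroˡ _))) (-‿cong (*-cong N≈ N≈)) ⟩
      c₀ * c₂ * (S * S - E) + 0# - c₁ * S * (c₁ * S)
        ≈⟨ solve 3 (λ x c s → x :+ con (+ 0) :- c :* s :* (c :* s) := x :- c :* c :* (s :* s)) refl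
             (c₀ * c₂ * (S * S - E)) c₁ S ⟩
      c₀ * c₂ * (S * S - E) - c₁ * c₁ * (S * S) ∎
      where
      N M : Carrier
      N = sum λ x → q (α ++ x ∷ []) * a x
      M = sum λ x → a x * sum λ y → pull α u x y * q (α ++ x ∷ y ∷ [])

      null : u zero * apply (A α 0) u zero ≈ u zero * 0#
      null = *-congˡ (trans (apply-null α 0 u) (trans
        (+-cong (trans (*-comm _ _) (*-congʳ W-empty)) (sum-cong λ x → trans (*-comm _ _) (*-congʳ (W-zero α (x ∷ [])))))
        (trans (sym (sum-suc _)) gu≈0)))

      letter : ∀ x → a x * apply (A α 0) u (suc x)
        ≈ u zero * (q (α ++ x ∷ []) * a x) + a x * sum (λ y → pull α u x y * q (α ++ x ∷ y ∷ []))
      letter x = trans (*-congˡ (trans (apply-letter α 0 u x)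
          (+-cong (*-congˡ (W-zero α (x ∷ []))) (sum-cong λ y → *-congˡ (W-zero α (x ∷ y ∷ []))))))
        (solve 4 (λ a u q s → a :* (u :* q :+ s) := u :* (q :* a) :+ a :* s) refl
          (a x) (u zero) (q (α ++ x ∷ [])) (sum λ y → pull α u x y * q (α ++ x ∷ y ∷ [])))

      N≈ : N ≈ c₁ * S
      N≈ = trans (sum-cong λ x → trans (*-congʳ (q≈₁ x)) (*-assoc _ _ _)) (sum-*ˡ c₁ v)

      M≈ : M ≈ c₂ * sum (λ x → sum λ y → a x * (pull α u x y * ωₓᵧ x y))
      M≈ = trans (sum-cong λ x → trans (sym (sum-*ˡ (a x) _)) (trans
          (sum-cong λ y → trans (*-congˡ (*-congˡ (q≈₂ x y)))
            (solve 4 (λ a p c o → a :* (p :* (c :* o)) := c :* (a :* (p :* o))) refl (a x) (pull α u x y) c₂ (ωₓᵧ x y)))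
          (sum-*ˡ c₂ _)))
        (sum-*ˡ c₂ _)

      qM : q α * M ≈ c₀ * c₂ * (S * S - E)
      qM = trans (*-cong (q≈ α) M≈) (trans
        (solve 4 (λ c o d t → c :* o :* (d :* t) := c :* d :* (o :* t)) refl c₀ (ω α) c₂
          (sum λ x → sum λ y → a x * (pull α u x y * ωₓᵧ x y)))
        (*-congˡ letters))

    quadratic≤0 : sum (λ i → g i * u i) ≈ 0# → quadratic (A α 0) u ≤ 0#
    quadratic≤0 gu≈0 = 0≤-⇒≤ (*-cancelˡ-nonneg (q-pos α∈) (0≤-resp (begin
      c₁ * c₁ * (S * S) - c₀ * c₂ * (S * S - E)
        ≈⟨ solve 2 (λ x y → x :- y := :- (y :- x)) refl (c₁ * c₁ * (S * S)) (c₀ * c₂ * (S * S - E)) ⟩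
      - (c₀ * c₂ * (S * S - E) - c₁ * c₁ * (S * S))
        ≈⟨ -‿cong (quadratic-expansion gu≈0) ⟨
      - (q α * quadratic (A α 0) u)
        ≈⟨ solve 2 (λ q x → :- (q :* x) := q :* (con (+ 0) :- x)) refl (q α) (quadratic (A α 0) u) ⟩
      q α * (0# - quadratic (A α 0) u) ∎)
      (≤⇒0≤- energy-bound)))

  hyperbolic-base : (∀ i j → A α 0 i j ≈ A α 0 j i) → Hyperbolic (A α 0)
  hyperbolic-base A-sym = lorentzian⇒hyperbolic A-sym g Form.quadratic≤0

-- Log-concavity from the matrix at the empty word.

module LogConcavity {c ℓ₁ ℓ₂ n ℓ} (ℛ : Reals c ℓ₁ ℓ₂) (𝒢 : Greedoid n ℓ) (interval : IsInterval 𝒢)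
  {rank k : ℕ} (hasRank : HasRank 𝒢 rank) (k<rank : suc k ℕ.< rank)
  (weight : Weighted.Weight ℛ 𝒢) (admissible : Weighted.Admissible ℛ 𝒢 (suc k) weight) where
  open OrderedField ℛ
  open LinearAlgebra ℛ
  open Hyperbolicity ℛ
  open Greedoid 𝒢 using (empty)
  open Weighted ℛ 𝒢
  open Admissible admissible
  open Continuations ℛ 𝒢 weight
  open InductiveStep ℛ 𝒢 weight scale (suc k) interval contInv paMon
  open import Relation.Binary.Reasoning.Setoid setoid

  hyperbolic : Hyperbolic (A [] k)
  hyperbolic = hyperbolic-induction hasRank k<rank
    (λ α∈ <k → BaseCase.hyperbolic-base ℛ 𝒢 weight scale α∈ (contInv α∈ <k) (logMod α∈ <k)
      (fewDes α∈ <k) (synMon α∈ <k) (scaleMon α∈ <k) (A-sym α∈ <k 0))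
    -- Here `k` is one less than the index of admissibility, so m = k at the empty word is the
    -- largest value that the induction reaches.
    k empty (ℕ.n<1+n k)

  letters null : Vector (suc n)
  letters zero    = 0#
  letters (suc x) = 1#
  -- At e = 0 the vector is the unit vector of null, and `apply-H` yields its image.
  null = H 0#

  apply-null-vector : ∀ i → apply (A [] k) null i ≈ A [] k i zero
  apply-null-vector i = trans (apply-H [] k 0# i) (trans (+-congʳ (zeroˡ _)) (+-identityˡ _))

  pull-letters : ∀ x y → pull [] letters x y ≈ 1#
  pull-letters x y with extends [] y
  ... | true  = refl
  ... | false = refl

  apply-letters : ∀ x → apply (A [] k) letters (suc x) ≈ W [] (x ∷ []) (suc k)
  apply-letters x = begin
    apply (A [] k) letters (suc x)
      ≈⟨ apply-letter [] k letters x ⟩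
    0# * W [] (x ∷ []) k + sum (λ y → pull [] letters x y * W [] (x ∷ y ∷ []) k)
      ≈⟨ +-cong (zeroˡ _) (sum-cong λ y → trans (*-congʳ (pull-letters x y)) (*-identityˡ _)) ⟩
    0# + sum (λ y → W [] (x ∷ y ∷ []) k)
      ≈⟨ trans (+-identityˡ _) (sym (W-suc [] (x ∷ []) k)) ⟩
    W [] (x ∷ []) (suc k) ∎

  sum-letters : ∀ (f : Vector (suc n)) → sum (λ i → letters i * f i) ≈ sum (λ x → f (suc x))
  sum-letters f = trans (sum-suc _)
    (trans (+-cong (zeroˡ _) (sum-cong λ x → *-identityˡ _)) (+-identityˡ _))

  quadratic-null : quadratic (A [] k) null ≈ L weight k
  quadratic-null = begin
    quadratic (A [] k) null
      ≈⟨ trans (sum-suc _) (+-cong (trans (*-identityˡ _) (apply-null-vector zero)) (sum-zero λ x → zeroˡ _)) ⟩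
    W [] [] k + 0#
      ≈⟨ trans (+-identityʳ _) (sym (L≈W k)) ⟩
    L weight k ∎

  bilinear-letters-null : bilinear (A [] k) letters null ≈ L weight (suc k)
  bilinear-letters-null = begin
    bilinear (A [] k) letters null     ≈⟨ trans (sum-letters _) (sum-cong λ x → apply-null-vector (suc x)) ⟩
    sum (λ x → W [] (x ∷ []) k)        ≈⟨ W-suc [] [] k ⟨
    W [] [] (suc k)                    ≈⟨ L≈W (suc k) ⟨
    L weight (suc k)                   ∎

  quadratic-letters : quadratic (A [] k) letters ≈ L weight (suc (suc k))
  quadratic-letters = begin
    quadratic (A [] k) letters         ≈⟨ trans (sum-letters _) (sum-cong apply-letters) ⟩
    sum (λ x → W [] (x ∷ []) (suc k))  ≈⟨ W-suc [] [] (suc k) ⟨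
    W [] [] (suc (suc k))              ≈⟨ L≈W (suc (suc k)) ⟨
    L weight (suc (suc k))             ∎

  log-concave : L weight k * L weight (suc (suc k)) ≤ L weight (suc k) * L weight (suc k)
  log-concave = ≤-resp
    (trans (*-comm _ _) (*-cong quadratic-null quadratic-letters))
    (*-cong bilinear-letters-null bilinear-letters-null)
    (hyperbolic letters null (0≤-resp (sym (trans quadratic-null (L≈W k))) (W-nonneg [] [] k)))

theorem1p31 : ∀ {c ℓ₁ ℓ₂ ℓ : Level} (ℛ : Reals c ℓ₁ ℓ₂) {n : ℕ} (𝒢 : Greedoid n ℓ) →
    IsInterval 𝒢 →
    ∀ {m k : ℕ} → HasRank 𝒢 m → 1 ≤ℕ k → k <ℕ m →
    let open Reals ℛ
        open Weighted ℛ 𝒢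
    in (q : Weight) → Admissible k q →
       L q (k ∸ 1) * L q (suc k) ≤ L q k * L q k
theorem1p31 ℛ 𝒢 interval {k = suc k} hasRank _ k<m q admissible =
  LogConcavity.log-concave ℛ 𝒢 interval hasRank k<m q admissible
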